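{- Let $m,s$ be such that $m/\gcd(m,s)$ is even, let $d=\gcd(m,s)$, and let $0\neq l\in L^*\setminus(L^*)^{\sigma-1}$. Then for every legitimate quadruple $t$ the presemifield $B(2,m,s,l,t)$ belongs to the C-family. The group $G_1=GL(2,L)\times L^*$ has exactly $2^{d-1}$ orbits on the set $\Omega(m,s)$ of legitimate quadruples.
   Context: A (finite) presemifield is a finite additive abelian group with a multiplication that is distributive on both sides over addition and has no zero divisors. Two presemifields $(F,+,*)$ and $(F,+,\circ)$ are isotopic if there are additive bijections $\alpha_1,\alpha_2,\beta$ with $\beta(\alpha_1(x)*\alpha_2(y))=x\circ y$ for all $x,y$. Let $m\ge 1$, $L=GF(2^m)$, $0\le s<2m$, $\sigma=2^s$, $(L^*)^{\sigma-1}=\{u^{\sigma-1}:u\in L^*\}$. A quadruple $t=[p_1,p_2,p_3,p_4]\in L^4$ is legitimate if $p_1\neq0$ and $p_1X^{\sigma+1}+p_2X^{\sigma}+p_3X+p_4$ has no root in $L$; $\Omega(m,s)$ is the set of legitimate quadruples. For legitimate $t$ and for $l=0$ or $l\in L^*\setminus(L^*)^{\sigma-1}$, $B(2,m,s,l,t)$ is the presemifield on $L\times L$ with multiplication $$(a,b)\circ(c,d)=(p_1ac^{\sigma}+lp_1a^{\sigma}c+p_2bc^{\sigma}+lp_2a^{\sigma}d+p_3ad^{\sigma}+lp_3b^{\sigma}c+p_4bd^{\sigma}+lp_4b^{\sigma}d,\ ad+bc).$$ For given $m,s$, the C-family consists of the (pre)semifields isotopic to some $B(2,m,s,l,[1,0,0,p_4])$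 with $l\neq0$ (and $[1,0,0,p_4]$ legitimate). The group $G_1=GL(2,L)\times L^*$ acts on $\Omega(m,s)$ as follows: $\lambda\in L^*$ maps $[p_1,p_2,p_3,p_4]$ to $[\lambda p_1,\lambda p_2,\lambda p_3,\lambda p_4]$, and $\begin{pmatrix}\alpha&\beta\\ \gamma&\delta\end{pmatrix}\in GL(2,L)$ maps it to $[p_1',p_2',p_3',p_4']$ where $p_1'=\alpha^{\sigma+1}p_1+\alpha^{\sigma}\gamma p_2+\alpha\gamma^{\sigma}p_3+\gamma^{\sigma+1}p_4$, $p_2'=\alpha^{\sigma}\beta p_1+\alpha^{\sigma}\delta p_2+\beta\gamma^{\sigma}p_3+\gamma^{\sigma}\delta p_4$, $p_3'=\alpha\beta^{\sigma}p_1+\beta^{\sigma}\gamma p_2+\alpha\delta^{\sigma}p_3+\gamma\delta^{\sigma}p_4$, $p_4'=\beta^{\sigma+1}p_1+\beta^{\sigma}\delta p_2+\beta\delta^{\sigma}p_3+\delta^{\sigma+1}p_4$. -}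

module Defs where

open import Algebra.Bundles using (AbelianGroup; CommutativeMonoid; CommutativeRing; Group)
open import Algebra.Definitions using (Invertible; _DistributesOver_; Congruent₂)
open import Algebra.Morphism.Structures using (module GroupMorphisms)
open import Algebra.Structures using (IsCommutativeRing)
open import Data.Fin.Base using (Fin)
open import Data.Fin.Permutation using (permutation)
open import Data.Fin.Properties using (*↔×)
open import Data.Nat.Base as ℕ using (ℕ; zero; suc; NonZero)
open import Data.Nat.GCD using (gcd; gcd[m,n]≢0)
open import Data.Product.Base using (Σ; Σ-syntax; ∃-syntax; _×_; _,_; proj₁; proj₂)
open import Data.Product.Function.NonDependent.Propositional using (_×-↔_)
open import Data.Product.Properties using (,-injective)
open import Data.Sum.Base using (_⊎_; inj₁; inj₂)
open import Function.Base using (_∘_; _on_; _$_)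
open import Function.Bundles using (Inverse)
open import Function.Construct.Composition using (_↔-∘_)
open import Function.Construct.Symmetry using (↔-sym)
open import Function.Properties.Inverse using (↔⇒↣)
open import Level using (Level; _⊔_)
open import Relation.Binary.Bundles using (Setoid)
open import Relation.Binary.Construct.On using (isEquivalence)
open import Relation.Binary.Definitions using (DecidableEquality)
open import Relation.Binary.PropositionalEquality
  using (_≡_; _≢_; refl; sym; trans; cong; cong₂; module ≡-Reasoning)
open import Relation.Nullary using (¬_; Dec; yes; no; contradiction)
open import Relation.Nullary.Decidable using (via-injection)
import Algebra.Construct.DirectProduct as DirectProduct
import Algebra.Properties.CommutativeMonoid.Sum as CommutativeMonoidSum
import Algebra.Properties.CommutativeSemigroup as CommutativeSemigroup
import Algebra.Properties.CommutativeSemiring.Exp as Exp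
import Algebra.Properties.Group as GroupProperties
import Algebra.Properties.Semiring.Mult as Mult
import Algebra.Solver.Ring.NaturalCoefficients.Default as NaturalSolver
import Data.Fin.Properties as Fin
import Data.Nat.Properties as ℕ
import Relation.Binary.PropositionalEquality.Properties as ≡

private variable
  c ℓ : Level

-- For a setoid this counts equivalence classes.
HasCardinality : Setoid c ℓ → ℕ → Set (c ⊔ ℓ)
HasCardinality S n = Inverse S (≡.setoid (Fin n))

gcd-nonZero : ∀ m n → .{{_ : NonZero m}} → NonZero (gcd m n)
gcd-nonZero m n = ℕ.≢-nonZero (gcd[m,n]≢0 m n (inj₁ (ℕ.≢-nonZero⁻¹ m)))

record Presemifield (F : AbelianGroup c ℓ) : Set (c ⊔ ℓ) where
  open AbelianGroup F renaming (_∙_ to _+_; ε to 0#)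
  infixl 7 _*_
  field
    finite         : ∃[ n ] HasCardinality setoid n
    _*_            : Carrier → Carrier → Carrier
    *-cong         : Congruent₂ _≈_ _*_
    distrib        : _DistributesOver_ _≈_ _*_ _+_
    noZeroDivisors : ∀ {x y} → x * y ≈ 0# → x ≈ 0# ⊎ y ≈ 0#

module _ {F : AbelianGroup c ℓ} where
  open AbelianGroup F using (Carrier; _≈_; rawGroup)
  open GroupMorphisms rawGroup rawGroup using (IsGroupIsomorphism)

  Isotopic : Presemifield F → Presemifield F → Set (c ⊔ ℓ)
  Isotopic P Q =
    Σ[ α₁ ∈ (Carrier → Carrier) ] Σ[ α₂ ∈ (Carrier → Carrier) ] Σ[ β ∈ (Carrier → Carrier) ]
      IsGroupIsomorphism α₁ × IsGroupIsomorphism α₂ × IsGroupIsomorphism β ×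
      (∀ x y → β (α₁ x P.* α₂ y) ≈ x Q.* y)
    where
    module P = Presemifield P
    module Q = Presemifield Q

-- GF(q) is unique up to isomorphism, so it is represented by an arbitrary field
-- with q elements.
record FiniteField (q : ℕ) : Set₁ where
  infix  8 -_
  infixl 7 _*_
  infixl 6 _+_
  field
    Carrier           : Set
    _+_ _*_           : Carrier → Carrier → Carrier
    -_                : Carrier → Carrier
    0# 1#             : Carrier
    isCommutativeRing : IsCommutativeRing _≡_ _+_ _*_ -_ 0# 1#
    1≢0               : 1# ≢ 0#
    invertible        : ∀ {x} → x ≢ 0# → Invertible _≡_ 1# _*_ x
    cardinality       : HasCardinality (≡.setoid Carrier) q

  commutativeRing : CommutativeRing _ _
  commutativeRing = record { isCommutativeRing = isCommutativeRing }

  open CommutativeRing commutativeRing public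
    using (_-_; +-comm; +-identityˡ; +-identityʳ; *-comm; *-assoc;
           *-identityˡ; *-identityʳ; zeroˡ; zeroʳ; distribˡ; distribʳ;
           -‿inverseʳ; +-abelianGroup; +-group; +-commutativeMonoid;
           semiring; commutativeSemiring)
  open Exp commutativeSemiring public using (_^_; ^-homo-*; ^-distrib-*)

  _≟_ : DecidableEquality Carrier
  _≟_ = via-injection (↔⇒↣ cardinality) Fin._≟_

  -- The value 0⁻¹ = 0 is a convention.
  _⁻¹ : Carrier → Carrier
  x ⁻¹ with x ≟ 0#
  ... | yes _  = 0#
  ... | no x≢0 = proj₁ (invertible x≢0)

  ⁻¹-inverseˡ : ∀ {x} → x ≢ 0# → x ⁻¹ * x ≡ 1#
  ⁻¹-inverseˡ {x} x≢0 with x ≟ 0#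
  ... | yes x≡0 = contradiction x≡0 x≢0
  ... | no x≢0′ = proj₁ (proj₂ (invertible x≢0′))

  ⁻¹-inverseʳ : ∀ {x} → x ≢ 0# → x * x ⁻¹ ≡ 1#
  ⁻¹-inverseʳ {x} x≢0 = trans (*-comm x (x ⁻¹)) (⁻¹-inverseˡ x≢0)

  *-nonZero : ∀ {x y} → x ≢ 0# → y ≢ 0# → x * y ≢ 0#
  *-nonZero {x} {y} x≢0 y≢0 xy≡0 = y≢0 $ begin
    y               ≡⟨ *-identityˡ y ⟨
    1# * y          ≡⟨ cong (_* y) (⁻¹-inverseˡ x≢0) ⟨
    x ⁻¹ * x * y    ≡⟨ *-assoc (x ⁻¹) x y ⟩
    x ⁻¹ * (x * y)  ≡⟨ cong (x ⁻¹ *_) xy≡0 ⟩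
    x ⁻¹ * 0#       ≡⟨ zeroʳ (x ⁻¹) ⟩
    0#              ∎
    where open ≡-Reasoning

  ⁻¹-nonZero : ∀ {x} → x ≢ 0# → x ⁻¹ ≢ 0#
  ⁻¹-nonZero {x} x≢0 x⁻¹≡0 = 1≢0 $ begin
    1#        ≡⟨ ⁻¹-inverseˡ x≢0 ⟨
    x ⁻¹ * x  ≡⟨ cong (_* x) x⁻¹≡0 ⟩
    0# * x    ≡⟨ zeroˡ x ⟩
    0#        ∎
    where open ≡-Reasoning

  ^-nonZero : ∀ {x} n → x ≢ 0# → x ^ n ≢ 0#
  ^-nonZero zero    x≢0 = 1≢0
  ^-nonZero (suc n) x≢0 = *-nonZero x≢0 (^-nonZero n x≢0)

  ^-suc : ∀ x n → x ^ (n ℕ.+ 1) ≡ x ^ n * x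
  ^-suc x n = trans (^-homo-* x n 1) (cong (x ^ n *_) (*-identityʳ x))

  open Mult semiring using () renaming (_×_ to _·_)

  -- Translation by 1 permutes the field, so q · 1 = 0.
  q·1≡0 : q · 1# ≡ 0#
  q·1≡0 = sym $ ∙-cancelˡ (sum from) 0# (q · 1#) $ begin
    sum from + 0#                  ≡⟨ +-identityʳ (sum from) ⟩
    sum from                       ≡⟨ sum-permute from π ⟩
    sum (λ i → from (to (from i + 1#)))
                                   ≡⟨ sum-cong-≗ (λ i → strictlyInverseʳ (from i + 1#)) ⟩
    sum (λ i → from i + 1#)        ≡⟨ ∑-distrib-+ from (λ _ → 1#) ⟩
    sum from + sum {q} (λ _ → 1#)  ≡⟨ cong (sum from +_) (sum-replicate q) ⟩
    sum from + q · 1#              ∎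
    where
    open ≡-Reasoning
    open Inverse cardinality
    open CommutativeMonoidSum +-commutativeMonoid
    open GroupProperties +-group using (∙-cancelˡ)
    minus-plus : ∀ x → x - 1# + 1# ≡ x
    minus-plus x = trans (CommutativeRing.+-assoc commutativeRing x (- 1#) 1#)
      (trans (cong (x +_) (trans (+-comm (- 1#) 1#) (-‿inverseʳ 1#))) (+-identityʳ x))
    plus-minus : ∀ x → x + 1# - 1# ≡ x
    plus-minus x = trans (CommutativeRing.+-assoc commutativeRing x 1# (- 1#))
      (trans (cong (x +_) (-‿inverseʳ 1#)) (+-identityʳ x))
    π = permutation (λ i → to (from i + 1#)) (λ i → to (from i - 1#))
      (λ i → trans (cong (λ x → to (x + 1#)) (strictlyInverseʳ (from i - 1#)))
               (trans (cong to (minus-plus (from i))) (strictlyInverseˡ i)))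
      (λ i → trans (cong (λ x → to (x - 1#)) (strictlyInverseʳ (from i + 1#)))
               (trans (cong to (plus-minus (from i))) (strictlyInverseˡ i)))

module FamilyB {m : ℕ} (L : FiniteField (2 ℕ.^ m)) (s : ℕ) where

  open FiniteField L

  private
    open module Solver = NaturalSolver commutativeSemiring using (solve; con; _:=_; _:+_; _:*_)

  σ : ℕ
  σ = 2 ℕ.^ s

  -- Membership in (L*)^{σ-1}; ∸ does not truncate since σ ≥ 1.
  IsPower : Carrier → Set
  IsPower l = ∃[ u ] u ≢ 0# × u ^ (σ ℕ.∸ 1) ≡ l

  Admissible : Carrier → Set
  Admissible l = l ≡ 0# ⊎ (l ≢ 0# × ¬ IsPower l)

  record Quadruple : Set where
    constructor [_,_,_,_]
    field
      p₁ p₂ p₃ p₄ : Carrier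

  Legitimate : Quadruple → Set
  Legitimate [ p₁ , p₂ , p₃ , p₄ ] =
    p₁ ≢ 0# × ¬ (∃[ x ] p₁ * x ^ (σ ℕ.+ 1) + p₂ * x ^ σ + p₃ * x + p₄ ≡ 0#)

  Ω : Set
  Ω = Σ Quadruple Legitimate

  L×L : AbelianGroup _ _
  L×L = DirectProduct.abelianGroup +-abelianGroup +-abelianGroup

  product : Carrier → Quadruple → Carrier × Carrier → Carrier × Carrier → Carrier × Carrier
  product l [ p₁ , p₂ , p₃ , p₄ ] (a , b) (c , d) =
    p₁ * a * c ^ σ + l * p₁ * a ^ σ * c + p₂ * b * c ^ σ + l * p₂ * a ^ σ * d
      + p₃ * a * d ^ σ + l * p₃ * b ^ σ * c + p₄ * b * d ^ σ + l * p₄ * b ^ σ * d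
    , a * d + b * c

  1+1≡0 : 1# + 1# ≡ 0#
  1+1≡0 with (1# + 1#) ≟ 0#
  ... | yes 1+1≡0 = 1+1≡0
  ... | no  1+1≢0 = contradiction q·1≡0 (powers m)
    where
    open Mult semiring using () renaming (_×_ to _·_; ×1-homo-* to ·1-homo-*)
    powers : ∀ k → (2 ℕ.^ k) · 1# ≢ 0#
    powers zero    eq = 1≢0 (trans (sym (+-identityʳ 1#)) eq)
    powers (suc k) eq = *-nonZero 2·1≢0 (powers k)
      (trans (sym (·1-homo-* 2 (2 ℕ.^ k))) eq)
      where
      2·1≢0 : 2 · 1# ≢ 0#
      2·1≢0 = 1+1≢0 ∘ trans (cong (1# +_) (sym (+-identityʳ 1#)))

  x+x≡0 : ∀ x → x + x ≡ 0#
  x+x≡0 x = begin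
    x + x            ≡⟨ cong₂ _+_ (*-identityʳ x) (*-identityʳ x) ⟨
    x * 1# + x * 1#  ≡⟨ distribˡ x 1# 1# ⟨
    x * (1# + 1#)    ≡⟨ cong (x *_) 1+1≡0 ⟩
    x * 0#           ≡⟨ zeroʳ x ⟩
    0#               ∎
    where open ≡-Reasoning

  x+[y+y]≡x : ∀ x y → x + (y + y) ≡ x
  x+[y+y]≡x x y = trans (cong (x +_) (x+x≡0 y)) (+-identityʳ x)

  -x≡x : ∀ x → - x ≡ x
  -x≡x x = sym (inverseˡ-unique x x (x+x≡0 x))
    where open GroupProperties +-group using (inverseˡ-unique)

  x+y≡0⇒x≡y : ∀ {x y} → x + y ≡ 0# → x ≡ y
  x+y≡0⇒x≡y {x} {y} eq = trans (inverseˡ-unique x y eq) (-x≡x y)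
    where open GroupProperties +-group using (inverseˡ-unique)

  ^σ-+ : ∀ x y → (x + y) ^ σ ≡ x ^ σ + y ^ σ
  ^σ-+ x y = go s
    where
    open ≡-Reasoning
    double : ∀ z k → z ^ (2 ℕ.* k) ≡ z ^ k * z ^ k
    double z k = trans (cong (z ^_) (cong (k ℕ.+_) (ℕ.+-identityʳ k))) (^-homo-* z k k)
    go : ∀ k → (x + y) ^ (2 ℕ.^ k) ≡ x ^ (2 ℕ.^ k) + y ^ (2 ℕ.^ k)
    go zero    = trans (*-identityʳ (x + y)) (sym (cong₂ _+_ (*-identityʳ x) (*-identityʳ y)))
    go (suc k) = begin
      (x + y) ^ (2 ℕ.* n)             ≡⟨ double (x + y) n ⟩
      (x + y) ^ n * (x + y) ^ n       ≡⟨ cong₂ _*_ (go k) (go k) ⟩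
      (x̂ + ŷ) * (x̂ + ŷ)               ≡⟨ solve 2 (λ u v →
        (u :+ v) :* (u :+ v) := (u :* u :+ v :* v) :+ (u :* v :+ u :* v)) refl x̂ ŷ ⟩
      x̂ * x̂ + ŷ * ŷ + (x̂ * ŷ + x̂ * ŷ) ≡⟨ x+[y+y]≡x _ _ ⟩
      x̂ * x̂ + ŷ * ŷ                   ≡⟨ cong₂ _+_ (double x n) (double y n) ⟨
      x ^ (2 ℕ.* n) + y ^ (2 ℕ.* n)   ∎
      where
      n = 2 ℕ.^ k
      x̂ = x ^ n
      ŷ = y ^ n

  0^n≡0 : ∀ n → .{{NonZero n}} → 0# ^ n ≡ 0#
  0^n≡0 (suc n) = zeroˡ (0# ^ n)

  ^σ-* : ∀ x y → (x * y) ^ σ ≡ x ^ σ * y ^ σ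
  ^σ-* x y = ^-distrib-* x y σ

  0^σ≡0 : 0# ^ σ ≡ 0#
  0^σ≡0 = 0^n≡0 σ {{ℕ.m^n≢0 2 s}}

  1^σ≡1 : 1# ^ σ ≡ 1#
  1^σ≡1 = go σ
    where
    go : ∀ n → 1# ^ n ≡ 1#
    go zero    = refl
    go (suc n) = trans (*-identityˡ (1# ^ n)) (go n)

  ^σ-split : ∀ x → x ^ σ ≡ x ^ (σ ℕ.∸ 1) * x
  ^σ-split x = trans (cong (x ^_) (sym (ℕ.m∸n+n≡m {σ} {1} (ℕ.m^n>0 2 s)))) (^-suc x (σ ℕ.∸ 1))

  -- Values of the form p₁ X^{σ+1} + p₂ X^σ Y + p₃ X Y^σ + p₄ Y^{σ+1}, with
  -- X^σ and Y^σ replaced by independent arguments.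

  bilinear : Quadruple → (x̂ ŷ x y : Carrier) → Carrier
  bilinear [ p₁ , p₂ , p₃ , p₄ ] x̂ ŷ x y =
    p₁ * (x̂ * x) + p₂ * (x̂ * y) + p₃ * (ŷ * x) + p₄ * (ŷ * y)

  form : Quadruple → (x y : Carrier) → Carrier
  form t x y = bilinear t (x ^ σ) (y ^ σ) x y

  form-[x,0] : ∀ t x → form t x 0# ≡ Quadruple.p₁ t * (x ^ σ * x)
  form-[x,0] [ p₁ , p₂ , p₃ , p₄ ] x rewrite 0^σ≡0 =
    solve 6 (λ p₁ p₂ p₃ p₄ x̂ x →
      p₁ :* (x̂ :* x) :+ p₂ :* (x̂ :* con 0) :+ p₃ :* (con 0 :* x) :+ p₄ :* (con 0 :* con 0)
        := p₁ :* (x̂ :* x)) refl p₁ p₂ p₃ p₄ (x ^ σ) x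

  form-[x,1] : ∀ t x → let open Quadruple t in
    form t x 1# ≡ p₁ * x ^ (σ ℕ.+ 1) + p₂ * x ^ σ + p₃ * x + p₄
  form-[x,1] [ p₁ , p₂ , p₃ , p₄ ] x rewrite 1^σ≡1 | ^-suc x σ =
    solve 6 (λ p₁ p₂ p₃ p₄ x̂ x →
      p₁ :* (x̂ :* x) :+ p₂ :* (x̂ :* con 1) :+ p₃ :* (con 1 :* x) :+ p₄ :* (con 1 :* con 1)
        := p₁ :* (x̂ :* x) :+ p₂ :* x̂ :+ p₃ :* x :+ p₄) refl p₁ p₂ p₃ p₄ (x ^ σ) x

  form-scale : ∀ t k x y → form t (k * x) (k * y) ≡ k ^ σ * k * form t x y
  form-scale [ p₁ , p₂ , p₃ , p₄ ] k x y rewrite ^σ-* k x | ^σ-* k y =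
    solve 10 (λ p₁ p₂ p₃ p₄ k̂ k x̂ x ŷ y →
      p₁ :* (k̂ :* x̂ :* (k :* x)) :+ p₂ :* (k̂ :* x̂ :* (k :* y))
        :+ p₃ :* (k̂ :* ŷ :* (k :* x)) :+ p₄ :* (k̂ :* ŷ :* (k :* y))
        := k̂ :* k :* (p₁ :* (x̂ :* x) :+ p₂ :* (x̂ :* y) :+ p₃ :* (ŷ :* x) :+ p₄ :* (ŷ :* y)))
      refl p₁ p₂ p₃ p₄ (k ^ σ) k (x ^ σ) x (y ^ σ) y

  form-nonZero : ∀ {t} → Legitimate t → ∀ x y → ¬ (x ≡ 0# × y ≡ 0#) → form t x y ≢ 0#
  form-nonZero {t} (p₁≢0 , noRoot) x y ≢[0,0] with y ≟ 0#
  ... | yes refl = *-nonZero p₁≢0 (*-nonZero (^-nonZero σ x≢0) x≢0) ∘ trans (sym (form-[x,0] t x))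
    where
    x≢0 : x ≢ 0#
    x≢0 x≡0 = ≢[0,0] (x≡0 , refl)
  ... | no y≢0 = *-nonZero (*-nonZero (^-nonZero σ y≢0) y≢0)
                   (λ eq → noRoot (y ⁻¹ * x , trans (sym (form-[x,1] t (y ⁻¹ * x))) eq))
                 ∘ trans (sym dehomogenise)
    where
    open ≡-Reasoning
    dehomogenise : form t x y ≡ y ^ σ * y * form t (y ⁻¹ * x) 1#
    dehomogenise = begin
      form t x y                            ≡⟨ cong₂ (form t) x≡ (sym (*-identityʳ y)) ⟩
      form t (y * (y ⁻¹ * x)) (y * 1#)      ≡⟨ form-scale t y (y ⁻¹ * x) 1# ⟩
      y ^ σ * y * form t (y ⁻¹ * x) 1#      ∎
      where
      x≡ : x ≡ y * (y ⁻¹ * x)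
      x≡ = begin
        x               ≡⟨ *-identityˡ x ⟨
        1# * x          ≡⟨ cong (_* x) (⁻¹-inverseʳ y≢0) ⟨
        y * y ⁻¹ * x    ≡⟨ *-assoc y (y ⁻¹) x ⟩
        y * (y ⁻¹ * x)  ∎

  infixl 6 _⊕_
  _⊕_ : ∀ {x y u u′ v v′} → x ≡ u + u′ → y ≡ v + v′ → x + y ≡ (u + v) + (u′ + v′)
  _⊕_ {u = u} {u′} {v} {v′} eq₁ eq₂ = trans (cong₂ _+_ eq₁ eq₂) (interchange u u′ v v′)
    where open CommutativeSemigroup (CommutativeMonoid.commutativeSemigroup +-commutativeMonoid) using (interchange)

  product-distribˡ : ∀ l t → let open AbelianGroup L×L in
    ∀ x y z → product l t x (y ∙ z) ≈ product l t x y ∙ product l t x z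
  product-distribˡ l [ p₁ , p₂ , p₃ , p₄ ] (a , b) (c , d) (c′ , d′)
    rewrite ^σ-+ c c′ | ^σ-+ d d′ =
      D ⊕ D ⊕ D ⊕ D ⊕ D ⊕ D ⊕ D ⊕ D , D ⊕ D
    where
    D : ∀ {x y z} → x * (y + z) ≡ x * y + x * z
    D = distribˡ _ _ _

  product-distribʳ : ∀ l t → let open AbelianGroup L×L in
    ∀ x y z → product l t (y ∙ z) x ≈ product l t y x ∙ product l t z x
  product-distribʳ l [ p₁ , p₂ , p₃ , p₄ ] (c , d) (a , b) (a′ , b′)
    rewrite ^σ-+ a a′ | ^σ-+ b b′ =
      D ⊕ D ⊕ D ⊕ D ⊕ D ⊕ D ⊕ D ⊕ D , distribʳ _ _ _ ⊕ distribʳ _ _ _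
    where
    D : ∀ {w x y z} → w * (x + y) * z ≡ w * x * z + w * y * z
    D = trans (cong (_* _) (distribˡ _ _ _)) (distribʳ _ _ _)

  product-proportional : ∀ l t a b k →
    proj₁ (product l t (a , b) (k * a , k * b)) ≡ (k ^ σ + l * k) * form t a b
  product-proportional l [ p₁ , p₂ , p₃ , p₄ ] a b k rewrite ^σ-* k a | ^σ-* k b =
    solve 11 (λ l p₁ p₂ p₃ p₄ a â b b̂ k k̂ →
      p₁ :* a :* (k̂ :* â) :+ l :* p₁ :* â :* (k :* a)
        :+ p₂ :* b :* (k̂ :* â) :+ l :* p₂ :* â :* (k :* b)
        :+ p₃ :* a :* (k̂ :* b̂) :+ l :* p₃ :* b̂ :* (k :* a)
        :+ p₄ :* b :* (k̂ :* b̂) :+ l :* p₄ :* b̂ :* (k :* b)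
      := (k̂ :+ l :* k)
           :* (p₁ :* (â :* a) :+ p₂ :* (â :* b) :+ p₃ :* (b̂ :* a) :+ p₄ :* (b̂ :* b)))
      refl l p₁ p₂ p₃ p₄ a (a ^ σ) b (b ^ σ) k (k ^ σ)

  cancel : ∀ {x y z} → x ≢ 0# → x * y ≡ x * z → y ≡ z
  cancel {x} {y} {z} x≢0 eq = begin
    y               ≡⟨ undo y ⟨
    x ⁻¹ * (x * y)  ≡⟨ cong (x ⁻¹ *_) eq ⟩
    x ⁻¹ * (x * z)  ≡⟨ undo z ⟩
    z               ∎
    where
    open ≡-Reasoning
    undo : ∀ w → x ⁻¹ * (x * w) ≡ w
    undo w = trans (sym (*-assoc (x ⁻¹) x w))
      (trans (cong (_* w) (⁻¹-inverseˡ x≢0)) (*-identityˡ w))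

  proportional : ∀ {a b c d} → a ≢ 0# → a * d ≡ b * c → ∃[ k ] c ≡ k * a × d ≡ k * b
  proportional {a} {b} {c} {d} a≢0 ad≡bc = c * a ⁻¹ , c≡ka , cancel a≢0 (begin
    a * d               ≡⟨ ad≡bc ⟩
    b * c               ≡⟨ cong (b *_) c≡ka ⟩
    b * (c * a ⁻¹ * a)  ≡⟨ solve 3 (λ a b k → b :* (k :* a) := a :* (k :* b)) refl a b (c * a ⁻¹) ⟩
    a * (c * a ⁻¹ * b)  ∎)
    where
    open ≡-Reasoning
    c≡ka : c ≡ c * a ⁻¹ * a
    c≡ka = sym (trans (*-assoc c (a ⁻¹) a) (trans (cong (c *_) (⁻¹-inverseˡ a≢0)) (*-identityʳ c)))

  factor-nonZero : ∀ {l k} → Admissible l → k ≢ 0# → k ^ σ + l * k ≢ 0#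
  factor-nonZero {k = k} (inj₁ refl) k≢0 eq =
    ^-nonZero σ k≢0 (trans (x+y≡0⇒x≡y eq) (zeroˡ k))
  factor-nonZero {l} {k} (inj₂ (_ , ¬power)) k≢0 eq = ¬power (k , k≢0 , cancel k≢0 (begin
    k * k ^ (σ ℕ.∸ 1)  ≡⟨ *-comm k _ ⟩
    k ^ (σ ℕ.∸ 1) * k  ≡⟨ ^σ-split k ⟨
    k ^ σ              ≡⟨ x+y≡0⇒x≡y eq ⟩
    l * k              ≡⟨ *-comm l k ⟩
    k * l              ∎))
    where open ≡-Reasoning

  product-noZeroDivisors : ∀ {l t} → Admissible l → Legitimate t →
    let open AbelianGroup L×L in ∀ {x y} → product l t x y ≈ ε → x ≈ ε ⊎ y ≈ ε
  product-noZeroDivisors {l} {t} adm leg {a , b} {c , d} (eq₁ , eq₂) = go (a ≟ 0#) (b ≟ 0#)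
    where
    ad≡bc : a * d ≡ b * c
    ad≡bc = x+y≡0⇒x≡y eq₂

    zero-factor : ∀ k → ¬ (a ≡ 0# × b ≡ 0#) → c ≡ k * a → d ≡ k * b → c ≡ 0# × d ≡ 0#
    zero-factor k ≢[0,0] refl refl with k ≟ 0#
    ... | yes refl = zeroˡ a , zeroˡ b
    ... | no  k≢0  = contradiction (trans (sym (product-proportional l t a b k)) eq₁)
                       (*-nonZero (factor-nonZero adm k≢0) (form-nonZero leg a b ≢[0,0]))

    go : Dec (a ≡ 0#) → Dec (b ≡ 0#) → (a ≡ 0# × b ≡ 0#) ⊎ (c ≡ 0# × d ≡ 0#)
    go (yes a≡0) (yes b≡0) = inj₁ (a≡0 , b≡0)
    go (no a≢0)  _         =
      let k , c≡ka , d≡kb = proportional a≢0 ad≡bc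
      in inj₂ (zero-factor k (a≢0 ∘ proj₁) c≡ka d≡kb)
    go (yes _)   (no b≢0)  =
      let k , d≡kb , c≡ka = proportional b≢0 (sym ad≡bc)
      in inj₂ (zero-factor k (b≢0 ∘ proj₂) c≡ka d≡kb)

  L×L-finite : HasCardinality (AbelianGroup.setoid L×L) (2 ℕ.^ m ℕ.* 2 ℕ.^ m)
  L×L-finite = record
    { to        = to
    ; from      = from
    ; to-cong   = λ { (refl , refl) → refl }
    ; from-cong = λ { refl → refl , refl }
    ; inverse   = (λ { (refl , refl) → strictlyInverseˡ _ })
                , (λ { refl → ,-injective (strictlyInverseʳ _) })
    }
    where open Inverse (↔-sym *↔× ↔-∘ (cardinality ×-↔ cardinality))

  B : (l : Carrier) → Admissible l → Ω → Presemifield L×L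
  B l adm (t , leg) = record
    { finite         = _ , L×L-finite
    ; _*_            = product l t
    ; *-cong         = λ { (refl , refl) (refl , refl) → refl , refl }
    ; distrib        = product-distribˡ l t , product-distribʳ l t
    ; noZeroDivisors = product-noZeroDivisors adm leg
    }

  CFamily : Presemifield L×L → Set
  CFamily P =
    Σ[ l ∈ Carrier ] Σ[ l≢0 ∈ l ≢ 0# ] Σ[ ¬power ∈ ¬ IsPower l ]
    Σ[ p₄ ∈ Carrier ] Σ[ leg ∈ Legitimate [ 1# , 0# , 0# , p₄ ] ]
      Isotopic P (B l (inj₂ (l≢0 , ¬power)) ([ 1# , 0# , 0# , p₄ ] , leg))

  record Matrix : Set where
    constructor mat
    field
      α β γ δ : Carrier

  det : Matrix → Carrier
  det (mat α β γ δ) = α * δ - β * γ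

  infixl 7 _⊗_
  _⊗_ : Matrix → Matrix → Matrix
  mat α β γ δ ⊗ mat α′ β′ γ′ δ′ =
    mat (α * α′ + β * γ′) (α * β′ + β * δ′) (γ * α′ + δ * γ′) (γ * β′ + δ * δ′)

  I : Matrix
  I = mat 1# 0# 0# 1#

  -- In characteristic 2 the adjugate needs no signs.
  inv : Matrix → Matrix
  inv A@(mat α β γ δ) = mat (e * δ) (e * β) (e * γ) (e * α)
    where e = det A ⁻¹

  mat-cong : ∀ {α α′ β β′ γ γ′ δ δ′} → α ≡ α′ → β ≡ β′ → γ ≡ γ′ → δ ≡ δ′ →
             mat α β γ δ ≡ mat α′ β′ γ′ δ′
  mat-cong refl refl refl refl = refl

  det-+ : ∀ α β γ δ → det (mat α β γ δ) ≡ α * δ + β * γ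
  det-+ α β γ δ = cong (α * δ +_) (-x≡x (β * γ))

  det-⊗ : ∀ A A′ → det (A ⊗ A′) ≡ det A * det A′
  det-⊗ A@(mat α β γ δ) A′@(mat α′ β′ γ′ δ′)
    rewrite -x≡x (β * γ) | -x≡x (β′ * γ′) | -x≡x ((α * β′ + β * δ′) * (γ * α′ + δ * γ′)) =
    trans
      (solve 8 (λ α β γ δ α′ β′ γ′ δ′ →
        (α :* α′ :+ β :* γ′) :* (γ :* β′ :+ δ :* δ′) :+ (α :* β′ :+ β :* δ′) :* (γ :* α′ :+ δ :* γ′)
        := (α :* δ :+ β :* γ) :* (α′ :* δ′ :+ β′ :* γ′)
             :+ ((α :* α′ :* γ :* β′ :+ β :* γ′ :* δ :* δ′) :+ (α :* α′ :* γ :* β′ :+ β :* γ′ :* δ :* δ′)))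
        refl α β γ δ α′ β′ γ′ δ′)
      (x+[y+y]≡x _ _)

  det-I : det I ≡ 1#
  det-I = trans (det-+ 1# 0# 0# 1#)
    (trans (cong₂ _+_ (*-identityˡ 1#) (zeroˡ 0#)) (+-identityʳ 1#))

  ⊗-assoc : ∀ A B C → (A ⊗ B) ⊗ C ≡ A ⊗ (B ⊗ C)
  ⊗-assoc (mat α β γ δ) (mat α′ β′ γ′ δ′) (mat α″ β″ γ″ δ″) =
    mat-cong (entry α β α″ γ″) (entry α β β″ δ″) (entry γ δ α″ γ″) (entry γ δ β″ δ″)
    where
    entry : ∀ a b c d → (a * α′ + b * γ′) * c + (a * β′ + b * δ′) * d
                      ≡ a * (α′ * c + β′ * d) + b * (γ′ * c + δ′ * d)
    entry a b c d = solve 8 (λ a b c d α′ β′ γ′ δ′ →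
      (a :* α′ :+ b :* γ′) :* c :+ (a :* β′ :+ b :* δ′) :* d
      := a :* (α′ :* c :+ β′ :* d) :+ b :* (γ′ :* c :+ δ′ :* d)) refl a b c d α′ β′ γ′ δ′

  1x+0y≡x : ∀ x y → 1# * x + 0# * y ≡ x
  1x+0y≡x x y = solve 2 (λ x y → con 1 :* x :+ con 0 :* y := x) refl x y

  0x+1y≡y : ∀ x y → 0# * x + 1# * y ≡ y
  0x+1y≡y x y = solve 2 (λ x y → con 0 :* x :+ con 1 :* y := y) refl x y

  ⊗-identityˡ : ∀ A → I ⊗ A ≡ A
  ⊗-identityˡ (mat α β γ δ) =
    mat-cong (1x+0y≡x α γ) (1x+0y≡x β δ) (0x+1y≡y α γ) (0x+1y≡y β δ)

  ⊗-identityʳ : ∀ A → A ⊗ I ≡ A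
  ⊗-identityʳ (mat α β γ δ) = mat-cong (x1+y0≡x α β) (x0+y1≡y α β) (x1+y0≡x γ δ) (x0+y1≡y γ δ)
    where
    x1+y0≡x : ∀ x y → x * 1# + y * 0# ≡ x
    x1+y0≡x x y = solve 2 (λ x y → x :* con 1 :+ y :* con 0 := x) refl x y
    x0+y1≡y : ∀ x y → x * 0# + y * 1# ≡ y
    x0+y1≡y x y = solve 2 (λ x y → x :* con 0 :+ y :* con 1 := y) refl x y

  inv-cancel : ∀ α β γ δ → let D = det (mat α β γ δ) in D ≢ 0# → D ⁻¹ * (α * δ + β * γ) ≡ 1#
  inv-cancel α β γ δ D≢0 =
    trans (cong (det (mat α β γ δ) ⁻¹ *_) (sym (det-+ α β γ δ))) (⁻¹-inverseˡ D≢0)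

  ⊗-inverseˡ : ∀ A → det A ≢ 0# → inv A ⊗ A ≡ I
  ⊗-inverseˡ A@(mat α β γ δ) D≢0 = mat-cong
    (trans (solve 5 (λ e α β γ δ → e :* δ :* α :+ e :* β :* γ := e :* (α :* δ :+ β :* γ))
      refl e α β γ δ) (inv-cancel α β γ δ D≢0))
    (trans (solve 3 (λ e x y → e :* y :* x :+ e :* x :* y := e :* x :* y :+ e :* x :* y)
      refl e β δ) (x+x≡0 _))
    (trans (solve 3 (λ e x y → e :* y :* x :+ e :* x :* y := e :* x :* y :+ e :* x :* y)
      refl e α γ) (x+x≡0 _))
    (trans (solve 5 (λ e α β γ δ → e :* γ :* β :+ e :* α :* δ := e :* (α :* δ :+ β :* γ))
      refl e α β γ δ) (inv-cancel α β γ δ D≢0))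
    where e = det A ⁻¹

  ⊗-inverseʳ : ∀ A → det A ≢ 0# → A ⊗ inv A ≡ I
  ⊗-inverseʳ A@(mat α β γ δ) D≢0 = mat-cong
    (trans (solve 5 (λ e α β γ δ → α :* (e :* δ) :+ β :* (e :* γ) := e :* (α :* δ :+ β :* γ))
      refl e α β γ δ) (inv-cancel α β γ δ D≢0))
    (trans (solve 3 (λ e x y → x :* (e :* y) :+ y :* (e :* x) := e :* x :* y :+ e :* x :* y)
      refl e α β) (x+x≡0 _))
    (trans (solve 3 (λ e x y → x :* (e :* y) :+ y :* (e :* x) := e :* x :* y :+ e :* x :* y)
      refl e γ δ) (x+x≡0 _))
    (trans (solve 5 (λ e α β γ δ → γ :* (e :* β) :+ δ :* (e :* α) := e :* (α :* δ :+ β :* γ))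
      refl e α β γ δ) (inv-cancel α β γ δ D≢0))
    where e = det A ⁻¹

  det-inv : ∀ A → det A ≢ 0# → det (inv A) ≢ 0#
  det-inv A D≢0 eq = 1≢0 $ begin
    1#                   ≡⟨ det-I ⟨
    det I                ≡⟨ cong det (⊗-inverseˡ A D≢0) ⟨
    det (inv A ⊗ A)      ≡⟨ det-⊗ (inv A) A ⟩
    det (inv A) * det A  ≡⟨ cong (_* det A) eq ⟩
    0# * det A           ≡⟨ zeroˡ (det A) ⟩
    0#                   ∎
    where open ≡-Reasoning

  GL₂ : Group _ _
  GL₂ = record
    { Carrier = Σ[ A ∈ Matrix ] det A ≢ 0#
    ; _≈_     = _≡_ on proj₁
    ; _∙_     = λ (A , A≢0) (B , B≢0) →
                  A ⊗ B , *-nonZero A≢0 B≢0 ∘ trans (sym (det-⊗ A B))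
    ; ε       = I , 1≢0 ∘ trans (sym det-I)
    ; _⁻¹     = λ (A , A≢0) → inv A , det-inv A A≢0
    ; isGroup = record
      { isMonoid = record
        { isSemigroup = record
          { isMagma = record
            { isEquivalence = isEquivalence proj₁ ≡.isEquivalence
            ; ∙-cong        = cong₂ _⊗_
            }
          ; assoc = λ (A , _) (B , _) (C , _) → ⊗-assoc A B C
          }
        ; identity = (λ (A , _) → ⊗-identityˡ A) , (λ (A , _) → ⊗-identityʳ A)
        }
      ; inverse = (λ (A , A≢0) → ⊗-inverseˡ A A≢0) , (λ (A , A≢0) → ⊗-inverseʳ A A≢0)
      ; ⁻¹-cong = cong inv
      }
    }

  Lˣ : Group _ _
  Lˣ = record
    { Carrier = Σ[ x ∈ Carrier ] x ≢ 0#
    ; _≈_     = _≡_ on proj₁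
    ; _∙_     = λ (x , x≢0) (y , y≢0) → x * y , *-nonZero x≢0 y≢0
    ; ε       = 1# , 1≢0
    ; _⁻¹     = λ (x , x≢0) → x ⁻¹ , ⁻¹-nonZero x≢0
    ; isGroup = record
      { isMonoid = record
        { isSemigroup = record
          { isMagma = record
            { isEquivalence = isEquivalence proj₁ ≡.isEquivalence
            ; ∙-cong        = cong₂ _*_
            }
          ; assoc = λ (x , _) (y , _) (z , _) → *-assoc x y z
          }
        ; identity = (λ (x , _) → *-identityˡ x) , (λ (x , _) → *-identityʳ x)
        }
      ; inverse = (λ (_ , x≢0) → ⁻¹-inverseˡ x≢0) , (λ (_ , x≢0) → ⁻¹-inverseʳ x≢0)
      ; ⁻¹-cong = cong _⁻¹
      }
    }

  G₁ : Group _ _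
  G₁ = DirectProduct.group GL₂ Lˣ

  scale : Carrier → Quadruple → Quadruple
  scale k [ p₁ , p₂ , p₃ , p₄ ] = [ k * p₁ , k * p₂ , k * p₃ , k * p₄ ]

  substitute : Quadruple → Matrix → Quadruple
  substitute [ p₁ , p₂ , p₃ , p₄ ] (mat α β γ δ) =
    [ α ^ (σ ℕ.+ 1) * p₁ + α ^ σ * γ * p₂ + α * γ ^ σ * p₃ + γ ^ (σ ℕ.+ 1) * p₄
    , α ^ σ * β * p₁ + α ^ σ * δ * p₂ + β * γ ^ σ * p₃ + γ ^ σ * δ * p₄
    , α * β ^ σ * p₁ + β ^ σ * γ * p₂ + α * δ ^ σ * p₃ + γ * δ ^ σ * p₄
    , β ^ (σ ℕ.+ 1) * p₁ + β ^ σ * δ * p₂ + β * δ ^ σ * p₃ + δ ^ (σ ℕ.+ 1) * p₄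
    ]

  -- A matrix acts by X ↦ αX + βY, Y ↦ γX + δY on the form
  -- p₁ X^{σ+1} + p₂ X^σ Y + p₃ X Y^σ + p₄ Y^{σ+1}; this is a right action.
  act : Quadruple → Group.Carrier G₁ → Quadruple
  act t ((A , _) , (k , _)) = scale k (substitute t A)

  quad-cong : ∀ {p₁ p₁′ p₂ p₂′ p₃ p₃′ p₄ p₄′} → p₁ ≡ p₁′ → p₂ ≡ p₂′ → p₃ ≡ p₃′ → p₄ ≡ p₄′ →
              [ p₁ , p₂ , p₃ , p₄ ] ≡ [ p₁′ , p₂′ , p₃′ , p₄′ ]
  quad-cong refl refl refl refl = refl

  substitute-bilinear : ∀ t α β γ δ → substitute t (mat α β γ δ) ≡
    [ bilinear t (α ^ σ) (γ ^ σ) α γ , bilinear t (α ^ σ) (γ ^ σ) β δ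
    , bilinear t (β ^ σ) (δ ^ σ) α γ , bilinear t (β ^ σ) (δ ^ σ) β δ ]
  substitute-bilinear [ p₁ , p₂ , p₃ , p₄ ] α β γ δ
    rewrite ^-suc α σ | ^-suc β σ | ^-suc γ σ | ^-suc δ σ =
      quad-cong (entry _ _ α γ) (entry _ _ β δ) entry₃ (entry _ _ β δ)
    where
    entry : ∀ x̂ ŷ x y → x̂ * x * p₁ + x̂ * y * p₂ + x * ŷ * p₃ + ŷ * y * p₄
                      ≡ bilinear [ p₁ , p₂ , p₃ , p₄ ] x̂ ŷ x y
    entry x̂ ŷ x y = solve 8 (λ p₁ p₂ p₃ p₄ x̂ ŷ x y →
      x̂ :* x :* p₁ :+ x̂ :* y :* p₂ :+ x :* ŷ :* p₃ :+ ŷ :* y :* p₄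
      := p₁ :* (x̂ :* x) :+ p₂ :* (x̂ :* y) :+ p₃ :* (ŷ :* x) :+ p₄ :* (ŷ :* y))
      refl p₁ p₂ p₃ p₄ x̂ ŷ x y
    entry₃ : α * β ^ σ * p₁ + β ^ σ * γ * p₂ + α * δ ^ σ * p₃ + γ * δ ^ σ * p₄
           ≡ bilinear [ p₁ , p₂ , p₃ , p₄ ] (β ^ σ) (δ ^ σ) α γ
    entry₃ rewrite *-comm α (β ^ σ) | *-comm γ (δ ^ σ) = entry _ _ α γ

  bilinear-substitute : ∀ t α β γ δ x̂ ŷ x y →
    bilinear (substitute t (mat α β γ δ)) x̂ ŷ x y ≡
    bilinear t (α ^ σ * x̂ + β ^ σ * ŷ) (γ ^ σ * x̂ + δ ^ σ * ŷ) (α * x + β * y) (γ * x + δ * y)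
  bilinear-substitute t@([ p₁ , p₂ , p₃ , p₄ ]) α β γ δ x̂ ŷ x y = trans
    (cong (λ u → bilinear u x̂ ŷ x y) (substitute-bilinear t α β γ δ))
    (solve 16 (λ p₁ p₂ p₃ p₄ α α̂ β β̂ γ γ̂ δ δ̂ x̂ ŷ x y →
      let b = λ p₁ p₂ p₃ p₄ x̂ ŷ x y →
                p₁ :* (x̂ :* x) :+ p₂ :* (x̂ :* y) :+ p₃ :* (ŷ :* x) :+ p₄ :* (ŷ :* y)
          b′ = b p₁ p₂ p₃ p₄
      in b (b′ α̂ γ̂ α γ) (b′ α̂ γ̂ β δ) (b′ β̂ δ̂ α γ) (b′ β̂ δ̂ β δ) x̂ ŷ x y
         := b′ (α̂ :* x̂ :+ β̂ :* ŷ) (γ̂ :* x̂ :+ δ̂ :* ŷ) (α :* x :+ β :* y) (γ :* x :+ δ :* y))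
      refl p₁ p₂ p₃ p₄ α (α ^ σ) β (β ^ σ) γ (γ ^ σ) δ (δ ^ σ) x̂ ŷ x y)

  bilinear-scale : ∀ t k x̂ ŷ x y → bilinear (scale k t) x̂ ŷ x y ≡ k * bilinear t x̂ ŷ x y
  bilinear-scale [ p₁ , p₂ , p₃ , p₄ ] k x̂ ŷ x y = solve 9 (λ p₁ p₂ p₃ p₄ k x̂ ŷ x y →
    k :* p₁ :* (x̂ :* x) :+ k :* p₂ :* (x̂ :* y) :+ k :* p₃ :* (ŷ :* x) :+ k :* p₄ :* (ŷ :* y)
    := k :* (p₁ :* (x̂ :* x) :+ p₂ :* (x̂ :* y) :+ p₃ :* (ŷ :* x) :+ p₄ :* (ŷ :* y)))
    refl p₁ p₂ p₃ p₄ k x̂ ŷ x y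

  substitute-I : ∀ t → substitute t I ≡ t
  substitute-I t@([ p₁ , p₂ , p₃ , p₄ ])
    rewrite substitute-bilinear t 1# 0# 0# 1# | 0^σ≡0 | 1^σ≡1 = quad-cong
    (solve 4 (λ p₁ p₂ p₃ p₄ → b p₁ p₂ p₃ p₄ (con 1) (con 0) (con 1) (con 0) := p₁) refl p₁ p₂ p₃ p₄)
    (solve 4 (λ p₁ p₂ p₃ p₄ → b p₁ p₂ p₃ p₄ (con 1) (con 0) (con 0) (con 1) := p₂) refl p₁ p₂ p₃ p₄)
    (solve 4 (λ p₁ p₂ p₃ p₄ → b p₁ p₂ p₃ p₄ (con 0) (con 1) (con 1) (con 0) := p₃) refl p₁ p₂ p₃ p₄)
    (solve 4 (λ p₁ p₂ p₃ p₄ → b p₁ p₂ p₃ p₄ (con 0) (con 1) (con 0) (con 1) := p₄) refl p₁ p₂ p₃ p₄)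
    where
    b : (p₁ p₂ p₃ p₄ x̂ ŷ x y : Solver.Polynomial 4) → Solver.Polynomial 4
    b p₁ p₂ p₃ p₄ x̂ ŷ x y = p₁ :* (x̂ :* x) :+ p₂ :* (x̂ :* y) :+ p₃ :* (ŷ :* x) :+ p₄ :* (ŷ :* y)

  substitute-⊗ : ∀ t A A′ → substitute t (A ⊗ A′) ≡ substitute (substitute t A) A′
  substitute-⊗ t A@(mat α β γ δ) A′@(mat α′ β′ γ′ δ′) = begin
    substitute t (A ⊗ A′)               ≡⟨ substitute-bilinear t _ _ _ _ ⟩
    [ b (α * α′ + β * γ′) (γ * α′ + δ * γ′) (α * α′ + β * γ′) (γ * α′ + δ * γ′)
    , b (α * α′ + β * γ′) (γ * α′ + δ * γ′) (α * β′ + β * δ′) (γ * β′ + δ * δ′)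
    , b (α * β′ + β * δ′) (γ * β′ + δ * δ′) (α * α′ + β * γ′) (γ * α′ + δ * γ′)
    , b (α * β′ + β * δ′) (γ * β′ + δ * δ′) (α * β′ + β * δ′) (γ * β′ + δ * δ′) ]
                                        ≡⟨ quad-cong (entry α′ γ′ α′ γ′) (entry α′ γ′ β′ δ′)
                                                     (entry β′ δ′ α′ γ′) (entry β′ δ′ β′ δ′) ⟩
    _                                   ≡⟨ substitute-bilinear (substitute t A) α′ β′ γ′ δ′ ⟨
    substitute (substitute t A) A′      ∎
    where
    open ≡-Reasoning
    b : (u v x y : Carrier) → Carrier
    b u v = bilinear t (u ^ σ) (v ^ σ)
    frobenius : ∀ a b x y → (a * x + b * y) ^ σ ≡ a ^ σ * x ^ σ + b ^ σ * y ^ σ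
    frobenius a b x y = trans (^σ-+ (a * x) (b * y)) (cong₂ _+_ (^σ-* a x) (^σ-* b y))
    entry : ∀ u v x y →
      b (α * u + β * v) (γ * u + δ * v) (α * x + β * y) (γ * x + δ * y)
      ≡ bilinear (substitute t A) (u ^ σ) (v ^ σ) x y
    entry u v x y = trans
      (cong₂ (λ x̂ ŷ → bilinear t x̂ ŷ (α * x + β * y) (γ * x + δ * y))
        (frobenius α β u v) (frobenius γ δ u v))
      (sym (bilinear-substitute t α β γ δ (u ^ σ) (v ^ σ) x y))

  substitute-scale : ∀ k t A → substitute (scale k t) A ≡ scale k (substitute t A)
  substitute-scale k t (mat α β γ δ) = trans (substitute-bilinear (scale k t) α β γ δ)
    (trans (quad-cong (bilinear-scale t k _ _ _ _) (bilinear-scale t k _ _ _ _)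
                      (bilinear-scale t k _ _ _ _) (bilinear-scale t k _ _ _ _))
           (cong (scale k) (sym (substitute-bilinear t α β γ δ))))

  scale-1 : ∀ t → scale 1# t ≡ t
  scale-1 [ p₁ , p₂ , p₃ , p₄ ] =
    quad-cong (*-identityˡ p₁) (*-identityˡ p₂) (*-identityˡ p₃) (*-identityˡ p₄)

  scale-* : ∀ k k′ t → scale (k * k′) t ≡ scale k′ (scale k t)
  scale-* k k′ [ p₁ , p₂ , p₃ , p₄ ] = quad-cong (entry p₁) (entry p₂) (entry p₃) (entry p₄)
    where
    entry : ∀ p → k * k′ * p ≡ k′ * (k * p)
    entry p = trans (cong (_* p) (*-comm k k′)) (*-assoc k′ k p)

  act-ε : ∀ t → act t (Group.ε G₁) ≡ t
  act-ε t = trans (scale-1 (substitute t I)) (substitute-I t)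

  act-∙ : ∀ t g h → act t (Group._∙_ G₁ g h) ≡ act (act t g) h
  act-∙ t ((A , _) , (k , _)) ((A′ , _) , (k′ , _)) = begin
    scale (k * k′) (substitute t (A ⊗ A′))              ≡⟨ cong (scale (k * k′)) (substitute-⊗ t A A′) ⟩
    scale (k * k′) (substitute (substitute t A) A′)     ≡⟨ scale-* k k′ _ ⟩
    scale k′ (scale k (substitute (substitute t A) A′)) ≡⟨ cong (scale k′) (substitute-scale k _ A′) ⟨
    scale k′ (substitute (scale k (substitute t A)) A′) ∎
    where open ≡-Reasoning

  act-cong : ∀ t {g h} → Group._≈_ G₁ g h → act t g ≡ act t h
  act-cong t (A≡A′ , k≡k′) = cong₂ (λ A k → scale k (substitute t A)) A≡A′ k≡k′

  singular : ∀ α β γ δ x y → ¬ (x ≡ 0# × y ≡ 0#) →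
             α * x + β * y ≡ 0# → γ * x + δ * y ≡ 0# → det (mat α β γ δ) ≡ 0#
  singular α β γ δ x y ≢[0,0] eq₁ eq₂ with det (mat α β γ δ) ≟ 0#
  ... | yes D≡0 = D≡0
  ... | no  D≢0 = contradiction (coordinate x Dx≡0 , coordinate y Dy≡0) ≢[0,0]
    where
    open ≡-Reasoning
    D = det (mat α β γ δ)
    coordinate : ∀ z → D * z ≡ 0# → z ≡ 0#
    coordinate z Dz≡0 = cancel D≢0 (trans Dz≡0 (sym (zeroʳ D)))
    combine : ∀ p q → p * (α * x + β * y) + q * (γ * x + δ * y) ≡ 0#
    combine p q = begin
      p * (α * x + β * y) + q * (γ * x + δ * y)  ≡⟨ cong₂ (λ u v → p * u + q * v) eq₁ eq₂ ⟩
      p * 0# + q * 0#                            ≡⟨ cong₂ _+_ (zeroʳ p) (zeroʳ q) ⟩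
      0# + 0#                                    ≡⟨ +-identityʳ 0# ⟩
      0#                                         ∎
    Dx≡0 : D * x ≡ 0#
    Dx≡0 = begin
      D * x                                      ≡⟨ cong (_* x) (det-+ α β γ δ) ⟩
      (α * δ + β * γ) * x                        ≡⟨ x+[y+y]≡x _ (β * δ * y) ⟨
      (α * δ + β * γ) * x + (β * δ * y + β * δ * y)
        ≡⟨ solve 6 (λ α β γ δ x y →
             (α :* δ :+ β :* γ) :* x :+ (β :* δ :* y :+ β :* δ :* y)
             := δ :* (α :* x :+ β :* y) :+ β :* (γ :* x :+ δ :* y)) refl α β γ δ x y ⟩
      δ * (α * x + β * y) + β * (γ * x + δ * y)  ≡⟨ combine δ β ⟩
      0#                                         ∎
    Dy≡0 : D * y ≡ 0#
    Dy≡0 = begin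
      D * y                                      ≡⟨ cong (_* y) (det-+ α β γ δ) ⟩
      (α * δ + β * γ) * y                        ≡⟨ x+[y+y]≡x _ (α * γ * x) ⟨
      (α * δ + β * γ) * y + (α * γ * x + α * γ * x)
        ≡⟨ solve 6 (λ α β γ δ x y →
             (α :* δ :+ β :* γ) :* y :+ (α :* γ :* x :+ α :* γ :* x)
             := γ :* (α :* x :+ β :* y) :+ α :* (γ :* x :+ δ :* y)) refl α β γ δ x y ⟩
      γ * (α * x + β * y) + α * (γ * x + δ * y)  ≡⟨ combine γ α ⟩
      0#                                         ∎

  form-substitute : ∀ t α β γ δ x y →
    form (substitute t (mat α β γ δ)) x y ≡ form t (α * x + β * y) (γ * x + δ * y)
  form-substitute t α β γ δ x y = trans
    (bilinear-substitute t α β γ δ (x ^ σ) (y ^ σ) x y)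
    (cong₂ (λ u v → bilinear t u v (α * x + β * y) (γ * x + δ * y))
      (sym (frobenius α β)) (sym (frobenius γ δ)))
    where
    frobenius : ∀ a b → (a * x + b * y) ^ σ ≡ a ^ σ * x ^ σ + b ^ σ * y ^ σ
    frobenius a b = trans (^σ-+ (a * x) (b * y)) (cong₂ _+_ (^σ-* a x) (^σ-* b y))

  legitimate : ∀ t → (∀ x y → ¬ (x ≡ 0# × y ≡ 0#) → form t x y ≢ 0#) → Legitimate t
  legitimate t form≢0 =
      (λ p₁≡0 → form≢0 1# 0# (1≢0 ∘ proj₁)
        (trans (form-[x,0] t 1#) (trans (cong (_* _) p₁≡0) (zeroˡ _))))
    , (λ (x , root) → form≢0 x 1# (1≢0 ∘ proj₂) (trans (form-[x,1] t x) root))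

  act-legitimate : ∀ {t} g → Legitimate t → Legitimate (act t g)
  act-legitimate {t} ((A@(mat α β γ δ) , D≢0) , (k , k≢0)) leg =
    legitimate (act t ((A , D≢0) , (k , k≢0))) λ x y ≢[0,0] eq →
      *-nonZero k≢0
        (form-nonZero leg (α * x + β * y) (γ * x + δ * y)
          (λ (eq₁ , eq₂) → D≢0 (singular α β γ δ x y ≢[0,0] eq₁ eq₂)))
        (begin
          k * form t (α * x + β * y) (γ * x + δ * y)  ≡⟨ cong (k *_) (form-substitute t α β γ δ x y) ⟨
          k * form (substitute t A) x y               ≡⟨ bilinear-scale (substitute t A) k _ _ x y ⟨
          form (scale k (substitute t A)) x y         ≡⟨ eq ⟩
          0#                                          ∎)
    where open ≡-Reasoning

  infixl 7 _◂_
  _◂_ : Ω → Group.Carrier G₁ → Ω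
  (t , leg) ◂ g = act t g , act-legitimate g leg

  infix 4 _≈Ω_ _∼_
  _≈Ω_ : Ω → Ω → Set
  _≈Ω_ = _≡_ on proj₁

  _∼_ : Ω → Ω → Set
  t ∼ t′ = ∃[ g ] t ◂ g ≈Ω t′

  Orbits : Setoid _ _
  Orbits = record
    { Carrier       = Ω
    ; _≈_           = _∼_
    ; isEquivalence = record
      { refl  = λ {(t , _)} → ε , act-ε t
      ; sym   = λ { {t , _} (g , refl) → g ⁻¹ᴳ ,
                  trans (sym (act-∙ t g (g ⁻¹ᴳ)))
                    (trans (act-cong t {g ∙ g ⁻¹ᴳ} {ε} (inverseʳ g)) (act-ε t)) }
      ; trans = λ { {t , _} (g , refl) (h , refl) → g ∙ h , act-∙ t g h }
      }
    }
    where open Group G₁ using (ε; _∙_; inverseʳ) renaming (_⁻¹ to _⁻¹ᴳ)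

module Submission where

-- A quadruple t is a σ-sesquilinear form B on L², anisotropic exactly when t is legitimate, and
-- G₁ acts by change of basis and scaling. The map T : v ↦ v^⊥ is σ-semilinear and fixes no line.
-- If T² fixes a line ⟨v⟩ then v, T v is an orthogonal basis, so t is equivalent to some
-- [1, 0, 0, p], and the change of basis is an isotopy of the presemifields, with the same l.
--
-- To find such a line let r = m/d, which is even, and N = T^r, a linear map commuting with T.
-- If N v = λ v with λ not fixed by σ, then v and T v are eigenvectors for λ and λ^σ, and T² v
-- is one for λ^{σ²} ≠ λ^σ, so T² v lies on ⟨v⟩. If λ is fixed by σ, then N is the scalar λ, and
-- Hilbert 90 gives a line fixed by T, which is excluded. If N has no eigenvector over L, then the
-- coefficients of its characteristic polynomial are fixed by σ, and since r is even that
-- polynomial has a root in L by Artin-Schreier theory, again a contradiction.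
--
-- Finally [1, 0, 0, p] is legitimate iff p is not a (σ+1)-st power, and two such quadruples are
-- equivalent iff p′/p or p p′ is a (σ+1)-st power. The (σ+1)-st powers are the (2^d + 1)-st powers,
-- so the orbits are the nontrivial classes of ℤ/(2^d + 1) up to sign, of which there are 2^{d-1}.

open import Defs
open import Algebra.Bundles using (AbelianGroup; CommutativeRing)
open import Algebra.Morphism.Structures using (module GroupMorphisms)
open import Algebra.Solver.Ring.AlmostCommutativeRing
  using (fromCommutativeRing; _-Raw-AlmostCommutative⟶_)
open import Data.Bool.Base using (Bool; true; false)
open import Data.Fin.Base as Fin using (Fin)
open import Data.Fin.Permutation using (permutation)
open import Data.List.Base using ([]; _∷_)
open import Data.List.Relation.Unary.All using (_∷_)
open import Data.Nat.Base as ℕ using (ℕ; zero; suc; NonZero; z≤n; s≤s)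
open import Data.Nat.Coprimality as Coprime using (Coprime)
open import Data.Nat.Divisibility
open import Data.Nat.DivMod using (m/n*n≡m; [m+kn]%n≡m%n; m≡m%n+[m/n]*n; m<n⇒m%n≡m; m%n<n)
open import Data.Nat.GCD using (gcd; gcd[m,n]∣m; gcd[m,n]∣n; gcd-GCD; module Bézout)
open import Data.Nat.GeneralisedArithmetic using (fold; fold-+)
open import Data.Nat.Induction using (<-rec)
open import Data.Nat.Primality using (Prime; prime⇒nonZero; prime⇒nonTrivial; prime⇒irreducible)
open import Data.Nat.Primality.Factorisation using (factorise)
open import Data.Product.Base using (∃; ∃-syntax; ∃₂; _×_; _,_; proj₁; proj₂; uncurry)
open import Data.Sum.Base using (_⊎_; inj₁; inj₂)
open import Function.Base using (_∘_; case_of_; it)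
open import Function.Bundles using (Inverse)
open import Relation.Binary.Bundles using (Setoid)
open import Relation.Binary.PropositionalEquality
  using (_≡_; _≢_; refl; sym; trans; cong; cong₂; subst; module ≡-Reasoning)
open import Relation.Nullary using (¬_; Dec; yes; no; contradiction)
open import Relation.Nullary.Decidable using (dec⇒maybe; decidable-stable; ¬?; _×-dec_)
import Algebra.Properties.CommutativeMonoid.Sum as CommutativeMonoidSum
import Algebra.Properties.Semiring.Exp as SemiringExp
import Algebra.Solver.Ring as RingSolver
import Data.Bool.Properties as Bool
import Data.Fin.Properties as Fin
import Data.Maybe.Base as Maybe
import Data.Nat.Properties as ℕ
import Data.Nat.Tactic.RingSolver as ℕSolver

-- Prime powers, coprimality and parity

prime-divisor : ∀ {k} → 1 ℕ.< k → ∃[ p ] Prime p × p ∣ k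
prime-divisor {suc k} 1<k with factorise (suc k)
... | record { factors = [] ; isFactorisation = eq } = contradiction (sym eq) (ℕ.<⇒≢ 1<k)
... | record { factors = p ∷ ps ; isFactorisation = eq ; factorsPrime = pp ∷ _ } =
  p , pp , subst (p ∣_) (sym eq) (m∣m*n _)

split-prime-power : ∀ {p} → Prime p → ∀ k → .{{NonZero k}} → ∃₂ λ e k′ → k ≡ p ℕ.^ e ℕ.* k′ × ¬ p ∣ k′
split-prime-power {p} pp = <-rec _ go
  where
  go : ∀ k → (∀ {j} → j ℕ.< k → .{{NonZero j}} → ∃₂ λ e k′ → j ≡ p ℕ.^ e ℕ.* k′ × ¬ p ∣ k′) →
       .{{NonZero k}} → ∃₂ λ e k′ → k ≡ p ℕ.^ e ℕ.* k′ × ¬ p ∣ k′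
  go k rec with p ∣? k
  ... | no p∤k = 0 , k , sym (ℕ.*-identityˡ k) , p∤k
  ... | yes p∣k with rec (quotient-< p∣k {{prime⇒nonTrivial pp}}) {{quotient≢0 p∣k}}
  ...   | e , k′ , eq , p∤k′ = suc e , k′ , k≡ , p∤k′
    where
    open ≡-Reasoning
    k≡ : k ≡ p ℕ.^ suc e ℕ.* k′
    k≡ = begin
      k                         ≡⟨ m∣n⇒n≡m*quotient p∣k ⟩
      p ℕ.* quotient p∣k        ≡⟨ cong (p ℕ.*_) eq ⟩
      p ℕ.* (p ℕ.^ e ℕ.* k′)    ≡⟨ ℕ.*-assoc p (p ℕ.^ e) k′ ⟨
      p ℕ.^ suc e ℕ.* k′        ∎

prime∤⇒coprime : ∀ {p c} → Prime p → ¬ p ∣ c → Coprime c p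
prime∤⇒coprime pp p∤c (i∣c , i∣p) with prime⇒irreducible pp i∣p
... | inj₁ i≡1  = i≡1
... | inj₂ refl = contradiction i∣c p∤c

coprime-^ : ∀ {c p} e → Coprime c p → Coprime c (p ℕ.^ e)
coprime-^ zero    _ (_ , i∣1) = ∣1⇒≡1 i∣1
coprime-^ (suc e) c⊥p {i} (i∣c , i∣p^) = coprime-^ e c⊥p
  (i∣c , Coprime.coprime-divisor (λ (j∣i , j∣p) → c⊥p (∣-trans j∣i i∣c , j∣p)) i∣p^)

-- If `p` divides the cofactor `c`, one factor `p` cancels. Otherwise `c` is coprime to
-- `p ^ (e + 1)` and divides it, so `c` is 1.
prime-power-divisor : ∀ {p D} e → Prime p → D ∣ p ℕ.^ suc e → D ∣ p ℕ.^ e ⊎ D ≡ p ℕ.^ suc e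
prime-power-divisor {p} {D} e pp (divides c eq) with p ∣? c
... | yes (divides c′ refl) = inj₁ (divides c′ (ℕ.*-cancelˡ-≡ _ _ p {{prime⇒nonZero pp}} (begin
  p ℕ.* p ℕ.^ e       ≡⟨ eq ⟩
  c′ ℕ.* p ℕ.* D      ≡⟨ cong (ℕ._* D) (ℕ.*-comm c′ p) ⟩
  p ℕ.* c′ ℕ.* D      ≡⟨ ℕ.*-assoc p c′ D ⟩
  p ℕ.* (c′ ℕ.* D)    ∎)))
  where open ≡-Reasoning
... | no p∤c with coprime-^ (suc e) (prime∤⇒coprime pp p∤c) (∣-refl , divides D (trans eq (ℕ.*-comm c D)))
...   | refl = inj₂ (sym (trans eq (ℕ.*-identityˡ D)))

coprime-∣ : ∀ {a b k} → Coprime a b → a ∣ k → b ∣ k → a ℕ.* b ∣ k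
coprime-∣ {a} {b} a⊥b (divides c refl) b∣ca = subst (a ℕ.* b ∣_) (ℕ.*-comm a c)
  (*-monoʳ-∣ a (Coprime.coprime-divisor (Coprime.sym a⊥b) (subst (b ∣_) (ℕ.*-comm c a) b∣ca)))

even∨odd : ∀ a → ∃[ e ] (a ≡ e ℕ.+ e ⊎ a ≡ suc (e ℕ.+ e))
even∨odd zero = 0 , inj₁ refl
even∨odd (suc a) with even∨odd a
... | e , inj₁ refl = e , inj₂ refl
... | e , inj₂ refl = suc e , inj₁ (cong suc (sym (ℕ.+-suc e e)))

2∣e+e : ∀ e → 2 ∣ e ℕ.+ e
2∣e+e e = divides e (trans (cong (e ℕ.+_) (sym (ℕ.+-identityʳ e))) (ℕ.*-comm 2 e))

-- A product congruent to 1 modulo an even number is odd, and so are its factors. With `r = h + h`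
-- this shows that `s′` and `i` are odd.
odd-factor : ∀ {a b h y} → a ℕ.* b ≡ 1 ℕ.+ (h ℕ.+ h) ℕ.* y → ∃[ e ] a ≡ suc (e ℕ.+ e)
odd-factor {a} {b} {h} {y} eq with even∨odd a
... | e , inj₂ odd  = e , odd
... | e , inj₁ refl = contradiction (∣1⇒≡1 (∣m+n∣m⇒∣n
  (subst (2 ∣_) (trans eq (ℕ.+-comm 1 _)) (∣m⇒∣m*n b (2∣e+e e))) (∣m⇒∣m*n y (2∣e+e h)))) λ ()

-- Keeping the quotient `y` makes the congruence an equation, as needed for counting iterates of a
-- map.
coprime⇒inverse : ∀ {a r} → Coprime a r → 1 ℕ.< r → ∃₂ λ i y → a ℕ.* i ≡ 1 ℕ.+ r ℕ.* y
coprime⇒inverse {a} {r} a⊥r 1<r with Coprime.coprime-Bézout a⊥r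
... | Bézout.+- x y eq = x , y , trans (ℕ.*-comm a x) (trans (sym eq) (cong suc (ℕ.*-comm y r)))
-- Here `a * x` is congruent to -1 modulo `r`, so `x * (r - 1)` is an inverse of `a`.
coprime⇒inverse {a} {suc (suc ρ)} _ _           | Bézout.-+ x (suc η) eq =
  x ℕ.* suc ρ , ρ ℕ.+ η ℕ.* suc ρ , ℕ.+-cancelˡ-≡ (suc (suc ρ)) _ _ (begin
    suc (suc ρ) ℕ.+ a ℕ.* (x ℕ.* suc ρ)                          ≡⟨ left a x ρ ⟩
    suc (suc ρ ℕ.* (1 ℕ.+ x ℕ.* a))                              ≡⟨ cong (λ k → suc (suc ρ ℕ.* k)) eq ⟩
    suc (suc ρ ℕ.* (suc η ℕ.* suc (suc ρ)))                      ≡⟨ right η ρ ⟩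
    suc (suc ρ) ℕ.+ (1 ℕ.+ suc (suc ρ) ℕ.* (ρ ℕ.+ η ℕ.* suc ρ))  ∎)
  where
  open ≡-Reasoning
  left : ∀ a x ρ → suc (suc ρ) ℕ.+ a ℕ.* (x ℕ.* suc ρ) ≡ suc (suc ρ ℕ.* (1 ℕ.+ x ℕ.* a))
  left = ℕSolver.solve-∀
  right : ∀ η ρ → suc (suc ρ ℕ.* (suc η ℕ.* suc (suc ρ)))
                ≡ suc (suc ρ) ℕ.+ (1 ℕ.+ suc (suc ρ) ℕ.* (ρ ℕ.+ η ℕ.* suc ρ))
  right = ℕSolver.solve-∀
coprime⇒inverse {r = suc zero} _ (s≤s ()) | Bézout.-+ _ _ _

1<k+k : ∀ k → k ≢ 0 → 1 ℕ.< k ℕ.+ k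
1<k+k zero    0≢0 = contradiction refl 0≢0
1<k+k (suc k) _   = s≤s (subst (0 ℕ.<_) (sym (ℕ.+-suc k k)) (s≤s z≤n))

-- The arithmetic of m, s and their gcd

record EvenIndex (m s : ℕ) : Set where
  d : ℕ
  d = gcd m s
  field
    -- `h` is half of m/d, and `i` inverts `s′` = s/d modulo m/d with quotient `y`.
    h s′ i y : ℕ
    m≡       : (h ℕ.+ h) ℕ.* d ≡ m
    s≡       : s′ ℕ.* d ≡ s
    inverse  : s′ ℕ.* i ≡ 1 ℕ.+ (h ℕ.+ h) ℕ.* y

  r : ℕ
  r = h ℕ.+ h

  -- Hence the `r`-th iterate of σ is the identity on L.
  r*s≡s′*m : r ℕ.* s ≡ s′ ℕ.* m
  r*s≡s′*m = begin
    r ℕ.* s             ≡⟨ cong (r ℕ.*_) s≡ ⟨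
    r ℕ.* (s′ ℕ.* d)    ≡⟨ rearrange r s′ d ⟩
    s′ ℕ.* (r ℕ.* d)    ≡⟨ cong (s′ ℕ.*_) m≡ ⟩
    s′ ℕ.* m            ∎
    where
    open ≡-Reasoning
    rearrange : ∀ a b c → a ℕ.* (b ℕ.* c) ≡ b ℕ.* (a ℕ.* c)
    rearrange = ℕSolver.solve-∀

  -- Hence the `i`-th iterate of σ is the map x ↦ x^(2^d), which has the same fixed field as σ.
  i*s≡d+y*m : i ℕ.* s ≡ d ℕ.+ y ℕ.* m
  i*s≡d+y*m = begin
    i ℕ.* s                  ≡⟨ cong (i ℕ.*_) s≡ ⟨
    i ℕ.* (s′ ℕ.* d)         ≡⟨ rearrange i s′ d ⟩
    s′ ℕ.* i ℕ.* d           ≡⟨ cong (ℕ._* d) inverse ⟩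
    (1 ℕ.+ r ℕ.* y) ℕ.* d    ≡⟨ distribute r y d ⟩
    d ℕ.+ y ℕ.* (r ℕ.* d)    ≡⟨ cong (λ k → d ℕ.+ y ℕ.* k) m≡ ⟩
    d ℕ.+ y ℕ.* m            ∎
    where
    open ≡-Reasoning
    rearrange : ∀ a b c → a ℕ.* (b ℕ.* c) ≡ b ℕ.* a ℕ.* c
    rearrange = ℕSolver.solve-∀
    distribute : ∀ a b c → (1 ℕ.+ a ℕ.* b) ℕ.* c ≡ c ℕ.+ b ℕ.* (a ℕ.* c)
    distribute = ℕSolver.solve-∀

evenIndex : ∀ m s .{{_ : NonZero m}} → 2 ∣ ℕ._/_ m (gcd m s) {{gcd-nonZero m s}} → EvenIndex m s
evenIndex m s (divides q m/d≡q*2) = record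
  { h = q ; s′ = s ℕ./ gcd m s ; i = proj₁ solution ; y = proj₁ (proj₂ solution)
  ; m≡ = r*d≡m
  ; s≡ = m/n*n≡m (gcd[m,n]∣n m s)
  ; inverse = proj₂ (proj₂ solution)
  }
  where
  instance
    d≢0 : NonZero (gcd m s)
    d≢0 = gcd-nonZero m s
  m/d≡q+q : m ℕ./ gcd m s ≡ q ℕ.+ q
  m/d≡q+q = trans m/d≡q*2 (trans (ℕ.*-comm q 2) (cong (q ℕ.+_) (ℕ.+-identityʳ q)))
  r*d≡m : (q ℕ.+ q) ℕ.* gcd m s ≡ m
  r*d≡m = trans (cong (ℕ._* gcd m s) (sym m/d≡q+q)) (m/n*n≡m (gcd[m,n]∣m m s))
  1<q+q : 1 ℕ.< q ℕ.+ q
  1<q+q = 1<k+k q λ q≡0 → ℕ.≢-nonZero⁻¹ m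
    (trans (sym r*d≡m) (cong (λ q → (q ℕ.+ q) ℕ.* gcd m s) q≡0))
  solution = coprime⇒inverse (Coprime.sym (subst (λ r → Coprime r (s ℕ./ gcd m s)) m/d≡q+q
               (Coprime.coprime-/gcd m s))) 1<q+q

-- With a = w + 1, the congruence a ≡ -1 modulo a + 1 makes even powers of a congruent to 1 and, in
-- the next lemma, odd powers congruent to -1.
^-even : ∀ w e → ∃[ c ] suc w ℕ.^ (e ℕ.+ e) ≡ suc (c ℕ.* suc (suc w))
^-even w zero = 0 , refl
^-even w (suc e) = let c , eq = ^-even w e in w ℕ.+ c ℕ.+ w ℕ.* c ℕ.* suc (suc w) , (begin
  suc w ℕ.^ (suc e ℕ.+ suc e)                               ≡⟨ cong (suc w ℕ.^_) (cong suc (ℕ.+-suc e e)) ⟩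
  suc w ℕ.* (suc w ℕ.* suc w ℕ.^ (e ℕ.+ e))                 ≡⟨ cong (λ k → suc w ℕ.* (suc w ℕ.* k)) eq ⟩
  suc w ℕ.* (suc w ℕ.* suc (c ℕ.* suc (suc w)))             ≡⟨ identity w c ⟩
  suc ((w ℕ.+ c ℕ.+ w ℕ.* c ℕ.* suc (suc w)) ℕ.* suc (suc w)) ∎)
  where
  open ≡-Reasoning
  identity : ∀ w c → suc w ℕ.* (suc w ℕ.* suc (c ℕ.* suc (suc w)))
                   ≡ suc ((w ℕ.+ c ℕ.+ w ℕ.* c ℕ.* suc (suc w)) ℕ.* suc (suc w))
  identity = ℕSolver.solve-∀

1+a∣1+a^odd : ∀ a .{{_ : NonZero a}} e → suc a ∣ suc (a ℕ.^ suc (e ℕ.+ e))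
1+a∣1+a^odd (suc w) e = let c , eq = ^-even w e in
  divides (1 ℕ.+ suc w ℕ.* c) (trans (cong (λ k → suc (suc w ℕ.* k)) eq) (identity w c))
  where
  identity : ∀ w c → suc (suc w ℕ.* suc (c ℕ.* suc (suc w))) ≡ (1 ℕ.+ suc w ℕ.* c) ℕ.* suc (suc w)
  identity = ℕSolver.solve-∀

-- Finite fields of characteristic 2

module Field {m : ℕ} (L : FiniteField (2 ℕ.^ m)) where
  open FiniteField L public
  -- These are statements about L alone, so the instance s = 0 supplies them.
  open FamilyB {m} L 0 public using (1+1≡0; 0^n≡0; x+x≡0; -x≡x; cancel; x+y≡0⇒x≡y)
  open SemiringExp semiring public using (^-assocʳ)
  open CommutativeRing commutativeRing public using (+-assoc)

  private
    ⟦_⟧ : Bool → Carrier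
    ⟦ true  ⟧ = 1#
    ⟦ false ⟧ = 0#

    𝔽₂⟶L : CommutativeRing.rawRing Bool.xor-∧-commutativeRing
             -Raw-AlmostCommutative⟶ fromCommutativeRing commutativeRing
    𝔽₂⟶L = record
      { ⟦_⟧    = ⟦_⟧
      ; +-homo = λ { true true → sym 1+1≡0 ; true false → sym (+-identityʳ 1#)
                   ; false y → sym (+-identityˡ ⟦ y ⟧) }
      ; *-homo = λ { true y → sym (*-identityˡ ⟦ y ⟧) ; false y → sym (zeroˡ ⟦ y ⟧) }
      ; -‿homo = λ x → sym (-x≡x ⟦ x ⟧)
      ; 0-homo = refl
      ; 1-homo = refl
      }

  -- Coefficients in 𝔽₂ let the solver cancel x + x.
  open module Char2Solver = RingSolver
    (CommutativeRing.rawRing Bool.xor-∧-commutativeRing) (fromCommutativeRing commutativeRing)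
    𝔽₂⟶L (λ x y → Maybe.map (cong ⟦_⟧) (dec⇒maybe (x Bool.≟ y))) public
    using (solve; con; _:=_; _:+_; _:*_)

  n : ℕ
  n = 2 ℕ.^ m ℕ.∸ 1

  2^m≡1+n : 2 ℕ.^ m ≡ suc n
  2^m≡1+n = sym (ℕ.m+[n∸m]≡n (ℕ.m^n>0 2 m))

  -- Exhaustive search, monic polynomials and their roots

  search : ∀ {P : Carrier → Set} → (∀ x → Dec (P x)) → ∃ P ⊎ (∀ x → ¬ P x)
  search {P} P? with Fin.any? (P? ∘ Inverse.from cardinality)
  ... | yes (i , p) = inj₁ (Inverse.from cardinality i , p)
  ... | no  ¬p      = inj₂ λ x p → ¬p (Inverse.to cardinality x ,
                        subst P (sym (Inverse.strictlyInverseʳ cardinality x)) p)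

  -- Polynomials are represented by their functions, with the degree certified by Horner's rule f(x)
  -- = x h(x) + c, starting from the constant 1.
  data Monic : ℕ → (Carrier → Carrier) → Set where
    unit   : ∀ {f} → (∀ x → f x ≡ 1#) → Monic 0 f
    extend : ∀ {k f h} c → Monic k h → (∀ x → f x ≡ x * h x + c) → Monic (suc k) f

  -- Synthetic division by x + a, which is x - a in characteristic 2.
  divide : ∀ {k f} → Monic (suc k) f → ∀ a → ∃[ h ] Monic k h × (∀ x → f x ≡ (x + a) * h x + f a)
  divide {f = f} (extend {h = h} c (unit h≡1) f≡) a = h , unit h≡1 , λ x → begin
    f x                          ≡⟨ f≡ x ⟩
    x * h x + c                  ≡⟨ cong (λ u → x * u + c) (h≡1 x) ⟩
    x * 1# + c                   ≡⟨ solve 3 (λ x a c → x :* con true :+ c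
                                      := (x :+ a) :* con true :+ (a :* con true :+ c)) refl x a c ⟩
    (x + a) * 1# + (a * 1# + c)  ≡⟨ cong₂ (λ u v → (x + a) * u + (a * v + c)) (h≡1 x) (h≡1 a) ⟨
    (x + a) * h x + (a * h a + c) ≡⟨ cong ((x + a) * h x +_) (f≡ a) ⟨
    (x + a) * h x + f a          ∎
    where open ≡-Reasoning
  divide {f = f} (extend {h = h} c M@(extend _ _ _) f≡) a with divide M a
  ... | h′ , M′ , h≡ = (λ x → x * h′ x + h a) , extend (h a) M′ (λ _ → refl) , λ x → begin
    f x                                           ≡⟨ f≡ x ⟩
    x * h x + c                                   ≡⟨ cong (λ u → x * u + c) (h≡ x) ⟩
    x * ((x + a) * h′ x + h a) + c                ≡⟨ solve 5 (λ x a u v c → x :* ((x :+ a) :* u :+ v) :+ c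
                                                       := (x :+ a) :* (x :* u :+ v) :+ (a :* v :+ c))
                                                       refl x a (h′ x) (h a) c ⟩
    (x + a) * (x * h′ x + h a) + (a * h a + c)    ≡⟨ cong ((x + a) * (x * h′ x + h a) +_) (f≡ a) ⟨
    (x + a) * (x * h′ x + h a) + f a              ∎
    where open ≡-Reasoning

  -- After division by the first root, the remaining ones are roots of the quotient because they
  -- differ from the first.
  roots≤degree : ∀ {k l f} → Monic k f → (z : Fin l → Carrier) → (∀ {i j} → z i ≡ z j → i ≡ j) →
                 (∀ i → f (z i) ≡ 0#) → l ℕ.≤ k
  roots≤degree {l = zero} _ _ _ _ = z≤n
  roots≤degree {l = suc l} (unit f≡1) z _ root = contradiction (trans (sym (f≡1 _)) (root Fin.zero)) 1≢0
  roots≤degree {suc k} {suc l} {f} M@(extend _ _ _) z inj root with divide M (z Fin.zero)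
  ... | h , M′ , f≡ = s≤s (roots≤degree M′ (z ∘ Fin.suc) (Fin.suc-injective ∘ inj) λ i →
    cancel (λ eq → Fin.0≢1+n (sym (inj (x+y≡0⇒x≡y eq)))) (begin
      (z (Fin.suc i) + a) * h (z (Fin.suc i))         ≡⟨ +-identityʳ _ ⟨
      (z (Fin.suc i) + a) * h (z (Fin.suc i)) + 0#    ≡⟨ cong ((z (Fin.suc i) + a) * h (z (Fin.suc i)) +_) (root Fin.zero) ⟨
      (z (Fin.suc i) + a) * h (z (Fin.suc i)) + f a   ≡⟨ f≡ _ ⟨
      f (z (Fin.suc i))                               ≡⟨ root (Fin.suc i) ⟩
      0#                                              ≡⟨ zeroʳ _ ⟨
      (z (Fin.suc i) + a) * 0#                        ∎))
    where
    open ≡-Reasoning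
    a = z Fin.zero

  ^-monic : ∀ k → Monic k (_^ k)
  ^-monic zero    = unit λ _ → refl
  ^-monic (suc k) = extend 0# (^-monic k) λ x → sym (+-identityʳ (x * x ^ k))

  ^+1-monic : ∀ k → Monic (suc k) (λ x → x ^ suc k + 1#)
  ^+1-monic k = extend 1# (^-monic k) λ _ → refl

  -- The multiplicative group: Fermat's theorem, orders, primitive elements

  1^k≡1 : ∀ k → 1# ^ k ≡ 1#
  1^k≡1 zero    = refl
  1^k≡1 (suc k) = trans (*-identityˡ _) (1^k≡1 k)

  -- Otherwise every element of L would be a root of x (x^k + 1), whose degree k + 1 is less than
  -- 2^m.
  nontrivial-power : ∀ {k} → 0 ℕ.< k → k ℕ.< n → ∃[ x ] x ≢ 0# × x ^ k ≢ 1#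
  nontrivial-power {suc k} _ k<n with search (λ x → ¬? (x ≟ 0#) ×-dec ¬? ((x ^ suc k) ≟ 1#))
  ... | inj₁ found = found
  ... | inj₂ none  = contradiction
    (roots≤degree (extend 0# (^+1-monic k) λ _ → refl) (Inverse.from cardinality) from-injective
      (root ∘ Inverse.from cardinality))
    (ℕ.<⇒≱ (subst (suc (suc k) ℕ.<_) (sym 2^m≡1+n) (s≤s k<n)))
    where
    from-injective : ∀ {i j} → Inverse.from cardinality i ≡ Inverse.from cardinality j → i ≡ j
    from-injective {i} {j} eq = trans (sym (Inverse.strictlyInverseˡ cardinality i))
      (trans (cong (Inverse.to cardinality) eq) (Inverse.strictlyInverseˡ cardinality j))
    root : ∀ x → x * (x ^ suc k + 1#) + 0# ≡ 0#
    root x with x ≟ 0#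
    ... | yes refl = trans (+-identityʳ _) (zeroˡ _)
    ... | no  x≢0 with (x ^ suc k) ≟ 1#
    ...   | no  ≢1 = contradiction (x≢0 , ≢1) (none x)
    ...   | yes ≡1 = trans (+-identityʳ _)
      (trans (cong (x *_) (trans (cong (_+ 1#) ≡1) 1+1≡0)) (zeroʳ x))

  -- Multiplication by `x` permutes L and so preserves the product of all non-zero elements. The
  -- function `h` replaces 0 by 1 and `k` omits the factor `x` there, which lets the products run
  -- over all of L.
  fermat : ∀ {x} → x ≢ 0# → x ^ n ≡ 1#
  fermat {x} x≢0 = trans (sym ∏k≡x^n) (cancel (∏-nonZero h′ λ i → h-nonZero (from i)) (begin
    ∏ h′ * ∏ k′                    ≡⟨ *-comm (∏ h′) (∏ k′) ⟩
    ∏ k′ * ∏ h′                    ≡⟨ ∑-distrib-+ k′ h′ ⟨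
    ∏ (λ i → k′ i * h′ i)          ≡⟨ sum-cong-≗ (λ i → h-* (from i)) ⟨
    ∏ (λ i → h (x * from i))       ≡⟨ sum-cong-≗ (λ i → cong h (strictlyInverseʳ (x * from i))) ⟨
    ∏ (λ i → h (from (to (x * from i))))  ≡⟨ sum-permute h′ π ⟨
    ∏ h′                           ≡⟨ *-identityʳ (∏ h′) ⟨
    ∏ h′ * 1#                      ∎))
    where
    open ≡-Reasoning
    open Inverse (subst (HasCardinality _) 2^m≡1+n cardinality)
    open CommutativeMonoidSum (CommutativeRing.*-commutativeMonoid commutativeRing) renaming (sum to ∏)
    h k : Carrier → Carrier
    h y with y ≟ 0#
    ... | yes _ = 1#
    ... | no  _ = y
    k y with y ≟ 0#
    ... | yes _ = 1#
    ... | no  _ = x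
    h′ k′ : Fin (suc n) → Carrier
    h′ = h ∘ from
    k′ = k ∘ from
    h-nonZero : ∀ y → h y ≢ 0#
    h-nonZero y with y ≟ 0#
    ... | yes _  = 1≢0
    ... | no y≢0 = y≢0
    h-* : ∀ y → h (x * y) ≡ k y * h y
    h-* y with y ≟ 0# | (x * y) ≟ 0#
    ... | yes _    | yes _     = sym (*-identityˡ 1#)
    ... | yes refl | no  xy≢0  = contradiction (zeroʳ x) xy≢0
    ... | no  y≢0  | yes xy≡0  = contradiction xy≡0 (*-nonZero x≢0 y≢0)
    ... | no  _    | no  _     = refl
    k[0]≡1 : k 0# ≡ 1#
    k[0]≡1 with 0# ≟ 0#
    ... | yes _  = refl
    ... | no 0≢0 = contradiction refl 0≢0
    k≡x : ∀ {y} → y ≢ 0# → k y ≡ x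
    k≡x {y} y≢0 with y ≟ 0#
    ... | yes y≡0 = contradiction y≡0 y≢0
    ... | no  _   = refl
    ∏-nonZero : ∀ {j} (f : Fin j → Carrier) → (∀ i → f i ≢ 0#) → ∏ f ≢ 0#
    ∏-nonZero {zero}  f _   = 1≢0
    ∏-nonZero {suc j} f f≢0 = *-nonZero (f≢0 Fin.zero) (∏-nonZero (f ∘ Fin.suc) (f≢0 ∘ Fin.suc))
    undo : ∀ {u v} → u * v ≡ 1# → ∀ y → u * (v * y) ≡ y
    undo uv≡1 y = trans (sym (*-assoc _ _ y)) (trans (cong (_* y) uv≡1) (*-identityˡ y))
    π = permutation (λ i → to (x * from i)) (λ i → to (x ⁻¹ * from i))
      (λ i → trans (cong (λ y → to (x * y)) (strictlyInverseʳ (x ⁻¹ * from i)))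
               (trans (cong to (undo (⁻¹-inverseʳ x≢0) (from i))) (strictlyInverseˡ i)))
      (λ i → trans (cong (λ y → to (x ⁻¹ * y)) (strictlyInverseʳ (x * from i)))
               (trans (cong to (undo (⁻¹-inverseˡ x≢0) (from i))) (strictlyInverseˡ i)))
    ∏k≡x^n : ∏ k′ ≡ x ^ n
    ∏k≡x^n = begin
      ∏ k′                                               ≡⟨ sum-remove {i = to 0#} k′ ⟩
      k′ (to 0#) * ∏ (λ j → k′ (Fin.punchIn (to 0#) j))  ≡⟨ cong₂ _*_
        (trans (cong k (strictlyInverseʳ 0#)) k[0]≡1)
        (sum-cong-≗ λ j → k≡x λ eq → Fin.punchInᵢ≢i (to 0#) j
          (trans (sym (strictlyInverseˡ _)) (cong to eq))) ⟩
      1# * ∏ {n} (λ _ → x)                               ≡⟨ *-identityˡ _ ⟩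
      ∏ {n} (λ _ → x)                                    ≡⟨ sum-replicate n ⟩
      x ^ n                                              ∎

  ^-∣ : ∀ x {a b} → a ∣ b → x ^ a ≡ 1# → x ^ b ≡ 1#
  ^-∣ x {a} (divides c refl) eq = trans (cong (x ^_) (ℕ.*-comm c a))
    (trans (sym (^-assocʳ x a c)) (trans (cong (_^ c) eq) (1^k≡1 c)))

  ^-cancelʳ : ∀ x a b → x ^ b ≡ 1# → x ^ (a ℕ.+ b) ≡ 1# → x ^ a ≡ 1#
  ^-cancelʳ x a b b≡1 a+b≡1 = begin
    x ^ a           ≡⟨ *-identityʳ (x ^ a) ⟨
    x ^ a * 1#      ≡⟨ cong (x ^ a *_) b≡1 ⟨
    x ^ a * x ^ b   ≡⟨ ^-homo-* x a b ⟨
    x ^ (a ℕ.+ b)   ≡⟨ a+b≡1 ⟩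
    1#              ∎
    where open ≡-Reasoning

  ^-gcd : ∀ x a b → x ^ a ≡ 1# → x ^ b ≡ 1# → x ^ gcd a b ≡ 1#
  ^-gcd x a b a≡1 b≡1 with Bézout.identity (gcd-GCD a b)
  ... | Bézout.+- u v eq = ^-cancelʳ x (gcd a b) (v ℕ.* b) (^-∣ x (n∣m*n v) b≡1)
                             (trans (cong (x ^_) eq) (^-∣ x (n∣m*n u) a≡1))
  ... | Bézout.-+ u v eq = ^-cancelʳ x (gcd a b) (u ℕ.* a) (^-∣ x (n∣m*n u) a≡1)
                             (trans (cong (x ^_) eq) (^-∣ x (n∣m*n v) b≡1))

  HasOrder : Carrier → ℕ → Set
  HasOrder x N = x ^ N ≡ 1# × (∀ k → x ^ k ≡ 1# → N ∣ k)

  -- If (x y)^k = 1, raising to the power `a` removes x, so b divides a k and hence k. The same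
  -- argument with the roles exchanged gives a, and coprimality combines the two.
  *-order : ∀ {x y a b} → Coprime a b → HasOrder x a → HasOrder y b → HasOrder (x * y) (a ℕ.* b)
  *-order {x} {y} {a} {b} a⊥b (x^a≡1 , ord-x) (y^b≡1 , ord-y) =
      trans (^-distrib-* x y (a ℕ.* b))
        (trans (cong₂ _*_ (^-∣ x (m∣m*n {a} b) x^a≡1) (^-∣ y (n∣m*n a) y^b≡1)) (*-identityˡ 1#))
    , λ k eq → coprime-∣ a⊥b
        (Coprime.coprime-divisor a⊥b (ord-x (b ℕ.* k) (factor y x b k y^b≡1
          (trans (cong (_^ k) (*-comm y x)) eq))))
        (Coprime.coprime-divisor (Coprime.sym a⊥b) (ord-y (a ℕ.* k) (factor x y a k x^a≡1 eq)))
    where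
    factor : ∀ x y a k → x ^ a ≡ 1# → (x * y) ^ k ≡ 1# → y ^ (a ℕ.* k) ≡ 1#
    factor x y a k x^a≡1 eq = begin
      y ^ (a ℕ.* k)                    ≡⟨ *-identityˡ _ ⟨
      1# * y ^ (a ℕ.* k)               ≡⟨ cong (_* _) (^-∣ x (m∣m*n {a} k) x^a≡1) ⟨
      x ^ (a ℕ.* k) * y ^ (a ℕ.* k)    ≡⟨ ^-distrib-* x y (a ℕ.* k) ⟨
      (x * y) ^ (a ℕ.* k)              ≡⟨ ^-∣ (x * y) (n∣m*n a) eq ⟩
      1#                               ∎
      where open ≡-Reasoning

  -- If x^k = 1, then the gcd of k and p^(e+1) also annihilates x. A proper divisor of p^(e+1)
  -- divides p^e, so this gcd is p^(e+1) itself.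
  prime-power-order : ∀ {x p} e → Prime p → x ^ (p ℕ.^ suc e) ≡ 1# → x ^ (p ℕ.^ e) ≢ 1# →
                      HasOrder x (p ℕ.^ suc e)
  prime-power-order {x} {p} e pp eq ≢1 = eq , λ k k≡1 →
    case (prime-power-divisor e pp (gcd[m,n]∣n k (p ℕ.^ suc e))) of λ where
      (inj₁ D∣p^e) → contradiction (^-∣ x D∣p^e (^-gcd x k (p ℕ.^ suc e) k≡1 eq)) ≢1
      (inj₂ D≡)    → subst (_∣ k) D≡ (gcd[m,n]∣m k (p ℕ.^ suc e))

  module _ (n>0 : 0 ℕ.< n) where

    -- Induction splits off the full power p^(e+1) of a prime in `N`. With c = n / p^(e+1), the
    -- power z^c has order p^(e+1) as soon as z^(n/p) ≠ 1, and `nontrivial-power` provides such a z.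
    element-of-order : ∀ N → .{{NonZero N}} → N ∣ n → ∃[ x ] HasOrder x N
    element-of-order = <-rec _ go
      where
      go : ∀ N → (∀ {M} → M ℕ.< N → .{{NonZero M}} → M ∣ n → ∃[ x ] HasOrder x M) →
           .{{NonZero N}} → N ∣ n → ∃[ x ] HasOrder x N
      go 1 _ _ = 1# , *-identityˡ 1# , λ k _ → 1∣ k
      go N@(suc (suc _)) rec N∣n with prime-divisor {N} (s≤s (s≤s z≤n))
      ... | p , pp , p∣N with split-prime-power pp N
      ...   | zero  , N′ , eq , p∤N′ = contradiction (subst (p ∣_) (trans eq (ℕ.*-identityˡ N′)) p∣N) p∤N′
      ...   | suc e , N′ , eq , p∤N′ = x * y , subst (HasOrder (x * y)) (trans (ℕ.*-comm N′ _) (sym eq))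
          (*-order (coprime-^ (suc e) (prime∤⇒coprime pp p∤N′)) ord-x ord-y)
        where
        instance
          p≢0 : NonZero p
          p≢0 = prime⇒nonZero pp
          N′≢0 : NonZero N′
          N′≢0 = ℕ.≢-nonZero λ { refl → contradiction (trans eq (ℕ.*-zeroʳ (p ℕ.^ suc e))) λ () }
        N′<N : N′ ℕ.< N
        N′<N = subst (N′ ℕ.<_) (trans (ℕ.*-comm N′ _) (sym eq)) (ℕ.m<m*n N′ (p ℕ.^ suc e)
          (ℕ.<-≤-trans (ℕ.nonTrivial⇒n>1 p {{prime⇒nonTrivial pp}}) (ℕ.m≤m*n p (p ℕ.^ e) {{ℕ.m^n≢0 p e}})))
        P∣n : p ℕ.^ suc e ∣ n
        P∣n = ∣-trans (subst (p ℕ.^ suc e ∣_) (sym eq) (m∣m*n N′)) N∣n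
        N′∣n : N′ ∣ n
        N′∣n = ∣-trans (subst (N′ ∣_) (sym eq) (n∣m*n (p ℕ.^ suc e))) N∣n
        x : Carrier
        x = proj₁ (rec N′<N N′∣n)
        ord-x = proj₂ (rec N′<N N′∣n)
        c = quotient P∣n
        n≡ : n ≡ c ℕ.* p ℕ.^ e ℕ.* p
        n≡ = begin
          n                          ≡⟨ m∣n⇒n≡quotient*m P∣n ⟩
          c ℕ.* (p ℕ.* p ℕ.^ e)      ≡⟨ cong (c ℕ.*_) (ℕ.*-comm p _) ⟩
          c ℕ.* (p ℕ.^ e ℕ.* p)      ≡⟨ ℕ.*-assoc c _ p ⟨
          c ℕ.* p ℕ.^ e ℕ.* p        ∎
          where open ≡-Reasoning
        instance
          cp^e≢0 : NonZero (c ℕ.* p ℕ.^ e)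
          cp^e≢0 = ℕ.≢-nonZero λ z → ℕ.<⇒≢ n>0 (sym (trans n≡ (cong (ℕ._* p) z)))
        z = nontrivial-power {c ℕ.* p ℕ.^ e} (ℕ.>-nonZero⁻¹ _)
              (subst (c ℕ.* p ℕ.^ e ℕ.<_) (sym n≡) (ℕ.m<m*n _ p (ℕ.nonTrivial⇒n>1 p {{prime⇒nonTrivial pp}})))
        y = proj₁ z ^ c
        ord-y = prime-power-order {y} e pp
          (trans (^-assocʳ (proj₁ z) c _)
            (trans (cong (proj₁ z ^_) (sym (m∣n⇒n≡quotient*m P∣n))) (fermat (proj₁ (proj₂ z)))))
          (proj₂ (proj₂ z) ∘ trans (sym (^-assocʳ (proj₁ z) c _)))

    primitive-element : ∃[ g ] HasOrder g n
    primitive-element = element-of-order n {{ℕ.>-nonZero n>0}} ∣-refl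

  module _ {g : Carrier} {N : ℕ} (ord : HasOrder g N) where

    order-∣∸ : .{{NonZero N}} → ∀ {a b} → a ℕ.≤ b → g ^ a ≡ g ^ b → N ∣ b ℕ.∸ a
    order-∣∸ {a} {b} a≤b eq = proj₂ ord (b ℕ.∸ a) (cancel (^-nonZero a g≢0) (begin
      g ^ a * g ^ (b ℕ.∸ a)   ≡⟨ ^-homo-* g a (b ℕ.∸ a) ⟨
      g ^ (a ℕ.+ (b ℕ.∸ a))   ≡⟨ cong (g ^_) (ℕ.m+[n∸m]≡n a≤b) ⟩
      g ^ b                   ≡⟨ eq ⟨
      g ^ a                   ≡⟨ *-identityʳ (g ^ a) ⟨
      g ^ a * 1#              ∎))
      where
      open ≡-Reasoning
      g≢0 : g ≢ 0#
      g≢0 refl = 1≢0 (trans (sym (proj₁ ord)) (0^n≡0 N))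

    order-injective-≤ : ∀ {a b} → a ℕ.≤ b → b ℕ.< N → g ^ a ≡ g ^ b → a ≡ b
    order-injective-≤ {a} {b} a≤b b<N eq with b ℕ.∸ a in b∸a | order-∣∸ {{ℕ.>-nonZero (ℕ.≤-<-trans z≤n b<N)}} a≤b eq
    ... | zero  | _     = ℕ.≤-antisym a≤b (ℕ.m∸n≡0⇒m≤n b∸a)
    ... | suc j | N∣1+j = contradiction (∣⇒≤ N∣1+j)
                            (ℕ.<⇒≱ (ℕ.≤-<-trans (subst (ℕ._≤ b) b∸a (ℕ.m∸n≤m b a)) b<N))

    order-injective : ∀ {a b} → a ℕ.< N → b ℕ.< N → g ^ a ≡ g ^ b → a ≡ b
    order-injective {a} {b} a<N b<N eq with ℕ.≤-total a b
    ... | inj₁ a≤b = order-injective-≤ a≤b b<N eq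
    ... | inj₂ b≤a = sym (order-injective-≤ b≤a a<N (sym eq))

  -- If y were different from the n distinct powers of g, then x^n + 1 would have n + 1 roots.
  discrete-log : ∀ {g} → 0 ℕ.< n → HasOrder g n → ∀ {y} → y ≢ 0# → ∃[ j ] y ≡ g ^ j
  discrete-log {g} n>0 ord {y} y≢0 with Fin.any? (λ (j : Fin n) → y ≟ (g ^ Fin.toℕ j))
  ... | yes (j , y≡g^j) = Fin.toℕ j , y≡g^j
  ... | no  none = contradiction (roots≤degree monic z z-injective z-root) ℕ.1+n≰n
    where
    monic : Monic n (λ x → x ^ n + 1#)
    monic = subst (λ k → Monic k (λ x → x ^ k + 1#)) (ℕ.suc-pred n {{ℕ.>-nonZero n>0}}) (^+1-monic (ℕ.pred n))
    z : Fin (suc n) → Carrier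
    z Fin.zero    = y
    z (Fin.suc j) = g ^ Fin.toℕ j
    z-injective : ∀ {i j} → z i ≡ z j → i ≡ j
    z-injective {Fin.zero}  {Fin.zero}  _  = refl
    z-injective {Fin.zero}  {Fin.suc j} eq = contradiction (j , eq) none
    z-injective {Fin.suc i} {Fin.zero}  eq = contradiction (i , sym eq) none
    z-injective {Fin.suc i} {Fin.suc j} eq =
      cong Fin.suc (Fin.toℕ-injective (order-injective ord (Fin.toℕ<n i) (Fin.toℕ<n j) eq))
    z-root : ∀ i → z i ^ n + 1# ≡ 0#
    z-root Fin.zero    = trans (cong (_+ 1#) (fermat y≢0)) 1+1≡0
    z-root (Fin.suc j) = trans (cong (_+ 1#) (trans (^-assocʳ g (Fin.toℕ j) n)
      (^-∣ g (n∣m*n (Fin.toℕ j)) (proj₁ ord)))) 1+1≡0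

  -- Powers of the Frobenius map

  F : ℕ → Carrier → Carrier
  F k x = x ^ (2 ℕ.^ k)

  F-+ : ∀ k x y → F k (x + y) ≡ F k x + F k y
  F-+ k = FamilyB.^σ-+ {m} L k

  F-* : ∀ k x y → F k (x * y) ≡ F k x * F k y
  F-* k = FamilyB.^σ-* {m} L k

  F-0 : ∀ k → F k 0# ≡ 0#
  F-0 k = FamilyB.0^σ≡0 {m} L k

  F-1 : ∀ k → F k 1# ≡ 1#
  F-1 k = FamilyB.1^σ≡1 {m} L k

  F-id : ∀ x → F 0 x ≡ x
  F-id = *-identityʳ

  F-∘ : ∀ j k x → F (j ℕ.+ k) x ≡ F j (F k x)
  F-∘ j k x = trans (cong (x ^_) (trans (ℕ.^-distribˡ-+-* 2 j k) (ℕ.*-comm (2 ℕ.^ j) _)))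
                    (sym (^-assocʳ x (2 ℕ.^ k) (2 ℕ.^ j)))

  F-suc : ∀ k x → F (suc k) x ≡ F k x * F k x
  F-suc k x = trans (F-∘ 1 k x) (cong (F k x *_) (*-identityʳ (F k x)))

  F-nonZero : ∀ k {x} → x ≢ 0# → F k x ≢ 0#
  F-nonZero k = ^-nonZero (2 ℕ.^ k)

  F-injective : ∀ k {x y} → F k x ≡ F k y → x ≡ y
  F-injective k {x} {y} eq with (x + y) ≟ 0#
  ... | yes x+y≡0 = x+y≡0⇒x≡y x+y≡0
  ... | no  x+y≢0 = contradiction
    (trans (F-+ k x y) (trans (cong (_+ F k y) eq) (x+x≡0 _))) (F-nonZero k x+y≢0)

  F-^ : ∀ k x j → F k (x ^ j) ≡ F k x ^ j
  F-^ k x j = trans (^-assocʳ x j (2 ℕ.^ k))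
    (trans (cong (x ^_) (ℕ.*-comm j (2 ℕ.^ k))) (sym (^-assocʳ x (2 ℕ.^ k) j)))

  F-⁻¹ : ∀ k {x} → x ≢ 0# → F k (x ⁻¹) ≡ F k x ⁻¹
  F-⁻¹ k {x} x≢0 = cancel (F-nonZero k x≢0) (begin
    F k x * F k (x ⁻¹)  ≡⟨ F-* k x (x ⁻¹) ⟨
    F k (x * x ⁻¹)      ≡⟨ cong (F k) (⁻¹-inverseʳ x≢0) ⟩
    F k 1#              ≡⟨ F-1 k ⟩
    1#                  ≡⟨ ⁻¹-inverseʳ (F-nonZero k x≢0) ⟨
    F k x * F k x ⁻¹    ∎)
    where open ≡-Reasoning

  F-m : ∀ x → F m x ≡ x
  F-m x with x ≟ 0#
  ... | yes refl = F-0 m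
  ... | no  x≢0  = trans (cong (x ^_) 2^m≡1+n) (trans (cong (x *_) (fermat x≢0)) (*-identityʳ x))

  F-fixed-* : ∀ j {k x} → F k x ≡ x → F (j ℕ.* k) x ≡ x
  F-fixed-* zero    {k} {x} _  = F-id x
  F-fixed-* (suc j) {k} {x} eq = trans (F-∘ k (j ℕ.* k) x) (trans (cong (F k) (F-fixed-* j eq)) eq)

  F-*m : ∀ j x → F (j ℕ.* m) x ≡ x
  F-*m j x = F-fixed-* j (F-m x)

  -- Bézout's identity, with the negative multiple moved to the other side so that only iterates
  -- fixing x occur.
  F-fixed-gcd : ∀ j k {x} → F j x ≡ x → F k x ≡ x → F (gcd j k) x ≡ x
  F-fixed-gcd j k {x} Fj Fk with Bézout.identity (gcd-GCD j k)
  ... | Bézout.+- u v eq = begin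
    F (gcd j k) x               ≡⟨ cong (F (gcd j k)) (F-fixed-* v Fk) ⟨
    F (gcd j k) (F (v ℕ.* k) x) ≡⟨ F-∘ (gcd j k) (v ℕ.* k) x ⟨
    F (gcd j k ℕ.+ v ℕ.* k) x   ≡⟨ cong (λ e → F e x) eq ⟩
    F (u ℕ.* j) x               ≡⟨ F-fixed-* u Fj ⟩
    x                           ∎
    where open ≡-Reasoning
  ... | Bézout.-+ u v eq = begin
    F (gcd j k) x               ≡⟨ cong (F (gcd j k)) (F-fixed-* u Fj) ⟨
    F (gcd j k) (F (u ℕ.* j) x) ≡⟨ F-∘ (gcd j k) (u ℕ.* j) x ⟨
    F (gcd j k ℕ.+ u ℕ.* j) x   ≡⟨ cong (λ e → F e x) eq ⟩
    F (v ℕ.* k) x               ≡⟨ F-fixed-* v Fk ⟩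
    x                           ∎
    where open ≡-Reasoning

  -- Sums of conjugates, traces and quadratic equations

  ∑ : ℕ → (ℕ → Carrier) → Carrier
  ∑ zero    f = 0#
  ∑ (suc k) f = ∑ k f + f k

  ∑-cong : ∀ k {f g} → (∀ i → f i ≡ g i) → ∑ k f ≡ ∑ k g
  ∑-cong zero    eq = refl
  ∑-cong (suc k) eq = cong₂ _+_ (∑-cong k eq) (eq k)

  ∑-+ : ∀ k f g → ∑ k (λ i → f i + g i) ≡ ∑ k f + ∑ k g
  ∑-+ zero    f g = sym (+-identityʳ 0#)
  ∑-+ (suc k) f g = trans (cong (_+ (f k + g k)) (∑-+ k f g))
    (solve 4 (λ a b x y → a :+ b :+ (x :+ y) := (a :+ x) :+ (b :+ y)) refl (∑ k f) (∑ k g) (f k) (g k))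

  ∑-* : ∀ k c f → ∑ k (λ i → c * f i) ≡ c * ∑ k f
  ∑-* zero    c f = sym (zeroʳ c)
  ∑-* (suc k) c f = trans (cong (_+ c * f k) (∑-* k c f)) (sym (distribˡ c (∑ k f) (f k)))

  ∑-square : ∀ k f → ∑ k f * ∑ k f ≡ ∑ k (λ i → f i * f i)
  ∑-square zero    f = zeroˡ 0#
  ∑-square (suc k) f = trans
    (solve 2 (λ a b → (a :+ b) :* (a :+ b) := a :* a :+ b :* b) refl (∑ k f) (f k))
    (cong (_+ f k * f k) (∑-square k f))

  ∑-shift : ∀ k f → f 0 + ∑ k (f ∘ suc) ≡ ∑ (suc k) f
  ∑-shift zero    f = trans (+-identityʳ (f 0)) (sym (+-identityˡ (f 0)))
  ∑-shift (suc k) f = trans (sym (+-assoc (f 0) _ _)) (cong (_+ f (suc k)) (∑-shift k f))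

  ∑-cycle : ∀ k f → f k ≡ f 0 → ∑ k (f ∘ suc) ≡ ∑ k f
  ∑-cycle k f eq = begin
    ∑ k (f ∘ suc)                ≡⟨ solve 2 (λ a b → a := b :+ (b :+ a)) refl _ (f 0) ⟩
    f 0 + (f 0 + ∑ k (f ∘ suc))  ≡⟨ cong₂ _+_ (sym eq) (∑-shift k f) ⟩
    f k + (∑ k f + f k)          ≡⟨ solve 2 (λ a b → b :+ (a :+ b) := a) refl _ (f k) ⟩
    ∑ k f                        ∎
    where open ≡-Reasoning

  ∑-split : ∀ j k f → ∑ (k ℕ.+ j) f ≡ ∑ j f + ∑ k (λ i → f (i ℕ.+ j))
  ∑-split j zero    f = sym (+-identityʳ _)
  ∑-split j (suc k) f = trans (cong (_+ f (k ℕ.+ j)) (∑-split j k f)) (+-assoc _ _ _)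

  -- Dedekind's argument: comparing the relation at c₀ c with F c₀ times the relation at c,
  -- for the last automorphism F, removes the last term.
  F-independent : ∀ j k (a : ℕ → Carrier) → (∀ i → 0 ℕ.< i → i ℕ.≤ j → ∃[ c ] F (i ℕ.* k) c ≢ c) →
                  a 0 ≢ 0# → ¬ (∀ c → ∑ (suc j) (λ i → a i * F (i ℕ.* k) c) ≡ 0#)
  F-independent zero k a _ a₀≢0 vanish = *-nonZero a₀≢0 1≢0 (begin
    a 0 * 1#           ≡⟨ cong (a 0 *_) (F-id 1#) ⟨
    a 0 * F 0 1#       ≡⟨ +-identityˡ _ ⟨
    0# + a 0 * F 0 1#  ≡⟨ vanish 1# ⟩
    0#                 ∎)
    where open ≡-Reasoning
  F-independent (suc j) k a moves a₀≢0 vanish = F-independent j k a′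
    (λ i i>0 i≤j → moves i i>0 (ℕ.m≤n⇒m≤1+n i≤j))
    (*-nonZero a₀≢0 λ eq → proj₂ (moves (suc j) (s≤s z≤n) ℕ.≤-refl)
      (sym (trans (sym (F-id c₀)) (x+y≡0⇒x≡y eq))))
    vanish′
    where
    open ≡-Reasoning
    c₀ = proj₁ (moves (suc j) (s≤s z≤n) ℕ.≤-refl)
    e = F (suc j ℕ.* k) c₀
    a′ : ℕ → Carrier
    a′ i = a i * (F (i ℕ.* k) c₀ + e)
    vanish′ : ∀ c → ∑ (suc j) (λ i → a′ i * F (i ℕ.* k) c) ≡ 0#
    vanish′ c = begin
      ∑ (suc j) (λ i → a′ i * F (i ℕ.* k) c)
        ≡⟨ solve 4 (λ u v w x → u := u :+ v :* (w :+ w) :* x) refl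
             _ (a (suc j)) e (F (suc j ℕ.* k) c) ⟩
      ∑ (2 ℕ.+ j) (λ i → a′ i * F (i ℕ.* k) c)
        ≡⟨ ∑-cong (2 ℕ.+ j) (λ i → trans
             (solve 4 (λ u v w x → u :* (v :+ w) :* x := u :* (v :* x) :+ w :* (u :* x)) refl
               (a i) (F (i ℕ.* k) c₀) e (F (i ℕ.* k) c))
             (cong (λ u → a i * u + e * (a i * F (i ℕ.* k) c)) (sym (F-* (i ℕ.* k) c₀ c)))) ⟩
      ∑ (2 ℕ.+ j) (λ i → a i * F (i ℕ.* k) (c₀ * c) + e * (a i * F (i ℕ.* k) c))
        ≡⟨ ∑-+ (2 ℕ.+ j) _ _ ⟩
      ∑ (2 ℕ.+ j) (λ i → a i * F (i ℕ.* k) (c₀ * c)) + ∑ (2 ℕ.+ j) (λ i → e * (a i * F (i ℕ.* k) c))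
        ≡⟨ cong₂ _+_ (vanish (c₀ * c)) (∑-* (2 ℕ.+ j) e _) ⟩
      0# + e * ∑ (2 ℕ.+ j) (λ i → a i * F (i ℕ.* k) c)
        ≡⟨ cong (λ u → 0# + e * u) (vanish c) ⟩
      0# + e * 0#
        ≡⟨ solve 1 (λ e → con false :+ e :* con false := con false) refl e ⟩
      0# ∎

  module _ .{{_ : NonZero m}} where

    n>0 : 0 ℕ.< n
    n>0 = ℕ.m<n⇒0<n∸m (ℕ.^-monoʳ-< 2 (s≤s (s≤s z≤n)) (ℕ.>-nonZero⁻¹ m))

    -- A fixed non-zero element satisfies x^(2^i - 1) = 1, and the exponent is positive and less
    -- than n.
    F-moves : ∀ {i} → 0 ℕ.< i → i ℕ.< m → ∃[ c ] F i c ≢ c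
    F-moves {i} i>0 i<m with nontrivial-power {2 ℕ.^ i ℕ.∸ 1}
      (ℕ.m<n⇒0<n∸m (ℕ.^-monoʳ-< 2 (s≤s (s≤s z≤n)) i>0))
      (ℕ.∸-monoˡ-< (ℕ.^-monoʳ-< 2 (s≤s (s≤s z≤n)) i<m) (ℕ.m^n>0 2 i))
    ... | x , x≢0 , ≢1 = x , λ eq → ≢1 (cancel x≢0 (begin
      x * x ^ (2 ℕ.^ i ℕ.∸ 1)   ≡⟨ cong (x ^_) (ℕ.m+[n∸m]≡n (ℕ.m^n>0 2 i)) ⟩
      x ^ (2 ℕ.^ i)             ≡⟨ eq ⟩
      x                         ≡⟨ *-identityʳ x ⟨
      x * 1#                    ∎))
      where open ≡-Reasoning

    -- As r k = m, each index 0 < i < r gives an exponent i k strictly between 0 and m, so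
    -- `F-independent` applies. Exhaustive search turns its conclusion into a witness.
    ∑F-nonZero : ∀ r {k} → r ℕ.* k ≡ m → (a : ℕ → Carrier) → a 0 ≢ 0# →
                 ∃[ c ] ∑ r (λ i → a i * F (i ℕ.* k) c) ≢ 0#
    ∑F-nonZero zero        refl = contradiction refl (ℕ.≢-nonZero⁻¹ 0)
    ∑F-nonZero (suc j) {k} rk≡m a a₀≢0
      with search (λ c → ¬? (∑ (suc j) (λ i → a i * F (i ℕ.* k) c) ≟ 0#))
    ... | inj₁ found = found
    ... | inj₂ none  = contradiction (λ c → decidable-stable (_ ≟ 0#) (none c))
      (F-independent j k a (λ i i>0 i≤j → F-moves (ℕ.*-mono-< i>0 k>0)
        (subst (i ℕ.* k ℕ.<_) rk≡m (ℕ.*-monoˡ-< k {{ℕ.>-nonZero k>0}} (s≤s i≤j)))) a₀≢0)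
      where
      k>0 : 0 ℕ.< k
      k>0 = ℕ.>-nonZero⁻¹ k {{ℕ.m*n≢0⇒n≢0 (suc j) {{subst NonZero (sym rk≡m) it}}}}

    -- Additive Hilbert 90, with the explicit solution z = ∑ⱼ (c + … + F^{j-1} c) F^j θ where θ has trace 1.
    artin-schreier : ∀ c → ∑ m (λ i → F i c) ≡ 0# → ∃[ z ] z * z ≡ z + c
    artin-schreier c tr≡0 with ∑F-nonZero m (ℕ.*-identityʳ m) (λ _ → 1#) 1≢0
    ... | θ , tr≢0 = z , (begin
      z * z                                         ≡⟨ ∑-square m _ ⟩
      ∑ m (λ j → (S j * F j θ) * (S j * F j θ))     ≡⟨ ∑-cong m term ⟩
      ∑ m (λ j → S (suc j) * F (suc j) θ + c * F (suc j) θ)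
                                                    ≡⟨ ∑-+ m _ _ ⟩
      ∑ m (λ j → S (suc j) * F (suc j) θ) + ∑ m (λ j → c * F (suc j) θ)
                                                    ≡⟨ cong₂ _+_ (∑-cycle m (λ j → S j * F j θ)
                                                         (trans (cong (_* F m θ) tr≡0) (trans (zeroˡ _) (sym (zeroˡ _)))))
                                                         (∑-* m c _) ⟩
      z + c * ∑ m (λ j → F (suc j) θ)               ≡⟨ cong (λ u → z + c * u) (trans shifted τ≡1) ⟩
      z + c * 1#                                    ≡⟨ cong (z +_) (*-identityʳ c) ⟩
      z + c                                         ∎)
      where
      open ≡-Reasoning
      S : ℕ → Carrier
      S j = ∑ j (λ i → F i c)
      z τ : Carrier
      z = ∑ m (λ j → S j * F j θ)
      τ = ∑ m (λ j → F j θ)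
      S² : ∀ j → S j * S j ≡ S (suc j) + c
      S² j = begin
        S j * S j                       ≡⟨ ∑-square j _ ⟩
        ∑ j (λ i → F i c * F i c)       ≡⟨ ∑-cong j (λ i → F-suc i c) ⟨
        ∑ j (λ i → F (suc i) c)         ≡⟨ solve 2 (λ a c → a := c :+ a :+ c) refl _ c ⟩
        c + ∑ j (λ i → F (suc i) c) + c ≡⟨ cong (λ u → u + ∑ j (λ i → F (suc i) c) + c) (F-id c) ⟨
        F 0 c + ∑ j (λ i → F (suc i) c) + c ≡⟨ cong (_+ c) (∑-shift j (λ i → F i c)) ⟩
        S (suc j) + c                   ∎
      term : ∀ j → (S j * F j θ) * (S j * F j θ) ≡ S (suc j) * F (suc j) θ + c * F (suc j) θ
      term j = begin
        (S j * F j θ) * (S j * F j θ)   ≡⟨ solve 2 (λ a b → (a :* b) :* (a :* b) := (a :* a) :* (b :* b)) refl (S j) (F j θ) ⟩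
        (S j * S j) * (F j θ * F j θ)   ≡⟨ cong₂ _*_ (S² j) (sym (F-suc j θ)) ⟩
        (S (suc j) + c) * F (suc j) θ   ≡⟨ distribʳ _ _ _ ⟩
        S (suc j) * F (suc j) θ + c * F (suc j) θ ∎
      shifted : ∑ m (λ j → F (suc j) θ) ≡ τ
      shifted = ∑-cycle m (λ j → F j θ) (trans (F-m θ) (sym (F-id θ)))
      τ≢0 : τ ≢ 0#
      τ≢0 = tr≢0 ∘ trans (∑-cong m λ i → trans (*-identityˡ _) (cong (λ e → F e θ) (ℕ.*-identityʳ i)))
      -- Squaring permutes the summands of the trace cyclically, so the trace equals its own square.
      τ≡1 : τ ≡ 1#
      τ≡1 = cancel τ≢0 (begin
        τ * τ                           ≡⟨ ∑-square m _ ⟩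
        ∑ m (λ j → F j θ * F j θ)       ≡⟨ ∑-cong m (λ j → F-suc j θ) ⟨
        ∑ m (λ j → F (suc j) θ)         ≡⟨ shifted ⟩
        τ                               ≡⟨ *-identityʳ τ ⟨
        τ * 1#                          ∎)

    -- For t = 0 the root is the square root c^(2^(m-1)). Otherwise x = t z reduces the equation to
    -- z² = z + c/t². Since c/t² lies in the subfield of index 2, the two halves of its trace cancel
    -- and `artin-schreier` applies.
    quadratic-root : ∀ {a} → a ℕ.+ a ≡ m → ∀ {t c} → F a t ≡ t → F a c ≡ c → ∃[ x ] x * x ≡ t * x + c
    quadratic-root {a} a+a≡m {t} {c} Ft Fc with t ≟ 0#
    ... | yes refl = F (ℕ.pred m) c , (begin
      F (ℕ.pred m) c * F (ℕ.pred m) c  ≡⟨ F-suc (ℕ.pred m) c ⟨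
      F (suc (ℕ.pred m)) c             ≡⟨ cong (λ k → F k c) (ℕ.suc-pred m) ⟩
      F m c                            ≡⟨ F-m c ⟩
      c                                ≡⟨ solve 2 (λ c u → c := con false :* u :+ c) refl c _ ⟩
      0# * F (ℕ.pred m) c + c          ∎)
      where open ≡-Reasoning
    ... | no t≢0 = t * z , (begin
      t * z * (t * z)                  ≡⟨ solve 2 (λ t z → t :* z :* (t :* z) := t :* t :* (z :* z)) refl t z ⟩
      t * t * (z * z)                  ≡⟨ cong (t * t *_) (proj₂ solution) ⟩
      t * t * (z + c′)                 ≡⟨ solve 4 (λ t z c u → t :* t :* (z :+ c :* (u :* u))
                                            := t :* (t :* z) :+ (t :* u) :* ((t :* u) :* c)) refl t z c (t ⁻¹) ⟩
      t * (t * z) + t * t ⁻¹ * (t * t ⁻¹ * c)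
                                       ≡⟨ cong (λ u → t * (t * z) + u * (u * c)) (⁻¹-inverseʳ t≢0) ⟩
      t * (t * z) + 1# * (1# * c)      ≡⟨ cong (t * (t * z) +_) (trans (*-identityˡ _) (*-identityˡ c)) ⟩
      t * (t * z) + c                  ∎)
      where
      open ≡-Reasoning
      c′ = c * (t ⁻¹ * t ⁻¹)
      Ft⁻¹ : F a (t ⁻¹) ≡ t ⁻¹
      Ft⁻¹ = trans (F-⁻¹ a t≢0) (cong _⁻¹ Ft)
      Fc′ : F a c′ ≡ c′
      Fc′ = trans (F-* a c _) (cong₂ _*_ Fc (trans (F-* a _ _) (cong₂ _*_ Ft⁻¹ Ft⁻¹)))
      solution = artin-schreier c′ (begin
        ∑ m (λ i → F i c′)                                    ≡⟨ cong (λ k → ∑ k (λ i → F i c′)) a+a≡m ⟨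
        ∑ (a ℕ.+ a) (λ i → F i c′)                            ≡⟨ ∑-split a a _ ⟩
        ∑ a (λ i → F i c′) + ∑ a (λ i → F (i ℕ.+ a) c′)       ≡⟨ cong (∑ a (λ i → F i c′) +_) (∑-cong a λ i → trans (F-∘ i a c′) (cong (F i) Fc′)) ⟩
        ∑ a (λ i → F i c′) + ∑ a (λ i → F i c′)               ≡⟨ x+x≡0 _ ⟩
        0#                                                    ∎)
      z = proj₁ solution

    -- Norms

    norm : ℕ → ℕ → Carrier → Carrier
    norm k zero    μ = 1#
    norm k (suc j) μ = μ * F k (norm k j μ)

    norm-nonZero : ∀ k j {μ} → μ ≢ 0# → norm k j μ ≢ 0#
    norm-nonZero k zero    _   = 1≢0
    norm-nonZero k (suc j) μ≢0 = *-nonZero μ≢0 (F-nonZero k (norm-nonZero k j μ≢0))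

    -- The geometric sum 1 + q + ... + q^(j-1) with q = 2^k; the norm is the power map with this
    -- exponent.
    norm-exponent : ℕ → ℕ → ℕ
    norm-exponent k zero    = 0
    norm-exponent k (suc j) = suc (norm-exponent k j ℕ.* 2 ℕ.^ k)

    norm≡^ : ∀ k j μ → norm k j μ ≡ μ ^ norm-exponent k j
    norm≡^ k zero    μ = refl
    norm≡^ k (suc j) μ = cong (μ *_) (trans (cong (F k) (norm≡^ k j μ)) (^-assocʳ μ (norm-exponent k j) (2 ℕ.^ k)))

    norm-exponent-* : ∀ k j w → 2 ℕ.^ k ≡ suc w → suc (norm-exponent k j ℕ.* w) ≡ 2 ℕ.^ (j ℕ.* k)
    norm-exponent-* k zero    w _  = refl
    norm-exponent-* k (suc j) w eq = begin
      suc (w ℕ.+ e ℕ.* 2 ℕ.^ k ℕ.* w)     ≡⟨ cong (λ q → suc (w ℕ.+ e ℕ.* q ℕ.* w)) eq ⟩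
      suc (w ℕ.+ e ℕ.* suc w ℕ.* w)       ≡⟨ identity e w ⟩
      suc w ℕ.* suc (e ℕ.* w)             ≡⟨ cong₂ ℕ._*_ (sym eq) (norm-exponent-* k j w eq) ⟩
      2 ℕ.^ k ℕ.* 2 ℕ.^ (j ℕ.* k)         ≡⟨ ℕ.^-distribˡ-+-* 2 k (j ℕ.* k) ⟨
      2 ℕ.^ (k ℕ.+ j ℕ.* k)               ∎
      where
      open ≡-Reasoning
      e = norm-exponent k j
      identity : ∀ e w → suc (w ℕ.+ e ℕ.* suc w ℕ.* w) ≡ suc w ℕ.* suc (e ℕ.* w)
      identity = ℕSolver.solve-∀

    -- Write l = g^j with g primitive, and n = e w with w = 2^k - 1. Since l is fixed, l^w = 1, so e
    -- w divides j w and e divides j. Then g^(j/e) has norm l.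
    norm-surjective : ∀ r {k l} → r ℕ.* k ≡ m → l ≢ 0# → F k l ≡ l → ∃[ μ ] μ ≢ 0# × norm k r μ ≡ l
    norm-surjective r {k} {l} rk≡m l≢0 Fl with primitive-element n>0
    ... | g , ord@(g^n≡1 , n∣_) with discrete-log n>0 ord l≢0
    ...   | j , refl = μ , μ≢0 , (begin
        norm k r μ                 ≡⟨ norm≡^ k r μ ⟩
        (g ^ quotient e∣j) ^ e     ≡⟨ ^-assocʳ g (quotient e∣j) e ⟩
        g ^ (quotient e∣j ℕ.* e)   ≡⟨ cong (g ^_) (m∣n⇒n≡quotient*m e∣j) ⟨
        g ^ j                      ∎)
      where
      open ≡-Reasoning
      e = norm-exponent k r
      w = 2 ℕ.^ k ℕ.∸ 1
      2^k≡1+w : 2 ℕ.^ k ≡ suc w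
      2^k≡1+w = sym (ℕ.m+[n∸m]≡n (ℕ.m^n>0 2 k))
      e*w≡n : e ℕ.* w ≡ n
      e*w≡n = ℕ.suc-injective (trans (norm-exponent-* k r w 2^k≡1+w) (trans (cong (2 ℕ.^_) rk≡m) 2^m≡1+n))
      g^jw≡1 : g ^ (j ℕ.* w) ≡ 1#
      g^jw≡1 = trans (sym (^-assocʳ g j w)) (cancel l≢0 (begin
        g ^ j * (g ^ j) ^ w     ≡⟨ cong ((g ^ j) ^_) 2^k≡1+w ⟨
        F k (g ^ j)             ≡⟨ Fl ⟩
        g ^ j                   ≡⟨ *-identityʳ _ ⟨
        g ^ j * 1#              ∎))
      instance
        w≢0 : NonZero w
        w≢0 = ℕ.m*n≢0⇒n≢0 e {{subst NonZero (sym e*w≡n) (ℕ.>-nonZero n>0)}}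
      e∣j : e ∣ j
      e∣j = *-cancelʳ-∣ w (subst (_∣ j ℕ.* w) (sym e*w≡n) (n∣_ (j ℕ.* w) g^jw≡1))
      g≢0 : g ≢ 0#
      g≢0 refl = 1≢0 (trans (sym g^n≡1) (0^n≡0 n {{ℕ.>-nonZero n>0}}))
      μ = g ^ quotient e∣j
      μ≢0 = ^-nonZero (quotient e∣j) g≢0

  -- Semilinear maps of L²

  F-i*s : ∀ {s} (ev : EvenIndex m s) → let open EvenIndex ev in ∀ c → F (i ℕ.* s) c ≡ F d c
  F-i*s ev c = trans (cong (λ j → F j c) i*s≡d+y*m) (trans (F-∘ d (y ℕ.* m) c) (cong (F d) (F-*m y c)))
    where open EvenIndex ev

  V : Set
  V = Carrier × Carrier

  infixl 6 _⊞_
  infixr 7 _·_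
  infix  6 _∧_

  0ᵥ : V
  0ᵥ = 0# , 0#

  _⊞_ : V → V → V
  (a , b) ⊞ (c , d) = a + c , b + d

  _·_ : Carrier → V → V
  k · (a , b) = k * a , k * b

  -- The determinant of two vectors, without sign in characteristic 2. It tests collinearity and
  -- extracts coordinates.
  _∧_ : V → V → Carrier
  (a , b) ∧ (c , d) = a * d + b * c

  ·-assoc : ∀ j k v → (j * k) · v ≡ j · (k · v)
  ·-assoc j k (a , b) = cong₂ _,_ (*-assoc j k a) (*-assoc j k b)

  1· : ∀ v → 1# · v ≡ v
  1· (a , b) = cong₂ _,_ (*-identityˡ a) (*-identityˡ b)

  0· : ∀ v → 0# · v ≡ 0ᵥ
  0· (a , b) = cong₂ _,_ (zeroˡ a) (zeroˡ b)

  ·-comm : ∀ j k v → j · (k · v) ≡ k · (j · v)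
  ·-comm j k v = trans (sym (·-assoc j k v)) (trans (cong (_· v) (*-comm j k)) (·-assoc k j v))

  ·-⊞ : ∀ k u v → k · (u ⊞ v) ≡ k · u ⊞ k · v
  ·-⊞ k (a , b) (c , d) = cong₂ _,_ (distribˡ k a c) (distribˡ k b d)

  ∧-·ʳ : ∀ v k w → v ∧ k · w ≡ k * (v ∧ w)
  ∧-·ʳ (a , b) k (c , d) = solve 5 (λ a b c d k → a :* (k :* d) :+ b :* (k :* c)
    := k :* (a :* d :+ b :* c)) refl a b c d k

  ∧-self : ∀ v → v ∧ v ≡ 0#
  ∧-self (a , b) = solve 2 (λ a b → a :* b :+ b :* a := con false) refl a b

  ∧-zeroʳ : ∀ v → v ∧ 0ᵥ ≡ 0#
  ∧-zeroʳ (a , b) = solve 2 (λ a b → a :* con false :+ b :* con false := con false) refl a b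

  ∧-combination : ∀ a v b w → v ∧ (a · v ⊞ b · w) ≡ b * (v ∧ w)
  ∧-combination a (v₁ , v₂) b (w₁ , w₂) = solve 6 (λ a v₁ v₂ b w₁ w₂ →
    v₁ :* (a :* v₂ :+ b :* w₂) :+ v₂ :* (a :* v₁ :+ b :* w₁) := b :* (v₁ :* w₂ :+ v₂ :* w₁))
    refl a v₁ v₂ b w₁ w₂

  combination-∧ : ∀ a v b w → w ∧ (a · v ⊞ b · w) ≡ a * (v ∧ w)
  combination-∧ a (v₁ , v₂) b (w₁ , w₂) = solve 6 (λ a v₁ v₂ b w₁ w₂ →
    w₁ :* (a :* v₂ :+ b :* w₂) :+ w₂ :* (a :* v₁ :+ b :* w₁) := a :* (v₁ :* w₂ :+ v₂ :* w₁))
    refl a v₁ v₂ b w₁ w₂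

  collinear : ∀ {v w} → v ≢ 0ᵥ → v ∧ w ≡ 0# → ∃[ k ] w ≡ k · v
  collinear {a , b} {c , d} v≢0 eq with a ≟ 0# | b ≟ 0#
  ... | no a≢0   | _ =
    let k , c≡ , d≡ = FamilyB.proportional {m} L 0 a≢0 (x+y≡0⇒x≡y eq) in k , cong₂ _,_ c≡ d≡
  ... | yes _    | no b≢0 =
    let k , d≡ , c≡ = FamilyB.proportional {m} L 0 b≢0 (sym (x+y≡0⇒x≡y eq)) in k , cong₂ _,_ c≡ d≡
  ... | yes refl | yes refl = contradiction refl v≢0

  independent : ∀ {v w a b} → v ∧ w ≢ 0# → a · v ⊞ b · w ≡ 0ᵥ → a ≡ 0# × b ≡ 0#
  independent {v} {w} {a} {b} vw≢0 eq =
      coefficient (trans (sym (combination-∧ a v b w)) (trans (cong (w ∧_) eq) (∧-zeroʳ w)))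
    , coefficient (trans (sym (∧-combination a v b w)) (trans (cong (v ∧_) eq) (∧-zeroʳ v)))
    where
    coefficient : ∀ {k} → k * (v ∧ w) ≡ 0# → k ≡ 0#
    coefficient {k} eq = cancel vw≢0 (trans (*-comm _ k) (trans eq (sym (zeroʳ _))))

  -- Cramer's rule.
  spanning : ∀ {v w} → v ∧ w ≢ 0# → ∀ u → ∃₂ λ a b → u ≡ a · v ⊞ b · w
  spanning {v₁ , v₂} {w₁ , w₂} vw≢0 (u₁ , u₂) = e * (u₁ * w₂ + u₂ * w₁) , e * (v₁ * u₂ + v₂ * u₁) , cong₂ _,_
    (trans (normalise u₁) (solve 7 (λ e u₁ u₂ v₁ v₂ w₁ w₂ → e :* (v₁ :* w₂ :+ v₂ :* w₁) :* u₁
      := e :* (u₁ :* w₂ :+ u₂ :* w₁) :* v₁ :+ e :* (v₁ :* u₂ :+ v₂ :* u₁) :* w₁) refl e u₁ u₂ v₁ v₂ w₁ w₂))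
    (trans (normalise u₂) (solve 7 (λ e u₁ u₂ v₁ v₂ w₁ w₂ → e :* (v₁ :* w₂ :+ v₂ :* w₁) :* u₂
      := e :* (u₁ :* w₂ :+ u₂ :* w₁) :* v₂ :+ e :* (v₁ :* u₂ :+ v₂ :* u₁) :* w₂) refl e u₁ u₂ v₁ v₂ w₁ w₂))
    where
    e = (v₁ * w₂ + v₂ * w₁) ⁻¹
    normalise : ∀ x → x ≡ e * (v₁ * w₂ + v₂ * w₁) * x
    normalise x = sym (trans (cong (_* x) (⁻¹-inverseˡ vw≢0)) (*-identityˡ x))

  iterate : (V → V) → ℕ → V → V
  iterate T j v = fold v T j

  iterate-* : ∀ T j k v → iterate (iterate T k) j v ≡ iterate T (j ℕ.* k) v
  iterate-* T zero    k v = refl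
  iterate-* T (suc j) k v = trans (cong (iterate T k) (iterate-* T j k v)) (sym (fold-+ v T k))

  iterate-comm : ∀ T j v → iterate T j (T v) ≡ T (iterate T j v)
  iterate-comm T zero    v = refl
  iterate-comm T (suc j) v = cong T (iterate-comm T j v)

  record Semilinear (k : ℕ) (T : V → V) : Set where
    field
      ⊞-homo : ∀ u v → T (u ⊞ v) ≡ T u ⊞ T v
      ·-homo : ∀ c v → T (c · v) ≡ F k c · T v

    0-homo : T 0ᵥ ≡ 0ᵥ
    0-homo = trans (cong T (sym (0· 0ᵥ))) (trans (·-homo 0# 0ᵥ) (trans (cong (_· T 0ᵥ) (F-0 k)) (0· (T 0ᵥ))))

  iterate-semilinear : ∀ {k T} → Semilinear k T → ∀ j → Semilinear (j ℕ.* k) (iterate T j)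
  iterate-semilinear semi zero    = record
    { ⊞-homo = λ _ _ → refl ; ·-homo = λ c v → cong (_· v) (sym (F-id c)) }
  iterate-semilinear {k} {T} semi (suc j) = record
    { ⊞-homo = λ u v → trans (cong T (J.⊞-homo u v)) (⊞-homo _ _)
    ; ·-homo = λ c v → trans (cong T (J.·-homo c v))
        (trans (·-homo (F (j ℕ.* k) c) _) (cong (_· _) (sym (F-∘ k (j ℕ.* k) c))))
    }
    where
    open Semilinear semi
    module J = Semilinear (iterate-semilinear semi j)

  semilinear-cong : ∀ {j k T} → (∀ c → F j c ≡ F k c) → Semilinear j T → Semilinear k T
  semilinear-cong eq semi = record
    { ⊞-homo = ⊞-homo ; ·-homo = λ c v → trans (·-homo c v) (cong (_· _) (eq c)) }
    where open Semilinear semi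

  iterate-eigenvector : ∀ {k T} → Semilinear k T → ∀ {v a} → T v ≡ a · v → ∀ j → ∃[ b ] iterate T j v ≡ b · v
  iterate-eigenvector semi {v} eq zero = 1# , sym (1· v)
  iterate-eigenvector {k} {T} semi {v} {a} eq (suc j) with iterate-eigenvector semi eq j
  ... | b , eq′ = F k b * a , trans (cong T eq′) (trans (·-homo b v)
                    (trans (cong (F k b ·_) eq) (sym (·-assoc (F k b) a v))))
    where open Semilinear semi

  iterate-scalar : ∀ {T : V → V} {l} → (∀ v → T v ≡ l · v) → ∀ j v → iterate T j v ≡ l ^ j · v
  iterate-scalar eq zero    v = sym (1· v)
  iterate-scalar {l = l} eq (suc j) v = trans (eq _)
    (trans (cong (l ·_) (iterate-scalar eq j v)) (sym (·-assoc l (l ^ j) v)))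

  ∑ᵥ : ℕ → (ℕ → V) → V
  ∑ᵥ k f = ∑ k (proj₁ ∘ f) , ∑ k (proj₂ ∘ f)

  ∑ᵥ-homo : ∀ {j U} → Semilinear j U → ∀ k f → U (∑ᵥ k f) ≡ ∑ᵥ k (U ∘ f)
  ∑ᵥ-homo semi zero    f = Semilinear.0-homo semi
  ∑ᵥ-homo {U = U} semi (suc k) f = trans (Semilinear.⊞-homo semi (∑ᵥ k f) (f k))
                                   (cong (_⊞ U (f k)) (∑ᵥ-homo semi k f))

  module _ .{{_ : NonZero m}} where

    -- Hilbert 90: once U^r is the scalar norm(μ), the sum ∑ⱼ norm_j(μ)⁻¹ F^j(c) U^j e is mapped
    -- by U to μ times itself.
    scalar-power⇒eigenvector : ∀ r {k U l} → Semilinear k U → r ℕ.* k ≡ m → l ≢ 0# → F k l ≡ l →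
      (∀ v → iterate U r v ≡ l · v) → ∃₂ λ u μ → u ≢ 0ᵥ × U u ≡ μ · u
    scalar-power⇒eigenvector r {k} {U} {l} semi rk≡m l≢0 Fl U^r with norm-surjective r rk≡m l≢0 Fl
    ... | μ , μ≢0 , norm≡l = u , μ , u≢0 , (begin
      U u                            ≡⟨ ∑ᵥ-homo semi r term ⟩
      ∑ᵥ r (U ∘ term)                ≡⟨ cong₂ _,_ (∑-cong r (cong proj₁ ∘ U-term)) (∑-cong r (cong proj₂ ∘ U-term)) ⟩
      ∑ᵥ r (λ j → μ · term (suc j))  ≡⟨ cong₂ _,_ (∑-* r μ _) (∑-* r μ _) ⟩
      μ · ∑ᵥ r (term ∘ suc)          ≡⟨ cong (μ ·_) (cong₂ _,_ (∑-cycle r _ (cong proj₁ wrap)) (∑-cycle r _ (cong proj₂ wrap))) ⟩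
      μ · u                          ∎)
      where
      open ≡-Reasoning
      open Semilinear semi
      w : ℕ → Carrier
      w j = norm k j μ ⁻¹
      e : V
      e = 1# , 0#
      w₀≢0 : w 0 * proj₁ e ≢ 0#
      w₀≢0 = *-nonZero (⁻¹-nonZero 1≢0) 1≢0
      -- The first coordinate of `u` is this combination of conjugates of `c`, so `c` can be chosen
      -- to make it non-zero.
      choice = ∑F-nonZero r rk≡m (λ j → w j * proj₁ (iterate U j e)) w₀≢0
      c = proj₁ choice
      term : ℕ → V
      term j = (w j * F (j ℕ.* k) c) · iterate U j e
      u = ∑ᵥ r term
      u≢0 : u ≢ 0ᵥ
      u≢0 eq = proj₂ choice (trans (∑-cong r λ j →
        solve 3 (λ w x f → w :* x :* f := w :* f :* x) refl (w j) (proj₁ (iterate U j e)) (F (j ℕ.* k) c))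
        (cong proj₁ eq))
      F-w : ∀ j → F k (w j) ≡ μ * w (suc j)
      F-w j = cancel Fnorm≢0 (begin
        F k (norm k j μ) * F k (w j)                ≡⟨ cong (F k (norm k j μ) *_) (F-⁻¹ k norm≢0) ⟩
        F k (norm k j μ) * F k (norm k j μ) ⁻¹      ≡⟨ ⁻¹-inverseʳ Fnorm≢0 ⟩
        1#                                          ≡⟨ ⁻¹-inverseʳ (*-nonZero μ≢0 Fnorm≢0) ⟨
        μ * F k (norm k j μ) * w (suc j)            ≡⟨ cong (_* w (suc j)) (*-comm μ _) ⟩
        F k (norm k j μ) * μ * w (suc j)            ≡⟨ *-assoc _ μ _ ⟩
        F k (norm k j μ) * (μ * w (suc j))          ∎)
        where
        norm≢0 = norm-nonZero k j μ≢0
        Fnorm≢0 = F-nonZero k norm≢0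
      U-term : ∀ j → U (term j) ≡ μ · term (suc j)
      U-term j = begin
        U (term j)                                      ≡⟨ ·-homo _ _ ⟩
        F k (w j * F (j ℕ.* k) c) · iterate U (suc j) e ≡⟨ cong (_· iterate U (suc j) e) (begin
          F k (w j * F (j ℕ.* k) c)                     ≡⟨ F-* k _ _ ⟩
          F k (w j) * F k (F (j ℕ.* k) c)               ≡⟨ cong₂ _*_ (F-w j) (sym (F-∘ k (j ℕ.* k) c)) ⟩
          μ * w (suc j) * F (suc j ℕ.* k) c             ≡⟨ *-assoc μ _ _ ⟩
          μ * (w (suc j) * F (suc j ℕ.* k) c)           ∎) ⟩
        (μ * (w (suc j) * F (suc j ℕ.* k) c)) · iterate U (suc j) e
                                                        ≡⟨ ·-assoc μ _ _ ⟩
        μ · term (suc j)                                ∎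
      -- The sum closes up cyclically: `c` returns to itself after `r` steps, and the scalar `l` of
      -- `U^r` cancels the norm `l` in the denominator.
      wrap : term r ≡ term 0
      wrap = begin
        (w r * F (r ℕ.* k) c) · iterate U r e   ≡⟨ cong₂ _·_ (cong (w r *_) (trans (cong (λ j → F j c) rk≡m) (F-m c))) (U^r e) ⟩
        (w r * c) · (l · e)                     ≡⟨ ·-assoc _ _ _ ⟨
        (w r * c * l) · e                       ≡⟨ cong (_· e) (begin
          w r * c * l                           ≡⟨ solve 3 (λ w c l → w :* c :* l := (w :* l) :* c) refl (w r) c l ⟩
          w r * l * c                           ≡⟨ cong (λ x → w r * x * c) norm≡l ⟨
          w r * norm k r μ * c                  ≡⟨ cong (_* c) (⁻¹-inverseˡ (norm-nonZero k r μ≢0)) ⟩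
          1# * c                                ≡⟨ cong (_* c) (trans (sym (⁻¹-inverseˡ 1≢0)) (*-identityʳ _)) ⟩
          w 0 * c                               ≡⟨ cong (w 0 *_) (F-id c) ⟨
          w 0 * F 0 c                           ∎) ⟩
        term 0                                  ∎

    -- A line fixed by the square of a semilinear map

    module _ {s : ℕ} (ev : EvenIndex m s) {T : V → V} (semi : Semilinear s T)
             (T-moves : ∀ {v} → v ≢ 0ᵥ → v ∧ T v ≢ 0#) where
      open EvenIndex ev
      open Semilinear semi

      private
        N : V → V
        N = iterate T r

        -- `r * s` is a multiple of m, so the field automorphism attached to `N` is trivial.
        N-linear : Semilinear 0 N
        N-linear = semilinear-cong
          (λ c → trans (cong (λ j → F j c) r*s≡s′*m) (trans (F-*m s′ c) (sym (F-id c))))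
          (iterate-semilinear semi r)

        module N = Semilinear N-linear

        N-· : ∀ c v → N (c · v) ≡ c · N v
        N-· c v = trans (N.·-homo c v) (cong (_· N v) (F-id c))

        N-T : ∀ v → N (T v) ≡ T (N v)
        N-T = iterate-comm T r

        T-nonZero : ∀ {v} → v ≢ 0ᵥ → T v ≢ 0ᵥ
        T-nonZero {v} v≢0 Tv≡0 = T-moves v≢0 (trans (cong (v ∧_) Tv≡0) (∧-zeroʳ v))

        iterate-nonZero : ∀ j {v} → v ≢ 0ᵥ → iterate T j v ≢ 0ᵥ
        iterate-nonZero zero    v≢0 = v≢0
        iterate-nonZero (suc j) v≢0 = T-nonZero (iterate-nonZero j v≢0)

        F-fixed-d : ∀ {x} → F s x ≡ x → F d x ≡ x
        F-fixed-d {x} = F-fixed-gcd m s (F-m x)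

        -- `U = T^i` is semilinear for x ↦ x^(2^d), and `U^r = N^i` is the scalar `l ^ i`, so
        -- Hilbert 90 gives a line ⟨u⟩ fixed by `U`. As s′ i = 1 + y r, on u the power `U^s′` is T
        -- applied to `l ^ y · u`. Hence T also fixes ⟨u⟩, which `T-moves` excludes.
        not-scalar : ∀ {l} → l ≢ 0# → F s l ≡ l → ¬ (∀ v → N v ≡ l · v)
        not-scalar {l} l≢0 Fl N≡l = *-nonZero (F-nonZero s (^-nonZero y l≢0)) (T-moves u≢0) (begin
          F s (l ^ y) * (u ∧ T u)          ≡⟨ ∧-·ʳ u _ (T u) ⟨
          u ∧ F s (l ^ y) · T u            ≡⟨ cong (u ∧_) (·-homo (l ^ y) u) ⟨
          u ∧ T (l ^ y · u)                ≡⟨ cong (λ w → u ∧ T w) (iterate-scalar N≡l y u) ⟨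
          u ∧ T (iterate N y u)            ≡⟨ cong (λ w → u ∧ T w) (iterate-* T y r u) ⟩
          u ∧ iterate T (1 ℕ.+ y ℕ.* r) u  ≡⟨ cong (λ j → u ∧ iterate T j u) (trans (cong suc (ℕ.*-comm y r)) (sym inverse)) ⟩
          u ∧ iterate T (s′ ℕ.* i) u       ≡⟨ cong (u ∧_) (iterate-* T s′ i u) ⟨
          u ∧ iterate U s′ u               ≡⟨ cong (u ∧_) (proj₂ U^s′) ⟩
          u ∧ proj₁ U^s′ · u               ≡⟨ ∧-·ʳ u _ u ⟩
          proj₁ U^s′ * (u ∧ u)             ≡⟨ cong (proj₁ U^s′ *_) (∧-self u) ⟩
          proj₁ U^s′ * 0#                  ≡⟨ zeroʳ _ ⟩
          0#                               ∎)
          where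
          open ≡-Reasoning
          U = iterate T i
          U-semilinear : Semilinear d U
          U-semilinear = semilinear-cong (F-i*s ev) (iterate-semilinear semi i)
          U^r : ∀ v → iterate U r v ≡ l ^ i · v
          U^r v = begin
            iterate U r v           ≡⟨ iterate-* T r i v ⟩
            iterate T (r ℕ.* i) v   ≡⟨ cong (λ j → iterate T j v) (ℕ.*-comm r i) ⟩
            iterate T (i ℕ.* r) v   ≡⟨ iterate-* T i r v ⟨
            iterate N i v           ≡⟨ iterate-scalar N≡l i v ⟩
            l ^ i · v               ∎
          F-l^i : F d (l ^ i) ≡ l ^ i
          F-l^i = trans (F-^ d l i) (cong (_^ i) (F-fixed-d Fl))
          eigen = scalar-power⇒eigenvector r U-semilinear m≡ (^-nonZero i l≢0) F-l^i U^r
          u = proj₁ eigen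
          u≢0 = proj₁ (proj₂ (proj₂ eigen))
          U^s′ = iterate-eigenvector U-semilinear (proj₂ (proj₂ (proj₂ eigen))) s′

        N-eigen : ∀ {v l} → N v ≡ l · v → N (T v) ≡ F s l · T v
        N-eigen {v} {l} eq = trans (N-T v) (trans (cong T eq) (·-homo l v))

        N-combination : ∀ a u b v → N (a · u ⊞ b · v) ≡ a · N u ⊞ b · N v
        N-combination a u b v = trans (N.⊞-homo _ _) (cong₂ _⊞_ (N-· a u) (N-· b v))

        -- Otherwise v and T v would both be eigenvectors for l, and since they span L², `N` would
        -- be a scalar.
        fixed-eigenvalue : ∀ {v l} → v ≢ 0ᵥ → N v ≡ l · v → F s l ≢ l
        fixed-eigenvalue {v} {l} v≢0 Nv Fl≡l = not-scalar l≢0 Fl≡l N-scalar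
          where
          open ≡-Reasoning
          l≢0 : l ≢ 0#
          l≢0 refl = iterate-nonZero r v≢0 (trans Nv (0· v))
          on-combination : ∀ a b → N (a · v ⊞ b · T v) ≡ l · (a · v ⊞ b · T v)
          on-combination a b = begin
            N (a · v ⊞ b · T v)            ≡⟨ N-combination a v b (T v) ⟩
            a · N v ⊞ b · N (T v)          ≡⟨ cong₂ (λ p q → a · p ⊞ b · q) Nv
                                               (trans (N-eigen Nv) (cong (_· T v) Fl≡l)) ⟩
            a · (l · v) ⊞ b · (l · T v)    ≡⟨ cong₂ _⊞_ (·-comm a l v) (·-comm b l (T v)) ⟩
            l · (a · v) ⊞ l · (b · T v)    ≡⟨ ·-⊞ l (a · v) (b · T v) ⟨
            l · (a · v ⊞ b · T v)          ∎
          N-scalar : ∀ u → N u ≡ l · u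
          N-scalar u = let a , b , u≡ = spanning (T-moves v≢0) u in
            trans (cong N u≡) (trans (on-combination a b) (cong (l ·_) (sym u≡)))

        -- Apply `N` to T² v = a v + b T v and take the determinant with v. The left side is
        -- multiplied by `l₂`, the right side by `l₁`. If v ∧ T² v were non-zero, these eigenvalues
        -- would agree, and injectivity of σ would make l fixed.
        from-eigenvector : ∀ {v l} a b → v ≢ 0ᵥ → N v ≡ l · v → T (T v) ≡ a · v ⊞ b · T v → v ∧ T (T v) ≡ 0#
        from-eigenvector {v} {l} a b v≢0 Nv TTv≡ = decidable-stable (_ ≟ 0#) λ vTTv≢0 →
          fixed-eigenvalue v≢0 Nv (F-injective s (cancel vTTv≢0 (begin
            (v ∧ T (T v)) * l₂                   ≡⟨ *-comm _ l₂ ⟩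
            l₂ * (v ∧ T (T v))                   ≡⟨ ∧-·ʳ v l₂ (T (T v)) ⟨
            v ∧ l₂ · T (T v)                     ≡⟨ cong (v ∧_) (N-eigen (N-eigen Nv)) ⟨
            v ∧ N (T (T v))                      ≡⟨ cong (λ w → v ∧ N w) TTv≡ ⟩
            v ∧ N (a · v ⊞ b · T v)              ≡⟨ cong (v ∧_) (N-combination a v b (T v)) ⟩
            v ∧ (a · N v ⊞ b · N (T v))          ≡⟨ cong₂ (λ p q → v ∧ (p ⊞ q))
                                                     (trans (cong (a ·_) Nv) (sym (·-assoc a l v)))
                                                     (trans (cong (b ·_) (N-eigen Nv)) (sym (·-assoc b l₁ (T v)))) ⟩
            v ∧ ((a * l) · v ⊞ (b * l₁) · T v)   ≡⟨ ∧-combination (a * l) v (b * l₁) (T v) ⟩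
            b * l₁ * (v ∧ T v)                   ≡⟨ cong (_* (v ∧ T v)) (*-comm b l₁) ⟩
            l₁ * b * (v ∧ T v)                   ≡⟨ *-assoc l₁ b (v ∧ T v) ⟩
            l₁ * (b * (v ∧ T v))                 ≡⟨ cong (l₁ *_) (∧-combination a v b (T v)) ⟨
            l₁ * (v ∧ (a · v ⊞ b · T v))         ≡⟨ cong (λ w → l₁ * (v ∧ w)) TTv≡ ⟨
            l₁ * (v ∧ T (T v))                   ≡⟨ *-comm l₁ _ ⟩
            (v ∧ T (T v)) * l₁                   ∎)))
          where
          open ≡-Reasoning
          l₁ = F s l
          l₂ = F s (F s l)

        e : V
        e = 1# , 0#

        e≢0 : e ≢ 0ᵥ
        e≢0 = 1≢0 ∘ cong proj₁

        -- For a root x, N² + t N + c factors as (N + x)(N + t + x), so (N + t + x) e is annihilated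
        -- by N + x. Its coefficient 1 at N e keeps it non-zero.
        quadratic-eigenvector : ∀ {c t x} → e ∧ N e ≢ 0# → N (N e) ≡ c · e ⊞ t · N e → x * x ≡ t * x + c →
                                ∃₂ λ v l → v ≢ 0ᵥ × N v ≡ l · v
        quadratic-eigenvector {c} {t} {x} eNe≢0 NNe root = w , x , w≢0 , Nw
          where
          open ≡-Reasoning
          w : V
          w = (t + x) · e ⊞ 1# · N e
          w≢0 : w ≢ 0ᵥ
          w≢0 = 1≢0 ∘ proj₂ ∘ independent eNe≢0
          Nw : N w ≡ x · w
          Nw = begin
            N ((t + x) · e ⊞ 1# · N e)            ≡⟨ N.⊞-homo _ _ ⟩
            N ((t + x) · e) ⊞ N (1# · N e)        ≡⟨ cong₂ _⊞_ (N-· (t + x) e) (N-· 1# (N e)) ⟩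
            (t + x) · N e ⊞ 1# · N (N e)          ≡⟨ cong (λ p → (t + x) · N e ⊞ 1# · p) NNe ⟩
            (t + x) · N e ⊞ 1# · (c · e ⊞ t · N e)
              ≡⟨ cong₂ _,_ (component (proj₁ e) (proj₁ (N e))) (component (proj₂ e) (proj₂ (N e))) ⟩
            x · ((t + x) · e ⊞ 1# · N e)          ∎
            where
            component : ∀ p q → (t + x) * q + 1# * (c * p + t * q) ≡ x * ((t + x) * p + 1# * q)
            component p q = begin
              (t + x) * q + 1# * (c * p + t * q)
                ≡⟨ solve 5 (λ t x c p q → (t :+ x) :* q :+ con true :* (c :* p :+ t :* q)
                     := x :* q :+ t :* x :* p :+ (t :* x :+ c) :* p) refl t x c p q ⟩
              x * q + t * x * p + (t * x + c) * p ≡⟨ cong (λ u → x * q + t * x * p + u * p) (root) ⟨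
              x * q + t * x * p + x * x * p
                ≡⟨ solve 4 (λ t x p q → x :* q :+ t :* x :* p :+ x :* x :* p
                     := x :* ((t :+ x) :* p :+ con true :* q)) refl t x p q ⟩
              x * ((t + x) * p + 1# * q)          ∎

        -- The relation N² = c + t N extends from e to all of L². Applying T to the relation at e
        -- gives one at T e with coefficients σ(c) and σ(t). As T e and N (T e) are independent, it
        -- agrees with the original relation there.
        coefficients-fixed : ∀ {c t} → e ∧ N e ≢ 0# → T e ∧ N (T e) ≢ 0# → N (N e) ≡ c · e ⊞ t · N e →
                             F s c ≡ c × F s t ≡ t
        coefficients-fixed {c} {t} eNe≢0 TeNTe≢0 NNe = fixed (proj₁ zeros) , fixed (proj₂ zeros)
          where
          open ≡-Reasoning
          cayley-hamilton : ∀ u → N (N u) ≡ c · u ⊞ t · N u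
          cayley-hamilton u = let a , b , u≡ = spanning eNe≢0 u in
            trans (cong (N ∘ N) u≡) (trans (on-combination a b) (cong (λ u → c · u ⊞ t · N u) (sym u≡)))
            where
            on-combination : ∀ a b → N (N (a · e ⊞ b · N e)) ≡ c · (a · e ⊞ b · N e) ⊞ t · N (a · e ⊞ b · N e)
            on-combination a b = begin
              N (N (a · e ⊞ b · N e))               ≡⟨ cong N (N-combination a e b (N e)) ⟩
              N (a · N e ⊞ b · N (N e))             ≡⟨ cong (λ p → N (a · N e ⊞ b · p)) NNe ⟩
              N (a · N e ⊞ b · (c · e ⊞ t · N e))   ≡⟨ N-combination a (N e) b _ ⟩
              a · N (N e) ⊞ b · N (c · e ⊞ t · N e) ≡⟨ cong₂ (λ p q → a · p ⊞ b · q) NNe (N-combination c e t (N e)) ⟩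
              a · (c · e ⊞ t · N e) ⊞ b · (c · N e ⊞ t · N (N e))
                                                    ≡⟨ cong (λ p → a · (c · e ⊞ t · N e) ⊞ b · (c · N e ⊞ t · p)) NNe ⟩
              a · (c · e ⊞ t · f) ⊞ b · (c · f ⊞ t · (c · e ⊞ t · f))
                ≡⟨ cong₂ _,_ (identity a b c t (proj₁ e) (proj₁ f)) (identity a b c t (proj₂ e) (proj₂ f)) ⟩
              c · (a · e ⊞ b · f) ⊞ t · (a · f ⊞ b · (c · e ⊞ t · f))
                ≡⟨ cong (λ p → c · (a · e ⊞ b · f) ⊞ t · p) (trans (N-combination a e b f) (cong (λ p → a · f ⊞ b · p) NNe)) ⟨
              c · (a · e ⊞ b · N e) ⊞ t · N (a · e ⊞ b · N e) ∎
              where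
              f = N e
              identity : ∀ a b c t x y → a * (c * x + t * y) + b * (c * y + t * (c * x + t * y))
                                       ≡ c * (a * x + b * y) + t * (a * y + b * (c * x + t * y))
              identity = solve 6 (λ a b c t x y →
                a :* (c :* x :+ t :* y) :+ b :* (c :* y :+ t :* (c :* x :+ t :* y))
                := c :* (a :* x :+ b :* y) :+ t :* (a :* y :+ b :* (c :* x :+ t :* y))) refl
          difference : (c + F s c) · T e ⊞ (t + F s t) · N (T e) ≡ 0ᵥ
          difference = begin
            (c + F s c) · T e ⊞ (t + F s t) · N (T e)
              ≡⟨ cong₂ _,_ (regroup c (F s c) t (F s t) (proj₁ (T e)) (proj₁ (N (T e))))
                           (regroup c (F s c) t (F s t) (proj₂ (T e)) (proj₂ (N (T e)))) ⟩
            (c · T e ⊞ t · N (T e)) ⊞ (F s c · T e ⊞ F s t · N (T e))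
              ≡⟨ cong₂ _⊞_ (sym (cayley-hamilton (T e))) (begin
                F s c · T e ⊞ F s t · N (T e)    ≡⟨ cong (λ p → F s c · T e ⊞ F s t · p) (N-T e) ⟩
                F s c · T e ⊞ F s t · T (N e)    ≡⟨ cong₂ _⊞_ (·-homo c e) (·-homo t (N e)) ⟨
                T (c · e) ⊞ T (t · N e)          ≡⟨ ⊞-homo _ _ ⟨
                T (c · e ⊞ t · N e)              ≡⟨ cong T NNe ⟨
                T (N (N e))                      ≡⟨ N-T (N e) ⟨
                N (T (N e))                      ≡⟨ cong N (N-T e) ⟨
                N (N (T e))                      ∎) ⟩
            N (N (T e)) ⊞ N (N (T e))            ≡⟨ cong₂ _,_ (x+x≡0 _) (x+x≡0 _) ⟩
            0ᵥ                                   ∎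
            where
            regroup : ∀ c c′ t t′ x y → (c + c′) * x + (t + t′) * y ≡ (c * x + t * y) + (c′ * x + t′ * y)
            regroup = solve 6 (λ c c′ t t′ x y → (c :+ c′) :* x :+ (t :+ t′) :* y
              := (c :* x :+ t :* y) :+ (c′ :* x :+ t′ :* y)) refl
          zeros = independent TeNTe≢0 difference
          fixed : ∀ {z} → z + F s z ≡ 0# → F s z ≡ z
          fixed = sym ∘ x+y≡0⇒x≡y

        -- If neither e nor T e is an eigenvector, c and t lie in GF(2^d), hence in GF(2^(h d)).
        -- That field has index 2 in L because `r` is even, so the characteristic polynomial has a
        -- root in L.
        eigenvector : ∃₂ λ v l → v ≢ 0ᵥ × N v ≡ l · v
        eigenvector = go (_ ≟ 0#) (_ ≟ 0#)
          where
          fixed : ∀ {z} → F s z ≡ z → F (h ℕ.* d) z ≡ z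
          fixed = F-fixed-* h ∘ F-fixed-d
          go : Dec (e ∧ N e ≡ 0#) → Dec (T e ∧ N (T e) ≡ 0#) → ∃₂ λ v l → v ≢ 0ᵥ × N v ≡ l · v
          go (yes eNe≡0) _ = let l , Ne = collinear e≢0 eNe≡0 in e , l , e≢0 , Ne
          go (no _) (yes TeNTe≡0) =
            let l , NTe = collinear (T-nonZero e≢0) TeNTe≡0 in T e , l , T-nonZero e≢0 , NTe
          go (no eNe≢0) (no TeNTe≢0) =
            let c , t , NNe = spanning eNe≢0 (N (N e))
                Fc , Ft = coefficients-fixed eNe≢0 TeNTe≢0 NNe
                x , root = quadratic-root {h ℕ.* d} (trans (sym (ℕ.*-distribʳ-+ d h h)) m≡) (fixed Ft) (fixed Fc)
            in quadratic-eigenvector eNe≢0 NNe root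

      square-stable-line : ∃[ v ] v ≢ 0ᵥ × v ∧ T (T v) ≡ 0#
      square-stable-line =
        let v , l , v≢0 , Nv = eigenvector
            a , b , TTv≡ = spanning (T-moves v≢0) (T (T v))
        in v , v≢0 , from-eigenvector a b v≢0 Nv TTv≡

-- Anisotropic forms and their orthogonal bases

module Forms {m : ℕ} .{{_ : NonZero m}} (L : FiniteField (2 ℕ.^ m)) (s : ℕ) where
  open Field {m} L public
  open FamilyB {m} L s public hiding (1+1≡0; 0^n≡0; x+x≡0; -x≡x; cancel; x+y≡0⇒x≡y)

  -- The map T. By `bilinear-perp`, the vectors w orthogonal to v are those with w ∧ perp t v = 0,
  -- so for legitimate `t` and non-zero v they form the line spanned by perp t v.
  perp : Quadruple → V → V
  perp [ p₁ , p₂ , p₃ , p₄ ] (x , y) = p₂ * F s x + p₄ * F s y , p₁ * F s x + p₃ * F s y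

  perp-semilinear : ∀ t → Semilinear s (perp t)
  perp-semilinear [ p₁ , p₂ , p₃ , p₄ ] = record
    { ⊞-homo = λ (x , y) (x′ , y′) → cong₂ _,_ (additive p₂ p₄ x y x′ y′) (additive p₁ p₃ x y x′ y′)
    ; ·-homo = λ c (x , y) → cong₂ _,_ (homogeneous p₂ p₄ c x y) (homogeneous p₁ p₃ c x y)
    }
    where
    additive : ∀ p q x y x′ y′ → p * F s (x + x′) + q * F s (y + y′)
                               ≡ (p * F s x + q * F s y) + (p * F s x′ + q * F s y′)
    additive p q x y x′ y′ = trans (cong₂ (λ u v → p * u + q * v) (F-+ s x x′) (F-+ s y y′))
      (solve 6 (λ p q x y x′ y′ → p :* (x :+ x′) :+ q :* (y :+ y′)
        := (p :* x :+ q :* y) :+ (p :* x′ :+ q :* y′)) refl p q (F s x) (F s y) (F s x′) (F s y′))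
    homogeneous : ∀ p q c x y → p * F s (c * x) + q * F s (c * y) ≡ F s c * (p * F s x + q * F s y)
    homogeneous p q c x y = trans (cong₂ (λ u v → p * u + q * v) (F-* s c x) (F-* s c y))
      (solve 5 (λ p q c x y → p :* (c :* x) :+ q :* (c :* y) := c :* (p :* x :+ q :* y))
        refl p q (F s c) (F s x) (F s y))

  bilinear-perp : ∀ t x y w₁ w₂ → bilinear t (F s x) (F s y) w₁ w₂ ≡ (w₁ , w₂) ∧ perp t (x , y)
  bilinear-perp [ p₁ , p₂ , p₃ , p₄ ] x y w₁ w₂ = solve 8 (λ p₁ p₂ p₃ p₄ x y w₁ w₂ →
    p₁ :* (x :* w₁) :+ p₂ :* (x :* w₂) :+ p₃ :* (y :* w₁) :+ p₄ :* (y :* w₂)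
    := w₁ :* (p₁ :* x :+ p₃ :* y) :+ w₂ :* (p₂ :* x :+ p₄ :* y))
    refl p₁ p₂ p₃ p₄ (F s x) (F s y) w₁ w₂

  -- The determinant of v and perp t v is the value of the form at v.
  perp-moves : ∀ {t} → Legitimate t → ∀ {v} → v ≢ 0ᵥ → v ∧ perp t v ≢ 0#
  perp-moves {t} leg {x , y} v≢0 eq =
    form-nonZero leg x y (v≢0 ∘ uncurry (cong₂ _,_)) (trans (bilinear-perp t x y x y) eq)

  diagonal : Carrier → Quadruple
  diagonal p = [ 1# , 0# , 0# , p ]

  -- If v spans a line fixed by perp ∘ perp, then v and perp v are orthogonal on both sides.
  orthogonal-basis : ∀ {t} → Legitimate t → ∀ v → v ≢ 0ᵥ → v ∧ perp t (perp t v) ≡ 0# →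
                     ∃₂ λ g p → act t g ≡ diagonal p
  orthogonal-basis {t} leg v@(a , c) v≢0 eq = ((mat a b c d , det≢0) , (k ⁻¹ , ⁻¹-nonZero k≢0)) , _ , (begin
    scale (k ⁻¹) (substitute t (mat a b c d))   ≡⟨ cong (scale (k ⁻¹)) (substitute-bilinear t a b c d) ⟩
    scale (k ⁻¹) [ B′ a c a c , B′ a c b d , B′ b d a c , B′ b d b d ]
                                                -- One mixed entry is w ∧ w, which always vanishes;
                                                -- the other is v ∧ perp t w, which vanishes by the
                                                -- choice of v. The first entry is `k`, whence the
                                                -- scaling.
                                                ≡⟨ cong (scale (k ⁻¹)) (quad-cong (bilinear-perp t a c a c)
                                                     (trans (bilinear-perp t a c b d) (∧-self w))
                                                     (trans (bilinear-perp t b d a c) eq)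
                                                     refl) ⟩
    scale (k ⁻¹) [ k , 0# , 0# , B′ b d b d ]   ≡⟨ quad-cong (⁻¹-inverseˡ k≢0) (zeroʳ _) (zeroʳ _) refl ⟩
    diagonal (k ⁻¹ * B′ b d b d)                ∎)
    where
    open ≡-Reasoning
    B′ : (x y z w : Carrier) → Carrier
    B′ x y = bilinear t (F s x) (F s y)
    w = perp t v
    b = proj₁ w
    d = proj₂ w
    k = v ∧ w
    k≢0 : k ≢ 0#
    k≢0 = perp-moves leg v≢0
    det≢0 : det (mat a b c d) ≢ 0#
    det≢0 = k≢0 ∘ trans (trans (cong (a * d +_) (*-comm c b)) (sym (det-+ a b c d)))

  diagonalise : EvenIndex m s → ∀ {t} → Legitimate t → ∃₂ λ g p → act t g ≡ diagonal p
  diagonalise ev {t} leg =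
    let v , v≢0 , eq = square-stable-line ev (perp-semilinear t) (perp-moves leg)
    in orthogonal-basis leg v v≢0 eq

  -- Equivalent quadruples give isotopic presemifields

  apply : Matrix → V → V
  apply (mat α β γ δ) (x , y) = α * x + β * y , γ * x + δ * y

  apply-⊞ : ∀ A u v → apply A (u ⊞ v) ≡ apply A u ⊞ apply A v
  apply-⊞ (mat α β γ δ) (x , y) (x′ , y′) = cong₂ _,_ (entry α β) (entry γ δ)
    where
    entry : ∀ a b → a * (x + x′) + b * (y + y′) ≡ (a * x + b * y) + (a * x′ + b * y′)
    entry a b = solve 6 (λ a b x y x′ y′ → a :* (x :+ x′) :+ b :* (y :+ y′)
      := (a :* x :+ b :* y) :+ (a :* x′ :+ b :* y′)) refl a b x y x′ y′

  apply-⊗ : ∀ A B v → apply (A ⊗ B) v ≡ apply A (apply B v)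
  apply-⊗ (mat α β γ δ) (mat α′ β′ γ′ δ′) (x , y) = cong₂ _,_ (entry α β) (entry γ δ)
    where
    entry : ∀ a b → (a * α′ + b * γ′) * x + (a * β′ + b * δ′) * y
                  ≡ a * (α′ * x + β′ * y) + b * (γ′ * x + δ′ * y)
    entry a b = solve 8 (λ a b α β γ δ x y → (a :* α :+ b :* γ) :* x :+ (a :* β :+ b :* δ) :* y
      := a :* (α :* x :+ β :* y) :+ b :* (γ :* x :+ δ :* y)) refl a b α′ β′ γ′ δ′ x y

  apply-I : ∀ v → apply I v ≡ v
  apply-I (x , y) = cong₂ _,_ (1x+0y≡x x y) (0x+1y≡y x y)

  apply-∧ : ∀ A u v → apply A u ∧ apply A v ≡ det A * (u ∧ v)
  apply-∧ A@(mat α β γ δ) (x , y) (x′ , y′) = trans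
    (solve 8 (λ α β γ δ x y x′ y′ →
      (α :* x :+ β :* y) :* (γ :* x′ :+ δ :* y′) :+ (γ :* x :+ δ :* y) :* (α :* x′ :+ β :* y′)
      := (α :* δ :+ β :* γ) :* (x :* y′ :+ y :* x′)) refl α β γ δ x y x′ y′)
    (cong (_* (x * y′ + y * x′)) (sym (det-+ α β γ δ)))

  -- With B(v, w) the form in which σ acts on v, the product of x and y is (B(y, x) + l B(x, y), x ∧
  -- y). Both coordinates transform simply under a change of basis.
  product-bilinear : ∀ l t a b c d →
    product l t (a , b) (c , d)
    ≡ (bilinear t (F s c) (F s d) a b + l * bilinear t (F s a) (F s b) c d , (a , b) ∧ (c , d))
  product-bilinear l [ p₁ , p₂ , p₃ , p₄ ] a b c d = cong (_, (a , b) ∧ (c , d))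
    (solve 13 (λ l p₁ p₂ p₃ p₄ a b c d â b̂ ĉ d̂ →
      p₁ :* a :* ĉ :+ l :* p₁ :* â :* c :+ p₂ :* b :* ĉ :+ l :* p₂ :* â :* d
        :+ p₃ :* a :* d̂ :+ l :* p₃ :* b̂ :* c :+ p₄ :* b :* d̂ :+ l :* p₄ :* b̂ :* d
      := (p₁ :* (ĉ :* a) :+ p₂ :* (ĉ :* b) :+ p₃ :* (d̂ :* a) :+ p₄ :* (d̂ :* b))
           :+ l :* (p₁ :* (â :* c) :+ p₂ :* (â :* d) :+ p₃ :* (b̂ :* c) :+ p₄ :* (b̂ :* d)))
      refl l p₁ p₂ p₃ p₄ a b c d (F s a) (F s b) (F s c) (F s d))

  bilinear-act : ∀ t α β γ δ k x y z w →
    bilinear (scale k (substitute t (mat α β γ δ))) (F s x) (F s y) z w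
    ≡ k * bilinear t (F s (α * x + β * y)) (F s (γ * x + δ * y)) (α * z + β * w) (γ * z + δ * w)
  bilinear-act t α β γ δ k x y z w = trans (bilinear-scale (substitute t (mat α β γ δ)) k _ _ z w)
    (cong (k *_) (trans (bilinear-substitute t α β γ δ (F s x) (F s y) z w)
      (cong₂ (λ u v → bilinear t u v (α * z + β * w) (γ * z + δ * w)) (sym (frobenius α β)) (sym (frobenius γ δ)))))
    where
    frobenius : ∀ a b → F s (a * x + b * y) ≡ F s a * F s x + F s b * F s y
    frobenius a b = trans (F-+ s (a * x) (b * y)) (cong₂ _+_ (F-* s a x) (F-* s b y))

  open GroupMorphisms (AbelianGroup.rawGroup L×L) (AbelianGroup.rawGroup L×L) using (IsGroupIsomorphism)

  additive-bijection : (f f⁻¹ : V → V) → (∀ u v → f (u ⊞ v) ≡ f u ⊞ f v) →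
                       (∀ v → f (f⁻¹ v) ≡ v) → (∀ v → f⁻¹ (f v) ≡ v) → IsGroupIsomorphism f
  additive-bijection f f⁻¹ f-⊞ right left = record
    { isGroupMonomorphism = record
      { isGroupHomomorphism = record
        { isMonoidHomomorphism = record
          { isMagmaHomomorphism = record
            { isRelHomomorphism = record { cong = λ (p , q) → split (cong f (cong₂ _,_ p q)) }
            ; homo = λ u v → split (f-⊞ u v)
            }
          ; ε-homo = split f-0
          }
        ; ⁻¹-homo = λ v → split (trans (cong f (negate v)) (sym (negate (f v))))
        }
      ; injective = λ {u} {v} (p , q) →
          split (trans (sym (left u)) (trans (cong f⁻¹ (cong₂ _,_ p q)) (left v)))
      }
    ; surjective = λ v → f⁻¹ v , λ (p , q) → split (trans (cong f (cong₂ _,_ p q)) (right v))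
    }
    where
    split : ∀ {u v : V} → u ≡ v → proj₁ u ≡ proj₁ v × proj₂ u ≡ proj₂ v
    split eq = cong proj₁ eq , cong proj₂ eq
    negate : ∀ (v : V) → (- proj₁ v , - proj₂ v) ≡ v
    negate v = cong₂ _,_ (-x≡x (proj₁ v)) (-x≡x (proj₂ v))
    f-0 : f 0ᵥ ≡ 0ᵥ
    f-0 = begin
      f 0ᵥ              ≡⟨ cong f (cong₂ _,_ (x+x≡0 0#) (x+x≡0 0#)) ⟨
      f (0ᵥ ⊞ 0ᵥ)       ≡⟨ f-⊞ 0ᵥ 0ᵥ ⟩
      f 0ᵥ ⊞ f 0ᵥ       ≡⟨ cong₂ _,_ (x+x≡0 _) (x+x≡0 _) ⟩
      0ᵥ                ∎
      where open ≡-Reasoning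

  -- The matrix acts on both factors. On the product, the first coordinate is scaled by `k`, and the
  -- second, which acquires the factor det A, is divided by it.
  act-isotopic : ∀ l adm {t t′} leg leg′ g → act t g ≡ t′ → Isotopic (B l adm (t , leg)) (B l adm (t′ , leg′))
  act-isotopic l adm {t} leg leg′ ((A@(mat α β γ δ) , D≢0) , (k , k≢0)) refl =
      apply A , apply A , rescale , apply-iso , apply-iso
    , additive-bijection rescale unscale
        (λ (x , y) (x′ , y′) → cong₂ _,_ (distribˡ _ x x′) (distribˡ _ y y′))
        (λ (x , y) → cong₂ _,_ (undo (⁻¹-inverseʳ k≢0) x) (undo (⁻¹-inverseˡ D≢0) y))
        (λ (x , y) → cong₂ _,_ (undo (⁻¹-inverseˡ k≢0) x) (undo (⁻¹-inverseʳ D≢0) y))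
    , λ x y → cong proj₁ (isotopy x y) , cong proj₂ (isotopy x y)
    where
    open ≡-Reasoning
    D = det A
    t′ = scale k (substitute t A)
    rescale unscale : V → V
    rescale (x , y) = k * x , D ⁻¹ * y
    unscale (x , y) = k ⁻¹ * x , D * y
    undo : ∀ {u v} → u * v ≡ 1# → ∀ y → u * (v * y) ≡ y
    undo uv≡1 y = trans (sym (*-assoc _ _ y)) (trans (cong (_* y) uv≡1) (*-identityˡ y))
    apply-iso : IsGroupIsomorphism (apply A)
    apply-iso = additive-bijection (apply A) (apply (inv A)) (apply-⊞ A)
      (λ v → trans (sym (apply-⊗ A (inv A) v)) (trans (cong (λ C → apply C v) (⊗-inverseʳ A D≢0)) (apply-I v)))
      (λ v → trans (sym (apply-⊗ (inv A) A v)) (trans (cong (λ C → apply C v) (⊗-inverseˡ A D≢0)) (apply-I v)))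
    isotopy : ∀ x y → rescale (product l t (apply A x) (apply A y)) ≡ product l t′ x y
    isotopy (a , b) (c , d) = begin
      rescale (product l t (a′ , b′) (c′ , d′))
        ≡⟨ cong rescale (product-bilinear l t a′ b′ c′ d′) ⟩
      (k * (bilinear t (F s c′) (F s d′) a′ b′ + l * bilinear t (F s a′) (F s b′) c′ d′)
        , D ⁻¹ * (apply A (a , b) ∧ apply A (c , d)))
        ≡⟨ cong₂ _,_
             (solve 4 (λ k l u v → k :* (u :+ l :* v) := k :* u :+ l :* (k :* v)) refl
               k l (bilinear t (F s c′) (F s d′) a′ b′) (bilinear t (F s a′) (F s b′) c′ d′))
             (trans (cong (D ⁻¹ *_) (apply-∧ A (a , b) (c , d))) (undo (⁻¹-inverseˡ D≢0) _)) ⟩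
      (k * bilinear t (F s c′) (F s d′) a′ b′ + l * (k * bilinear t (F s a′) (F s b′) c′ d′)
        , (a , b) ∧ (c , d))
        ≡⟨ cong₂ (λ u v → u + l * v , (a , b) ∧ (c , d))
             (bilinear-act t α β γ δ k c d a b) (bilinear-act t α β γ δ k a b c d) ⟨
      (bilinear t′ (F s c) (F s d) a b + l * bilinear t′ (F s a) (F s b) c d , (a , b) ∧ (c , d))
        ≡⟨ product-bilinear l t′ a b c d ⟨
      product l t′ (a , b) (c , d) ∎
      where
      a′ = α * a + β * b
      b′ = γ * a + δ * b
      c′ = α * c + β * d
      d′ = γ * c + δ * d

  member-of-C : EvenIndex m s → ∀ l l≢0 ¬power t → CFamily (B l (inj₂ (l≢0 , ¬power)) t)
  member-of-C ev l l≢0 ¬power (t , leg) =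
    let g , p , eq = diagonalise ev leg
        leg′ = subst Legitimate eq (act-legitimate g leg)
    in l , l≢0 , ¬power , p , leg′ , act-isotopic l (inj₂ (l≢0 , ¬power)) leg leg′ g eq

  -- Equivalence of diagonal forms

  N : Carrier → Carrier
  N x = F s x * x

  N-^ : ∀ x → N x ≡ x ^ suc σ
  N-^ x = *-comm (F s x) x

  diagonal-root : ∀ p x → 1# * x ^ (σ ℕ.+ 1) + 0# * x ^ σ + 0# * x + p ≡ N x + p
  diagonal-root p x = trans (cong (λ u → 1# * u + 0# * x ^ σ + 0# * x + p) (^-suc x σ))
    (solve 3 (λ x̂ x p → con true :* (x̂ :* x) :+ con false :* x̂ :+ con false :* x :+ p := x̂ :* x :+ p)
      refl (F s x) x p)

  diagonal-legitimate : ∀ {p} → (∀ x → N x ≢ p) → Legitimate (diagonal p)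
  diagonal-legitimate {p} ¬N = 1≢0 , λ (x , eq) → ¬N x (x+y≡0⇒x≡y (trans (sym (diagonal-root p x)) eq))

  legitimate⇒≢N : ∀ {p} → Legitimate (diagonal p) → ∀ x → N x ≢ p
  legitimate⇒≢N {p} (_ , noRoot) x refl = noRoot (x , trans (diagonal-root p x) (x+x≡0 p))

  legitimate⇒≢0 : ∀ {p} → Legitimate (diagonal p) → p ≢ 0#
  legitimate⇒≢0 leg p≡0 = legitimate⇒≢N leg 0# (trans (zeroʳ _) (sym p≡0))

  act-diagonal : ∀ p α β γ δ k → scale k (substitute (diagonal p) (mat α β γ δ)) ≡
    [ k * (F s α * α + p * (F s γ * γ)) , k * (F s α * β + p * (F s γ * δ))
    , k * (F s β * α + p * (F s δ * γ)) , k * (F s β * β + p * (F s δ * δ)) ]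
  act-diagonal p α β γ δ k = cong (scale k) (trans (substitute-bilinear (diagonal p) α β γ δ)
    (quad-cong (entry (F s α) (F s γ) α γ) (entry (F s α) (F s γ) β δ)
               (entry (F s β) (F s δ) α γ) (entry (F s β) (F s δ) β δ)))
    where
    entry : ∀ x̂ ŷ x y → bilinear (diagonal p) x̂ ŷ x y ≡ x̂ * x + p * (ŷ * y)
    entry = solve 5 (λ p x̂ ŷ x y →
      con true :* (x̂ :* x) :+ con false :* (x̂ :* y) :+ con false :* (ŷ :* x) :+ p :* (ŷ :* y)
      := x̂ :* x :+ p :* (ŷ :* y)) refl p

  -- Equality of p and p′ up to inversion, modulo the values of `N` on non-zero elements.
  Related : Carrier → Carrier → Set
  Related p p′ = ∃[ z ] z ≢ 0# × (N z * p ≡ p′ ⊎ N z ≡ p * p′)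

  -- Rescaling Y realises the first alternative. Exchanging the variables realises the second, where
  -- the factor `p ⁻¹` restores the leading coefficient 1.
  related⇒∼ : ∀ {p p′} leg leg′ → Related p p′ → (diagonal p , leg) ∼ (diagonal p′ , leg′)
  related⇒∼ {p} {p′} leg leg′ (z , z≢0 , inj₁ eq) =
      ((mat 1# 0# 0# z , det≢0) , (1# , 1≢0))
    , trans (act-diagonal p 1# 0# 0# z 1#) entries
    where
    det≢0 : det (mat 1# 0# 0# z) ≢ 0#
    det≢0 = z≢0 ∘ trans (trans (solve 1 (λ z → z := con true :* z :+ con false :* con false) refl z)
                               (sym (det-+ 1# 0# 0# z)))
    entries : [ 1# * (F s 1# * 1# + p * (F s 0# * 0#)) , 1# * (F s 1# * 0# + p * (F s 0# * z))
              , 1# * (F s 0# * 1# + p * (F s z * 0#)) , 1# * (F s 0# * 0# + p * (F s z * z)) ] ≡ diagonal p′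
    entries rewrite F-0 s | F-1 s = quad-cong
      (solve 1 (λ p → con true :* (con true :* con true :+ p :* (con false :* con false)) := con true) refl p)
      (solve 2 (λ p z → con true :* (con true :* con false :+ p :* (con false :* z)) := con false) refl p z)
      (solve 2 (λ p z → con true :* (con false :* con true :+ p :* (z :* con false)) := con false) refl p (F s z))
      (trans (solve 3 (λ p ẑ z → con true :* (con false :* con false :+ p :* (ẑ :* z)) := ẑ :* z :* p)
               refl p (F s z) z) eq)
  related⇒∼ {p} {p′} leg leg′ (z , z≢0 , inj₂ eq) =
      ((mat 0# z 1# 0# , det≢0) , (p ⁻¹ , ⁻¹-nonZero p≢0))
    , trans (act-diagonal p 0# z 1# 0# (p ⁻¹)) entries
    where
    p≢0 = legitimate⇒≢0 leg
    det≢0 : det (mat 0# z 1# 0#) ≢ 0#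
    det≢0 = z≢0 ∘ trans (trans (solve 1 (λ z → z := con false :* con false :+ z :* con true) refl z)
                               (sym (det-+ 0# z 1# 0#)))
    entries : [ p ⁻¹ * (F s 0# * 0# + p * (F s 1# * 1#)) , p ⁻¹ * (F s 0# * z + p * (F s 1# * 0#))
              , p ⁻¹ * (F s z * 0# + p * (F s 0# * 1#)) , p ⁻¹ * (F s z * z + p * (F s 0# * 0#)) ] ≡ diagonal p′
    entries rewrite F-0 s | F-1 s = quad-cong
      (trans (solve 2 (λ p q → q :* (con false :* con false :+ p :* (con true :* con true)) := q :* p) refl p (p ⁻¹))
             (⁻¹-inverseˡ p≢0))
      (solve 3 (λ p q z → q :* (con false :* z :+ p :* (con true :* con false)) := con false) refl p (p ⁻¹) z)
      (solve 3 (λ p q z → q :* (z :* con false :+ p :* (con false :* con true)) := con false) refl p (p ⁻¹) (F s z))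
      (trans (cong (λ u → p ⁻¹ * (u + p * (0# * 0#))) eq)
        (trans (solve 3 (λ p q p′ → q :* (p :* p′ :+ p :* (con false :* con false)) := (q :* p) :* p′) refl p (p ⁻¹) p′)
          (trans (cong (_* p′) (⁻¹-inverseˡ p≢0)) (*-identityˡ p′))))

  -- The ratio k = z / y lies in the fixed field of σ, where k = j² = N j; hence p = N (j y).
  ≢-crossed : ∀ {p z y} → Legitimate (diagonal p) → y ≢ 0# → F s z * y ≡ p → ¬ F s y * z ≡ p
  ≢-crossed {p} {z} {y} leg y≢0 eq₁ eq₂ = legitimate⇒≢N leg (j * y) (begin
    F s (j * y) * (j * y)  ≡⟨ cong (_* (j * y)) (trans (F-* s j y) (cong (_* F s y) Fj)) ⟩
    j * F s y * (j * y)    ≡⟨ solve 3 (λ j y ŷ → j :* ŷ :* (j :* y) := ŷ :* (j :* j :* y)) refl j y (F s y) ⟩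
    F s y * (j * j * y)    ≡⟨ cong (λ u → F s y * (u * y)) j² ⟩
    F s y * (k * y)        ≡⟨ cong (F s y *_) z≡ ⟨
    F s y * z              ≡⟨ eq₂ ⟩
    p                      ∎)
    where
    open ≡-Reasoning
    k = z * y ⁻¹
    z≡ : z ≡ k * y
    z≡ = sym (trans (*-assoc z _ y) (trans (cong (z *_) (⁻¹-inverseˡ y≢0)) (*-identityʳ z)))
    Fk : F s k ≡ k
    Fk = cancel (*-nonZero (F-nonZero s y≢0) y≢0) (begin
      F s y * y * F s k    ≡⟨ solve 3 (λ ŷ y k → ŷ :* y :* k := k :* ŷ :* y) refl (F s y) y (F s k) ⟩
      F s k * F s y * y    ≡⟨ cong (_* y) (F-* s k y) ⟨
      F s (k * y) * y      ≡⟨ cong (λ u → F s u * y) z≡ ⟨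
      F s z * y            ≡⟨ trans eq₁ (sym eq₂) ⟩
      F s y * z            ≡⟨ cong (F s y *_) z≡ ⟩
      F s y * (k * y)      ≡⟨ solve 3 (λ ŷ y k → ŷ :* (k :* y) := ŷ :* y :* k) refl (F s y) y k ⟩
      F s y * y * k        ∎)
    j = F (ℕ.pred m) k
    j² : j * j ≡ k
    j² = trans (sym (F-suc (ℕ.pred m) k)) (trans (cong (λ e → F e k) (ℕ.suc-pred m)) (F-m k))
    Fj : F s j ≡ j
    Fj = begin
      F s (F (ℕ.pred m) k)     ≡⟨ F-∘ s (ℕ.pred m) k ⟨
      F (s ℕ.+ ℕ.pred m) k     ≡⟨ cong (λ e → F e k) (ℕ.+-comm s (ℕ.pred m)) ⟩
      F (ℕ.pred m ℕ.+ s) k     ≡⟨ F-∘ (ℕ.pred m) s k ⟩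
      F (ℕ.pred m) (F s k)     ≡⟨ cong (F (ℕ.pred m)) Fk ⟩
      F (ℕ.pred m) k           ∎

  divisor : ∀ {x y} → x ≢ 0# → x * y ≡ 0# → y ≡ 0#
  divisor {x} x≢0 eq = cancel x≢0 (trans eq (sym (zeroʳ x)))

  quotient≡ : ∀ {x y} → y ≢ 0# → x ≡ (x * y ⁻¹) * y
  quotient≡ {x} {y} y≢0 = sym (trans (*-assoc x _ y) (trans (cong (x *_) (⁻¹-inverseˡ y≢0)) (*-identityʳ x)))

  -- Division by `F s g * d`; it is used with x and w equal to α/γ and β/δ, in either order.
  crossed : ∀ {p g d} x w → g ≢ 0# → d ≢ 0# → F s (x * g) * (w * d) ≡ p * (F s g * d) → F s x * w ≡ p
  crossed {p} {g} {d} x w g≢0 d≢0 eq = cancel (*-nonZero (F-nonZero s g≢0) d≢0) (begin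
    F s g * d * (F s x * w)    ≡⟨ solve 4 (λ g d x w → g :* d :* (x :* w) := x :* g :* (w :* d)) refl (F s g) d (F s x) w ⟩
    F s x * F s g * (w * d)    ≡⟨ cong (_* (w * d)) (F-* s x g) ⟨
    F s (x * g) * (w * d)      ≡⟨ eq ⟩
    p * (F s g * d)            ≡⟨ *-comm p _ ⟩
    F s g * d * p              ∎)
    where open ≡-Reasoning

  -- The vanishing mixed coefficients force β = 0 if γ = 0, and δ = 0 if α = 0, so the matrix is
  -- diagonal or antidiagonal and the outer coefficients give the relation. If α and γ are non-zero,
  -- then δ = 0 would make the matrix singular, and δ ≠ 0 leads to the two equations excluded by
  -- `≢-crossed`.
  orbit⇒related : ∀ {p p′ α β γ δ k} → Legitimate (diagonal p) → α * δ + β * γ ≢ 0# → k ≢ 0# →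
    k * (F s α * α + p * (F s γ * γ)) ≡ 1# → k * (F s α * β + p * (F s γ * δ)) ≡ 0# →
    k * (F s β * α + p * (F s δ * γ)) ≡ 0# → k * (F s β * β + p * (F s δ * δ)) ≡ p′ →
    Dec (α ≡ 0#) → Dec (γ ≡ 0#) → Dec (δ ≡ 0#) → Related p p′
  orbit⇒related {p} {p′} {α} {β} {γ} {δ} {k} leg D≢0 k≢0 E₁ E₂ E₃ E₄ (yes refl) (yes refl) _ = contradiction
    (solve 2 (λ β δ → con false :* δ :+ β :* con false := con false) refl β δ) D≢0
  orbit⇒related {p} {p′} {α} {β} {γ} {δ} {k} leg D≢0 k≢0 E₁ E₂ E₃ E₄ (yes refl) (no γ≢0) _ = z , z≢0 , inj₂ (sym (begin
    p * p′                              ≡⟨ cong (p *_) E₄ ⟨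
    p * (k * (F s β * β + p * (F s δ * δ)))
      ≡⟨ cong₂ (λ u v → p * (k * (F s u * u + p * (F s v * v)))) (quotient≡ γ≢0) δ≡0 ⟩
    p * (k * (F s (z * γ) * (z * γ) + p * (F s 0# * 0#)))
      ≡⟨ cong (λ u → p * (k * (u * (z * γ) + p * (F s 0# * 0#)))) (F-* s z γ) ⟩
    p * (k * (F s z * F s γ * (z * γ) + p * (F s 0# * 0#)))
      ≡⟨ solve 7 (λ p k ẑ γ̂ z γ o → p :* (k :* (ẑ :* γ̂ :* (z :* γ) :+ p :* (o :* con false)))
           := k :* (o :* con false :+ p :* (γ̂ :* γ)) :* (ẑ :* z)) refl p k (F s z) (F s γ) z γ (F s 0#) ⟩
    k * (F s 0# * 0# + p * (F s γ * γ)) * N z   ≡⟨ cong (_* N z) E₁ ⟩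
    1# * N z                            ≡⟨ *-identityˡ (N z) ⟩
    N z                                 ∎))
    where
    open ≡-Reasoning
    z = β * γ ⁻¹
    δ≡0 : δ ≡ 0#
    δ≡0 = divisor (*-nonZero (legitimate⇒≢0 leg) (F-nonZero s γ≢0)) (trans
      (solve 4 (λ p γ̂ δ β → p :* γ̂ :* δ := con false :* β :+ p :* (γ̂ :* δ)) refl p (F s γ) δ β)
      (trans (cong (λ u → u * β + p * (F s γ * δ)) (sym (F-0 s))) (divisor k≢0 E₂)))
    z≢0 : z ≢ 0#
    z≢0 z≡0 = D≢0 (trans (cong (λ u → 0# * δ + u * γ) (trans (quotient≡ γ≢0) (trans (cong (_* γ) z≡0) (zeroˡ γ))))
      (solve 2 (λ δ γ → con false :* δ :+ con false :* γ := con false) refl δ γ))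
  orbit⇒related {p} {p′} {α} {β} {γ} {δ} {k} leg D≢0 k≢0 E₁ E₂ E₃ E₄ (no α≢0) (yes refl) _ = z , z≢0 , inj₁ (sym (begin
    p′                                  ≡⟨ E₄ ⟨
    k * (F s β * β + p * (F s δ * δ))
      ≡⟨ cong₂ (λ u v → k * (F s u * u + p * (F s v * v))) β≡0 (quotient≡ α≢0) ⟩
    k * (F s 0# * 0# + p * (F s (z * α) * (z * α)))
      ≡⟨ cong (λ u → k * (F s 0# * 0# + p * (u * (z * α)))) (F-* s z α) ⟩
    k * (F s 0# * 0# + p * (F s z * F s α * (z * α)))
      ≡⟨ solve 7 (λ p k ẑ α̂ z α o → k :* (o :* con false :+ p :* (ẑ :* α̂ :* (z :* α)))
           := k :* (α̂ :* α :+ p :* (o :* con false)) :* (ẑ :* z :* p)) refl p k (F s z) (F s α) z α (F s 0#) ⟩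
    k * (F s α * α + p * (F s 0# * 0#)) * (N z * p)   ≡⟨ cong (_* (N z * p)) E₁ ⟩
    1# * (N z * p)                      ≡⟨ *-identityˡ _ ⟩
    N z * p                             ∎))
    where
    open ≡-Reasoning
    z = δ * α ⁻¹
    β≡0 : β ≡ 0#
    β≡0 = divisor (F-nonZero s α≢0) (trans
      (solve 4 (λ p α̂ δ β → α̂ :* β := α̂ :* β :+ p :* (con false :* δ)) refl p (F s α) δ β)
      (trans (cong (λ u → F s α * β + p * (u * δ)) (sym (F-0 s))) (divisor k≢0 E₂)))
    z≢0 : z ≢ 0#
    z≢0 z≡0 = D≢0 (trans (cong (λ u → α * u + β * 0#) (trans (quotient≡ α≢0) (trans (cong (_* α) z≡0) (zeroˡ α))))
      (solve 2 (λ α β → α :* con false :+ β :* con false := con false) refl α β))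
  orbit⇒related {p} {p′} {α} {β} {γ} {δ} {k} leg D≢0 k≢0 E₁ E₂ E₃ E₄ (no α≢0) (no γ≢0) (yes refl) = contradiction
    (trans (cong (λ u → α * 0# + u * γ) β≡0)
      (solve 2 (λ α γ → α :* con false :+ con false :* γ := con false) refl α γ)) D≢0
    where
    β≡0 : β ≡ 0#
    β≡0 = divisor (F-nonZero s α≢0) (trans
      (solve 4 (λ p α̂ γ̂ β → α̂ :* β := α̂ :* β :+ p :* (γ̂ :* con false)) refl p (F s α) (F s γ) β)
      (divisor k≢0 E₂))
  orbit⇒related {p} {p′} {α} {β} {γ} {δ} {k} leg D≢0 k≢0 E₁ E₂ E₃ E₄ (no α≢0) (no γ≢0) (no δ≢0) =
    contradiction eq₂ (≢-crossed leg y≢0 eq₁)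
    where
    z = α * γ ⁻¹
    y = β * δ ⁻¹
    eq₁ : F s z * y ≡ p
    eq₁ = crossed z y γ≢0 δ≢0 (trans (sym (cong₂ (λ a b → F s a * b) (quotient≡ γ≢0) (quotient≡ δ≢0)))
      (x+y≡0⇒x≡y (divisor k≢0 E₂)))
    eq₂ : F s y * z ≡ p
    eq₂ = crossed y z δ≢0 γ≢0 (trans (sym (cong₂ (λ a b → F s a * b) (quotient≡ δ≢0) (quotient≡ γ≢0)))
      (x+y≡0⇒x≡y (divisor k≢0 E₃)))
    y≢0 : y ≢ 0#
    y≢0 y≡0 = legitimate⇒≢0 leg (trans (sym eq₁) (trans (cong (F s z *_) y≡0) (zeroʳ _)))

  ∼⇒related : ∀ {p p′} leg leg′ → (diagonal p , leg) ∼ (diagonal p′ , leg′) → Related p p′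
  ∼⇒related {p} {p′} leg _ (((mat α β γ δ , D≢0) , (k , k≢0)) , eq) = orbit⇒related leg
    (D≢0 ∘ trans (det-+ α β γ δ)) k≢0
    (cong Quadruple.p₁ entries) (cong Quadruple.p₂ entries)
    (cong Quadruple.p₃ entries) (cong Quadruple.p₄ entries)
    (α ≟ 0#) (γ ≟ 0#) (δ ≟ 0#)
    where entries = trans (sym (act-diagonal p α β γ δ k)) eq

-- Counting the orbits

module OrbitCount {m : ℕ} .{{_ : NonZero m}} (L : FiniteField (2 ℕ.^ m)) (s : ℕ) (ev : EvenIndex m s) where
  open Forms {m} L s
  module E = EvenIndex ev

  Q M H : ℕ
  Q = 2 ℕ.^ E.d
  M = suc Q
  H = 2 ℕ.^ (E.d ℕ.∸ 1)

  Q≡H+H : Q ≡ H ℕ.+ H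
  Q≡H+H = begin
    2 ℕ.^ E.d                       ≡⟨ cong (2 ℕ.^_) (ℕ.m+[n∸m]≡n (ℕ.>-nonZero⁻¹ E.d {{gcd-nonZero m s}})) ⟨
    H ℕ.+ (H ℕ.+ 0)                 ≡⟨ cong (H ℕ.+_) (ℕ.+-identityʳ H) ⟩
    H ℕ.+ H                         ∎
    where open ≡-Reasoning

  2^[j*d]≡Q^j : ∀ j → 2 ℕ.^ (j ℕ.* E.d) ≡ Q ℕ.^ j
  2^[j*d]≡Q^j j = trans (cong (2 ℕ.^_) (ℕ.*-comm j E.d)) (sym (ℕ.^-*-assoc 2 E.d j))

  -- Q ≡ -1 modulo `M`, and 2^m = Q^r with `r` even.
  M∣n : M ∣ n
  M∣n = let c , eq = ^-even (ℕ.pred Q) E.h in divides c (ℕ.suc-injective (begin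
    suc n                             ≡⟨ 2^m≡1+n ⟨
    2 ℕ.^ m                           ≡⟨ cong (2 ℕ.^_) E.m≡ ⟨
    2 ℕ.^ (E.r ℕ.* E.d)               ≡⟨ 2^[j*d]≡Q^j E.r ⟩
    Q ℕ.^ E.r                         ≡⟨ cong (ℕ._^ E.r) 1+w≡Q ⟨
    suc (ℕ.pred Q) ℕ.^ E.r            ≡⟨ eq ⟩
    suc (c ℕ.* suc (suc (ℕ.pred Q)))  ≡⟨ cong (λ q → suc (c ℕ.* suc q)) 1+w≡Q ⟩
    suc (c ℕ.* M)                     ∎))
    where
    open ≡-Reasoning
    1+w≡Q : suc (ℕ.pred Q) ≡ Q
    1+w≡Q = ℕ.suc-pred Q {{ℕ.m^n≢0 2 E.d}}

  -- Here σ = Q^s′ with `s′` odd.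
  M∣1+σ : M ∣ suc σ
  M∣1+σ = let e , s′≡ = odd-factor {E.s′} {E.i} {E.h} {E.y} E.inverse in
    subst (λ q → M ∣ suc q) (begin
      Q ℕ.^ suc (e ℕ.+ e)     ≡⟨ cong (Q ℕ.^_) s′≡ ⟨
      Q ℕ.^ E.s′              ≡⟨ 2^[j*d]≡Q^j E.s′ ⟨
      2 ℕ.^ (E.s′ ℕ.* E.d)    ≡⟨ cong (2 ℕ.^_) E.s≡ ⟩
      σ                       ∎) (1+a∣1+a^odd Q {{ℕ.m^n≢0 2 E.d}} e)
    where open ≡-Reasoning

  1+σ∣1+2^is : suc σ ∣ suc (2 ℕ.^ (E.i ℕ.* s))
  1+σ∣1+2^is = let e , i≡ = odd-factor {E.i} {E.s′} {E.h} {E.y} (trans (ℕ.*-comm E.i E.s′) E.inverse) in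
    subst (λ q → suc σ ∣ suc q) (begin
      σ ℕ.^ suc (e ℕ.+ e)     ≡⟨ cong (σ ℕ.^_) i≡ ⟨
      σ ℕ.^ E.i               ≡⟨ ℕ.^-*-assoc 2 s E.i ⟩
      2 ℕ.^ (s ℕ.* E.i)       ≡⟨ cong (2 ℕ.^_) (ℕ.*-comm s E.i) ⟩
      2 ℕ.^ (E.i ℕ.* s)       ∎) (1+a∣1+a^odd σ {{ℕ.m^n≢0 2 s}} e)
    where open ≡-Reasoning

  -- The i-th iterate of σ is x ↦ x^Q, so y^M = y^(1 + σ^i), and since `i` is odd 1 + σ divides this
  -- exponent. Together with `M∣1+σ`, the values of `N` are exactly the `M`-th powers.
  ^M≡N : ∀ y → ∃[ c ] N (y ^ c) ≡ y ^ M
  ^M≡N y = quotient 1+σ∣1+2^is , (begin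
    N (y ^ c)                     ≡⟨ N-^ (y ^ c) ⟩
    (y ^ c) ^ suc σ               ≡⟨ ^-assocʳ y c (suc σ) ⟩
    y ^ (c ℕ.* suc σ)             ≡⟨ cong (y ^_) (m∣n⇒n≡quotient*m 1+σ∣1+2^is) ⟨
    y * F (E.i ℕ.* s) y           ≡⟨ cong (y *_) (F-i*s ev y) ⟩
    y ^ M                         ∎)
    where
    open ≡-Reasoning
    c = quotient 1+σ∣1+2^is

  g : Carrier
  g = proj₁ (primitive-element n>0)

  g-order : HasOrder g n
  g-order = proj₂ (primitive-element n>0)

  g≢0 : g ≢ 0#
  g≢0 g≡0 = 1≢0 (trans (sym (proj₁ g-order)) (trans (cong (_^ n) g≡0) (0^n≡0 n {{ℕ.>-nonZero n>0}})))

  -- An exponent of `g` is determined modulo n, hence modulo its divisor `M`.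
  exponents-mod : ∀ a b → g ^ a ≡ g ^ b → a ℕ.% M ≡ b ℕ.% M
  exponents-mod a b eq = go (ℕ.≤-total a b)
    where
    ordered : ∀ {a b} → a ℕ.≤ b → g ^ a ≡ g ^ b → a ℕ.% M ≡ b ℕ.% M
    ordered {a} {b} a≤b eq = sym (begin
      b ℕ.% M                       ≡⟨ cong (ℕ._% M) (ℕ.m+[n∸m]≡n a≤b) ⟨
      (a ℕ.+ (b ℕ.∸ a)) ℕ.% M       ≡⟨ cong (λ k → (a ℕ.+ k) ℕ.% M) (m∣n⇒n≡quotient*m M∣b∸a) ⟩
      (a ℕ.+ quotient M∣b∸a ℕ.* M) ℕ.% M  ≡⟨ [m+kn]%n≡m%n a (quotient M∣b∸a) M ⟩
      a ℕ.% M                       ∎)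
      where
      open ≡-Reasoning
      M∣b∸a : M ∣ b ℕ.∸ a
      M∣b∸a = ∣-trans M∣n (order-∣∸ g-order {{ℕ.>-nonZero n>0}} a≤b eq)
    go : a ℕ.≤ b ⊎ b ℕ.≤ a → a ℕ.% M ≡ b ℕ.% M
    go (inj₁ a≤b) = ordered a≤b eq
    go (inj₂ b≤a) = sym (ordered b≤a (sym eq))

  N-g^ : ∀ k → ∃[ c ] N (g ^ k) ≡ g ^ (c ℕ.* M)
  N-g^ k = k ℕ.* quotient M∣1+σ , (begin
    N (g ^ k)                           ≡⟨ N-^ (g ^ k) ⟩
    (g ^ k) ^ suc σ                     ≡⟨ ^-assocʳ g k (suc σ) ⟩
    g ^ (k ℕ.* suc σ)                   ≡⟨ cong (λ e → g ^ (k ℕ.* e)) (m∣n⇒n≡quotient*m M∣1+σ) ⟩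
    g ^ (k ℕ.* (quotient M∣1+σ ℕ.* M))  ≡⟨ cong (g ^_) (ℕ.*-assoc k (quotient M∣1+σ) M) ⟨
    g ^ (k ℕ.* quotient M∣1+σ ℕ.* M)    ∎)
    where open ≡-Reasoning

  N≡g^ : ∀ {z} → z ≢ 0# → ∃[ c ] N z ≡ g ^ (c ℕ.* M)
  N≡g^ z≢0 = let k , z≡ = discrete-log n>0 g-order z≢0
                 c , eq = N-g^ k
             in c , trans (cong N z≡) eq

  N≡g^⇒M∣ : ∀ {z} a → z ≢ 0# → N z ≡ g ^ a → M ∣ a
  N≡g^⇒M∣ a z≢0 eq = let c , eq′ = N≡g^ z≢0 in
    m%n≡0⇒n∣m a M (trans (exponents-mod a (c ℕ.* M) (trans (sym eq) eq′)) ([m+kn]%n≡m%n 0 c M))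

  H<M : H ℕ.< M
  H<M = s≤s (subst (H ℕ.≤_) (sym Q≡H+H) (ℕ.m≤m+n H H))

  -- As M = 2 H + 1, the exponents 1, ..., H represent the non-zero classes modulo `M` up to sign.
  -- The shift by one skips class 0, which consists of values of `N`.
  representative : Fin H → Ω
  representative i = diagonal (g ^ suc (Fin.toℕ i)) , diagonal-legitimate λ x eq →
    ℕ.<⇒≱ (ℕ.≤-<-trans (Fin.toℕ<n i) H<M) (∣⇒≤ (N≡g^⇒M∣ _ (x≢0 x eq) eq))
    where
    x≢0 : ∀ x → N x ≡ g ^ suc (Fin.toℕ i) → x ≢ 0#
    x≢0 x eq refl = ^-nonZero (suc (Fin.toℕ i)) g≢0 (trans (sym eq) (zeroʳ _))

  -- Related exponents are congruent modulo `M` or have a sum divisible by `M`. The sum is positive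
  -- and at most 2 H < M, so only the first can happen.
  representative-injective : ∀ i j → representative i ∼ representative j → i ≡ j
  representative-injective i j i∼j =
    go (∼⇒related (proj₂ (representative i)) (proj₂ (representative j)) i∼j)
    where
    open ≡-Reasoning
    a = Fin.toℕ i
    b = Fin.toℕ j
    residue : ∀ (i : Fin H) → suc (Fin.toℕ i) ℕ.% M ≡ suc (Fin.toℕ i)
    residue i = m<n⇒m%n≡m (ℕ.≤-<-trans (Fin.toℕ<n i) H<M)
    go : Related (g ^ suc a) (g ^ suc b) → i ≡ j
    go (z , z≢0 , inj₁ eq) = let c , Nz = N≡g^ z≢0 in Fin.toℕ-injective (ℕ.suc-injective (begin
      suc a                           ≡⟨ residue i ⟨
      suc a ℕ.% M                     ≡⟨ [m+kn]%n≡m%n (suc a) c M ⟨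
      (suc a ℕ.+ c ℕ.* M) ℕ.% M       ≡⟨ exponents-mod (suc a ℕ.+ c ℕ.* M) (suc b) (begin
        g ^ (suc a ℕ.+ c ℕ.* M)       ≡⟨ ^-homo-* g (suc a) (c ℕ.* M) ⟩
        g ^ suc a * g ^ (c ℕ.* M)     ≡⟨ *-comm (g ^ suc a) _ ⟩
        g ^ (c ℕ.* M) * g ^ suc a     ≡⟨ cong (_* g ^ suc a) Nz ⟨
        N z * g ^ suc a               ≡⟨ eq ⟩
        g ^ suc b                     ∎) ⟩
      suc b ℕ.% M                     ≡⟨ residue j ⟩
      suc b                           ∎))
    go (z , z≢0 , inj₂ eq) = contradiction
      (∣⇒≤ (N≡g^⇒M∣ (suc a ℕ.+ suc b) z≢0 (trans eq (sym (^-homo-* g (suc a) (suc b))))))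
      (ℕ.<⇒≱ (s≤s (subst (suc a ℕ.+ suc b ℕ.≤_) (sym Q≡H+H) (ℕ.+-mono-≤ (Fin.toℕ<n i) (Fin.toℕ<n j)))))

  representative-diagonal : ∀ {p} (leg : Legitimate (diagonal p)) → ∃[ i ] representative i ∼ (diagonal p , leg)
  representative-diagonal {p} leg = go (j ℕ.% M) (m%n<n j M) (m≡m%n+[m/n]*n j M) (j ℕ.% M ℕ.≤? H)
    where
    open ≡-Reasoning
    log = discrete-log n>0 g-order (legitimate⇒≢0 leg)
    j = proj₁ log
    c = j ℕ./ M
    p≡ : p ≡ g ^ j
    p≡ = proj₂ log
    class : ∀ k → k ℕ.< H → Related (g ^ suc k) p → ∃[ i ] representative i ∼ (diagonal p , leg)
    class k k<H rel = Fin.fromℕ< k<H , related⇒∼ (proj₂ (representative (Fin.fromℕ< k<H))) leg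
      (subst (λ k → Related (g ^ suc k) p) (sym (Fin.toℕ-fromℕ< k<H)) rel)
    N-g^*M : ∀ k → ∃[ z ] z ≢ 0# × N z ≡ g ^ (k ℕ.* M)
    N-g^*M k = let c , eq = ^M≡N (g ^ k) in
      (g ^ k) ^ c , ^-nonZero c (^-nonZero k g≢0) , trans eq (^-assocʳ g k M)
    go : ∀ e → e ℕ.< M → j ≡ e ℕ.+ c ℕ.* M → Dec (e ℕ.≤ H) → ∃[ i ] representative i ∼ (diagonal p , leg)
    -- In class 0 the element p is a value of `N`, contrary to legitimacy.
    go zero _ j≡ _ = let z , _ , eq = N-g^*M c in
      contradiction (trans eq (trans (cong (g ^_) (sym j≡)) (sym p≡))) (legitimate⇒≢N leg z)
    go (suc e) _ j≡ (yes e<H) = let z , z≢0 , eq = N-g^*M c in class e e<H (z , z≢0 , inj₁ (begin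
      N z * g ^ suc e               ≡⟨ cong (_* g ^ suc e) eq ⟩
      g ^ (c ℕ.* M) * g ^ suc e     ≡⟨ *-comm _ (g ^ suc e) ⟩
      g ^ suc e * g ^ (c ℕ.* M)     ≡⟨ ^-homo-* g (suc e) (c ℕ.* M) ⟨
      g ^ (suc e ℕ.+ c ℕ.* M)       ≡⟨ cong (g ^_) j≡ ⟨
      g ^ j                         ≡⟨ p≡ ⟨
      p                             ∎))
    -- A residue above H is replaced by its negative M - (1 + e), which has index Q - (1 + e). The
    -- two exponents then add up to (c + 1) M, giving the second alternative of `Related`.
    go (suc e) (s≤s 1+e≤Q) j≡ (no H≮1+e) = let z , z≢0 , eq = N-g^*M (suc c) in
      class (Q ℕ.∸ suc e)
        (ℕ.+-cancelʳ-< (suc e) _ _ (subst (ℕ._< H ℕ.+ suc e) (sym (trans (ℕ.m∸n+n≡m 1+e≤Q) Q≡H+H))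
          (ℕ.+-monoʳ-< H (ℕ.≰⇒> H≮1+e))))
        (z , z≢0 , inj₂ (begin
          N z                                                   ≡⟨ eq ⟩
          g ^ (M ℕ.+ c ℕ.* M)                                   ≡⟨ cong (λ k → g ^ (suc k ℕ.+ c ℕ.* M)) (ℕ.m∸n+n≡m 1+e≤Q) ⟨
          g ^ (suc (Q ℕ.∸ suc e) ℕ.+ suc e ℕ.+ c ℕ.* M)         ≡⟨ cong (g ^_) (trans (ℕ.+-assoc (suc (Q ℕ.∸ suc e)) (suc e) _)
                                                                     (cong (suc (Q ℕ.∸ suc e) ℕ.+_) (sym j≡))) ⟩
          g ^ (suc (Q ℕ.∸ suc e) ℕ.+ j)                         ≡⟨ ^-homo-* g (suc (Q ℕ.∸ suc e)) j ⟩
          g ^ suc (Q ℕ.∸ suc e) * g ^ j                         ≡⟨ cong (g ^ suc (Q ℕ.∸ suc e) *_) p≡ ⟨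
          g ^ suc (Q ℕ.∸ suc e) * p                             ∎))

  private module O = Setoid Orbits

  class : ∀ t → ∃[ i ] representative i ∼ t
  class (t , leg) =
    let γ , p , eq = diagonalise ev leg
        leg′ = subst Legitimate eq (act-legitimate γ leg)
        i , rel = representative-diagonal leg′
    in i , O.trans {representative i} {diagonal p , leg′} {t , leg} rel
             (O.sym {t , leg} {diagonal p , leg′} (γ , eq))

  orbit-count : HasCardinality Orbits H
  orbit-count = record
    { to        = proj₁ ∘ class
    ; from      = representative
    ; to-cong   = λ {t} {t′} t∼t′ → representative-injective _ _
        (O.trans {representative (proj₁ (class t))} {t} {representative (proj₁ (class t′))} (proj₂ (class t))
          (O.trans {t} {t′} {representative (proj₁ (class t′))} t∼t′
            (O.sym {representative (proj₁ (class t′))} {t′} (proj₂ (class t′)))))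
    ; from-cong = λ { {i} refl → O.refl {representative i} }
    ; inverse   = (λ {i} {t} t∼i → representative-injective (proj₁ (class t)) i
                    (O.trans {representative (proj₁ (class t))} {t} {representative i} (proj₂ (class t)) t∼i))
                , (λ { {t} refl → proj₂ (class t) })
    }

theorem5 :
  (m s : ℕ) .{{_ : NonZero m}} → s ℕ.< 2 ℕ.* m → (L : FiniteField (2 ℕ.^ m)) →
  let open FiniteField L hiding (_^_)
      open FamilyB {m} L s
      d = gcd m s
  in
  2 ∣ ℕ._/_ m d {{gcd-nonZero m s}} →
  ((l : Carrier) (l≢0 : l ≢ 0#) (¬power : ¬ IsPower l) (t : Ω) →
     CFamily (B l (inj₂ (l≢0 , ¬power)) t))
  × HasCardinality Orbits (2 ℕ.^ (d ℕ.∸ 1))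
theorem5 m s _ L 2∣m/d = Forms.member-of-C {m} L s ev , OrbitCount.orbit-count {m} L s ev
  where ev = evenIndex m s 2∣m/d
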